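{- Let $n\ge 6$ and run the CDCL solver described below on $OP_n$. Then the sequence of clauses learned by the solver is exactly the following, in this exact order. (Head) $C(1,n-2)$, $C(1,n-3)$. (Descending Cascade) For each $j$ descending from $n-2$ to $2$, the block $C(j,n-2), C(j,n-3),\dots,C(j,j-1)$. (Tail) $C(1,n-4), C(1,n-5),\dots,C(1,2)$. After learning these clauses, the solver derives that $OP_n$ is unsatisfiable.
   Context: Ordering principle: for $n\ge 1$, the variables are $P_{i,j}$ for $1\le i,j\le n$ with $i\ne j$. The formula $OP_n$ is the conjunction of three families of clauses. - Transitivity clauses: $A(i,j,k)=\neg P_{i,j}\lor\neg P_{j,k}\lor P_{i,k}$ for pairwise distinct $i,j,k$. - Antisymmetry clauses: $B(i,j)=\neg P_{i,j}\lor\neg P_{j,i}$ for $i\ne j$. - Non-minimality clauses: $D(j)=\bigvee_{i\ne j}P_{i,j}$ for each $j$. For a column $j$, let $\mathcal{L}_j=\langle P_{1,j},\dots,P_{j-1,j},P_{j+1,j},\dots,P_{n,j}\rangle$ be the variables of column $j$ in increasing row order. $C(j,k)$ denotes the disjunction of the first $k$ variables of $\mathcal{L}_j$ (all positive). CDCL configuration: - Propagation and conflicts: unit propagation; on a conflict, 1UIP clause learning. Learned clauses are kept forever (no deletion). The solver restarts (backtracks to decision level 0) after every conflict. A conflict reached with no decisions yields UNSAT. - Branching: VSIDS. Scores start at $0$, and after the $t$-th conflict $q(x,t)=b(x,t)+\delta q(x,t-1)$, where $b(x,t)=1$ iff $x$ occurs in the clause learned at conflict $t$. The decay factor is $\delta\le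 1/2$. Each decision picks an unassigned variable of highest score. Ties are broken by taking the first such variable in the column-major order $P_{2,1},\dots,P_{n,1},P_{1,2},\dots,P_{n,2},\dots,P_{1,n},\dots,P_{n-1,n}$. - Phase: decided variables are always assigned false.
   Formalization: The decay factor δ is taken rational with 0 < δ ≤ 1/2, and unit propagation is read as queue-based (trail literals processed in order, clauses for each literal in any order); learned clauses are compared as sets of literals. -}

module Defs where

open import Data.Nat as ℕ using (ℕ; zero; suc; _∸_)
open import Data.Bool using (Bool; true; false; if_then_else_; not; _∧_)
open import Data.List using (List; []; _∷_; _++_; map; filter; concatMap; take; drop;
  upTo; length; reverse; foldl; deduplicate; _∷ʳ_)
open import Data.Bool.ListAction using (any)
open import Data.Product using (_×_; _,_; proj₁; proj₂)
open import Data.Product.Properties using (≡-dec)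
open import Data.Maybe using (Maybe; just; nothing)
open import Data.Rational as ℚ using (ℚ; 0ℚ; 1ℚ)
open import Data.Rational.Properties as ℚP using ()
open import Relation.Binary.PropositionalEquality using (_≡_; refl; _≢_)
open import Relation.Binary.Definitions using (DecidableEquality)
open import Relation.Nullary using (¬?; yes; no; Dec)
open import Relation.Nullary.Decidable using (⌊_⌋)
open import Data.List.Membership.Propositional using (_∈_)
open import Data.List.Membership.DecPropositional as DecMem using ()
open import Data.List.Relation.Binary.BagAndSetEquality using (_∼[_]_; set)
open import Data.List.Relation.Binary.Pointwise using (Pointwise)
open import Relation.Binary.Construct.Closure.ReflexiveTransitive using (Star)
open import Induction.WellFounded using (Acc)

-- Variables, literals, clauses
-- The variable P_{i,j} is represented by the pair (i , j) of natural
-- numbers, with the paper's 1-based indices 1 ≤ i, j ≤ n, i ≠ j.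

Var : Set
Var = ℕ × ℕ

_≟V_ : DecidableEquality Var
_≟V_ = ≡-dec ℕ._≟_ ℕ._≟_

data Lit : Set where
  pos : Var → Lit
  neg : Var → Lit

var : Lit → Var
var (pos x) = x
var (neg x) = x

complement : Lit → Lit
complement (pos x) = neg x
complement (neg x) = pos x

_≟L_ : DecidableEquality Lit
pos x ≟L pos y with x ≟V y
... | yes refl = yes refl
... | no x≢y = no λ { refl → x≢y refl }
pos x ≟L neg y = no λ ()
neg x ≟L pos y = no λ ()
neg x ≟L neg y with x ≟V y
... | yes refl = yes refl
... | no x≢y = no λ { refl → x≢y refl }

Clause : Set
Clause = List Lit

idx : ℕ → List ℕ
idx n = map suc (upTo n)

column : ℕ → ℕ → List Var
column n j = map (λ i → (i , j)) (filter (λ i → ¬? (i ℕ.≟ j)) (idx n))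

variables : ℕ → List Var
variables n = concatMap (column n) (idx n)

A : ℕ → ℕ → ℕ → Clause
A i j k = neg (i , j) ∷ neg (j , k) ∷ pos (i , k) ∷ []

B : ℕ → ℕ → Clause
B i j = neg (i , j) ∷ neg (j , i) ∷ []

D : ℕ → ℕ → Clause
D n j = map pos (column n j)

C : ℕ → ℕ → ℕ → Clause
C n j k = take k (map pos (column n j))

distinct : ℕ → ℕ → Bool
distinct i j = not ⌊ i ℕ.≟ j ⌋

when : {X : Set} → Bool → X → List X
when true x = x ∷ []
when false x = []

transitivity : ℕ → List Clause
transitivity n =
  concatMap (λ i → concatMap (λ j → concatMap (λ k →
    when (distinct i j ∧ distinct j k ∧ distinct i k) (A i j k))
    (idx n)) (idx n)) (idx n)

antisymmetry : ℕ → List Clause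
antisymmetry n =
  concatMap (λ i → concatMap (λ j → when (distinct i j) (B i j)) (idx n)) (idx n)

nonMinimality : ℕ → List Clause
nonMinimality n = map (D n) (idx n)

OP : ℕ → List Clause
OP n = transitivity n ++ antisymmetry n ++ nonMinimality n

-- a trail entry: a literal made true, with its reason
-- (nothing = decision, just c = propagated by clause c)
record Entry : Set where
  constructor entry
  field
    lit    : Lit
    reason : Maybe Clause
open Entry public

Trail : Set
Trail = List Entry   -- chronological order (oldest first)

isTrue : Trail → Lit → Bool
isTrue t l = any (λ e → ⌊ lit e ≟L l ⌋) t

isFalse : Trail → Lit → Bool
isFalse t l = isTrue t (complement l)

isAssigned : Trail → Var → Bool
isAssigned t x = any (λ e → ⌊ var (lit e) ≟V x ⌋) t

data Status : Set where
  satisfied  : Status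
  falsified  : Status
  unit       : Lit → Status
  unresolved : Status

status : Trail → Clause → Status
status t c with any (isTrue t) c
... | true = satisfied
... | false with deduplicate _≟L_ (filter (λ l → ¬? (Data.Bool._≟_ (isFalse t l) true)) c)
...   | [] = falsified
...   | m ∷ [] = unit m
...   | _ ∷ _ ∷ _ = unresolved

data Quiet : Status → Set where
  sat-quiet : Quiet satisfied
  unr-quiet : Quiet unresolved

isDecision : Entry → Bool
isDecision e with reason e
... | nothing = true
... | just _ = false

hasDecision : Trail → Bool
hasDecision t = any isDecision t

bump : Clause → Var → ℚ
bump c x = if any (λ l → ⌊ var l ≟V x ⌋) c then 1ℚ else 0ℚ

-- q(x, t) = b(x, t) + δ q(x, t-1), q(x, 0) = 0,
-- for the learned clauses listed in chronological order
score : ℚ → List Clause → Var → ℚ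
score δ ls x = foldl (λ q c → bump c x ℚ.+ δ ℚ.* q) 0ℚ ls

pickFirstMax : (Var → ℚ) → Maybe Var → List Var → Maybe Var
pickFirstMax s best [] = best
pickFirstMax s nothing (x ∷ xs) = pickFirstMax s (just x) xs
pickFirstMax s (just b) (x ∷ xs) =
  if ⌊ s b ℚP.<? s x ⌋ then pickFirstMax s (just x) xs
                       else pickFirstMax s (just b) xs

pick : ℕ → ℚ → List Clause → Trail → Maybe Var
pick n δ ls t =
  pickFirstMax (score δ ls) nothing (filter (λ x → ¬? (Data.Bool._≟_ (isAssigned t x) true)) (variables n))

-- entries of the current decision level, most recent first
-- (input: trail most recent first)
currentLevel : List Entry → List Entry
currentLevel [] = []
currentLevel (e ∷ es) with reason e
... | nothing = e ∷ []
... | just _  = e ∷ currentLevel es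

countAt : List Var → Clause → ℕ
countAt vs cl = length (filter (λ l → DecMem._∈?_ _≟V_ (var l) vs) cl)

resolve : Clause → Lit → Clause → Clause
resolve cl x r =
  deduplicate _≟L_ (filter (λ l → ¬? (l ≟L complement x)) cl ++ filter (λ l → ¬? (l ≟L x)) r)

-- walk back through the current level, resolving with reasons, until
-- exactly one literal of the current level remains (first UIP)
analyzeGo : List Var → List Entry → Clause → Clause
analyzeGo vs [] cl = cl
analyzeGo vs (e ∷ es) cl with countAt vs cl ℕ.≤? 1
... | yes _ = cl
... | no _ with DecMem._∈?_ _≟L_ (complement (lit e)) cl | reason e
...   | yes _ | just r  = analyzeGo vs es (resolve cl (lit e) r)
...   | yes _ | nothing = cl
...   | no _  | _       = analyzeGo vs es cl

analyze : Trail → Clause → Clause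
analyze t c =
  let seg = currentLevel (reverse t) in
  analyzeGo (map (λ e → var (lit e)) seg) seg (deduplicate _≟L_ c)

record State : Set where
  constructor ⟨_,_,_⟩
  field
    learned : List Clause   -- learned clauses, chronological order
    trail   : Trail
    done    : ℕ             -- number of trail entries already processed
                            -- by unit propagation (propagation queue)

data Config : Set where
  running : State → Config
  unsat   : List Clause → Config

DB : ℕ → List Clause → List Clause
DB n ls = OP n ++ ls

onConflict : List Clause → Trail → Clause → Config
onConflict ls t c =
  if hasDecision t then running ⟨ ls ∷ʳ analyze t c , [] , 0 ⟩ else unsat ls

-- Unit propagation processes the trail literals in order (a queue):
-- for the pending literal l, the clauses containing ¬l are visited in
-- an arbitrary order; a unit clause enqueues its literal, a falsified
-- clause is a conflict.  Once no clause containing ¬l is unit or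
-- falsified, l is done.  With an empty queue, a unit clause (a learned
-- unit clause at level 0) is propagated; otherwise a decision is made.
data Step (n : ℕ) (δ : ℚ) : Config → Config → Set where
  propagate : ∀ {ls t k e rest c m} →
    drop k t ≡ e ∷ rest → c ∈ DB n ls → complement (lit e) ∈ c →
    status t c ≡ unit m →
    Step n δ (running ⟨ ls , t , k ⟩) (running ⟨ ls , t ∷ʳ entry m (just c) , k ⟩)
  conflict : ∀ {ls t k e rest c} →
    drop k t ≡ e ∷ rest → c ∈ DB n ls → complement (lit e) ∈ c →
    status t c ≡ falsified →
    Step n δ (running ⟨ ls , t , k ⟩) (onConflict ls t c)
  advance : ∀ {ls t k e rest} →
    drop k t ≡ e ∷ rest →
    (∀ c → c ∈ DB n ls → complement (lit e) ∈ c → Quiet (status t c)) →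
    Step n δ (running ⟨ ls , t , k ⟩) (running ⟨ ls , t , suc k ⟩)
  propagate₀ : ∀ {ls t k c m} →
    drop k t ≡ [] → c ∈ DB n ls → status t c ≡ unit m →
    Step n δ (running ⟨ ls , t , k ⟩) (running ⟨ ls , t ∷ʳ entry m (just c) , k ⟩)
  conflict₀ : ∀ {ls t k c} →
    drop k t ≡ [] → c ∈ DB n ls → status t c ≡ falsified →
    Step n δ (running ⟨ ls , t , k ⟩) (onConflict ls t c)
  decide : ∀ {ls t k x} →
    drop k t ≡ [] → (∀ c → c ∈ DB n ls → Quiet (status t c)) →
    pick n δ ls t ≡ just x →
    Step n δ (running ⟨ ls , t , k ⟩) (running ⟨ ls , t ∷ʳ entry (neg x) nothing , k ⟩)

initial : Config
initial = running ⟨ [] , [] , 0 ⟩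

Stuck : ℕ → ℚ → Config → Set
Stuck n δ c = ∀ c′ → Step n δ c c′ → Data.Empty.⊥
  where import Data.Empty

-- [a, a-1, …, b]   (for b ≤ a)
descending : ℕ → ℕ → List ℕ
descending a b = map (λ i → a ∸ i) (upTo (suc (a ∸ b)))

expectedLearned : ℕ → List Clause
expectedLearned n =
  (C n 1 (n ∸ 2) ∷ C n 1 (n ∸ 3) ∷ [])
  ++ concatMap (λ j → map (C n j) (descending (n ∸ 2) (j ∸ 1))) (descending (n ∸ 2) 2)
  ++ map (C n 1) (descending (n ∸ 4) 2)

SameClause : Clause → Clause → Set
SameClause c d = c ∼[ set ] d

{-# OPTIONS --safe #-}
module Submission where

-- All learned clauses have the form R(z,s) = {P(i,z) | 1 ≤ i ≤ s, i ≠ z}: C(z,k) is R(z,k+1) for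
-- k ≥ z − 1, and D(z) is R(z,n). Scores stay below 2, so a variable outside the last learned clause
-- scores below 2δ ≤ 1 and one inside at least 1; hence decisions run down the column z of the last
-- learned block. Once the rows of column z below s are false, R(z,s) propagates P(s,z), and
-- transitivity and antisymmetry falsify every P(i,s) with i < s. If R(s,s) is known, it is in
-- conflict, and the first UIP is the last falsified literal of column z, so R(z,s−1) is learned. If
-- s = n − 1, then D(s) forces P(n,s), which falsifies D(n), with the same learned clause. Otherwise
-- decisions continue in column z and are copied to column s by transitivity, until the shortest
-- known R(s,r) propagates P(r,s); the conflict with R(r,r) then yields R(s,r−1). Visiting order does
-- not matter: all consequences of a pending literal are on the trail before the next one is processed.

open import Defs
open import Data.Nat using (ℕ; zero; suc; _+_; _∸_; _≤_; _<_; z≤n; s≤s; _≟_; _≤?_)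
open import Data.Nat.Properties as ℕP
  using (≤-refl; ≤-trans; ≤-antisym; <-irrefl; <-trans; <⇒≤; ≤∧≢⇒<; n<1+n; n≤1+n; ≰⇒>; ≤-pred)
open import Data.Bool using (Bool; true; false)
open import Data.Bool.ListAction using (any)
open import Data.List using (List; []; _∷_; _++_; map; filter; concatMap; take; drop; upTo;
  length; reverse; deduplicate; _∷ʳ_)
import Data.List.Properties as ListP
open import Data.List.Relation.Unary.Any using (Any; here; there)
import Data.List.Relation.Unary.Any.Properties as AnyP
open import Data.List.Relation.Unary.All as All using (All; []; _∷_)
import Data.List.Relation.Unary.All.Properties as AllP
open import Data.List.Relation.Unary.AllPairs as AllPairs using (AllPairs; []; _∷_)
import Data.List.Relation.Unary.AllPairs.Properties as AllPairsP
open import Data.List.Relation.Unary.Unique.Propositional using (Unique)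
import Data.List.Relation.Unary.Unique.Propositional.Properties as UniqueP
open import Data.List.Relation.Unary.Unique.DecPropositional.Properties _≟L_ using (deduplicate-!)
open import Data.List.Membership.Propositional using (_∈_; _∉_; lose)
open import Data.List.Membership.Propositional.Properties
  using (∈-map⁺; ∈-map⁻; ∈-filter⁺; ∈-filter⁻; ∈-deduplicate⁺; ∈-deduplicate⁻; ∈-++⁺ˡ; ∈-++⁺ʳ;
         ∈-∃++; ∈-++⁻; ∈-concatMap⁺; ∈-concatMap⁻; ∈-upTo⁺; ∈-upTo⁻)
open import Data.List.Membership.DecPropositional as DecMem using ()
open import Data.List.Relation.Binary.Pointwise as PW using (Pointwise; []; _∷_)
open import Data.Maybe using (Maybe; just; nothing)
open import Data.Product using (_×_; _,_; proj₁; proj₂; ∃; ∃₂)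
open import Data.Sum using (_⊎_; inj₁; inj₂; [_,_]′)
open import Data.Empty using (⊥; ⊥-elim)
open import Function using (_∘_; id; case_of_; mk⇔)
open import Data.Rational as ℚ using (ℚ; 0ℚ; 1ℚ; ½) renaming (_≤_ to _≤ℚ_; _<_ to _<ℚ_)
import Data.Rational.Properties as ℚP
open import Relation.Nullary using (¬_; ¬?; Dec; yes; no; contradiction)
open import Relation.Nullary.Decidable using (⌊_⌋)
open import Relation.Binary.PropositionalEquality
  using (_≡_; _≢_; refl; sym; trans; cong; cong₂; subst; subst₂; module ≡-Reasoning)
open import Relation.Binary.Construct.Closure.ReflexiveTransitive using (Star; ε; _◅_)
open import Induction.WellFounded using (Acc; acc)

-- The obstacle is that the clauses containing the complement of a pending literal may be visited in
-- any order, so neither the trail nor the reasons on it are determined. The trail is therefore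
-- never computed. Each phase of a run carries an upper bound on the literals that can be on the
-- trail, and the queue discipline supplies a lower bound; together they leave so few candidates
-- that every clause that can be unit or falsified is known. Conflict analysis is treated in the
-- same spirit: a set of literals bounds all intermediate clauses, and entries whose complements lie
-- outside it are skipped wherever they stand. The propagated P(s,z) is not itself a UIP. If P(a,z)
-- is the last falsified literal of its column, literals of row `a` lead from the conflict around
-- P(s,z) to P(a,z), for instance through the reason `A a s z`. Hence one more resolution, with
-- R(z,s), takes place, and it removes P(s,z). The score bound 2 is the limit of 1 + 1/2 + 1/4 +
-- ..., which no finite sum reaches.

lits : Trail → List Lit
lits = map lit

vars : Trail → List Var
vars = map (λ e → var (lit e))

any-true⁺ : ∀ {X : Set} (p : X → Bool) {x xs} → x ∈ xs → p x ≡ true → any p xs ≡ true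
any-true⁺ p {xs = y ∷ _} (here refl) px rewrite px = refl
any-true⁺ p {xs = y ∷ _} (there x∈) px with p y
... | true  = refl
... | false = any-true⁺ p x∈ px

any-true⁻ : ∀ {X : Set} (p : X → Bool) xs → any p xs ≡ true → ∃ λ x → x ∈ xs × p x ≡ true
any-true⁻ p (x ∷ xs) h with p x in eq
... | true  = x , here refl , eq
... | false with y , y∈ , py ← any-true⁻ p xs h = y , there y∈ , py

⌊⌋-true⁻ : ∀ {P : Set} (d : Dec P) → ⌊ d ⌋ ≡ true → P
⌊⌋-true⁻ (yes p) _ = p

⌊⌋-true⁺ : ∀ {P : Set} (d : Dec P) → P → ⌊ d ⌋ ≡ true
⌊⌋-true⁺ (yes _) _ = refl
⌊⌋-true⁺ (no ¬p) p = contradiction p ¬p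

isTrue⁺ : ∀ t {l} → l ∈ lits t → isTrue t l ≡ true
isTrue⁺ t l∈ with e , e∈ , refl ← ∈-map⁻ lit l∈ =
  any-true⁺ _ e∈ (⌊⌋-true⁺ (lit e ≟L lit e) refl)

isTrue⁻ : ∀ t {l} → isTrue t l ≡ true → l ∈ lits t
isTrue⁻ t {l} h with e , e∈ , q ← any-true⁻ _ t h =
  subst (_∈ lits t) (⌊⌋-true⁻ (lit e ≟L l) q) (∈-map⁺ lit e∈)

isAssigned⁺ : ∀ t {x} → x ∈ vars t → isAssigned t x ≡ true
isAssigned⁺ t x∈ with e , e∈ , refl ← ∈-map⁻ (λ e → var (lit e)) x∈ =
  any-true⁺ _ e∈ (⌊⌋-true⁺ (var (lit e) ≟V var (lit e)) refl)

isAssigned⁻ : ∀ t {x} → isAssigned t x ≡ true → x ∈ vars t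
isAssigned⁻ t {x} h with e , e∈ , q ← any-true⁻ _ t h =
  subst (_∈ vars t) (⌊⌋-true⁻ (var (lit e) ≟V x) q) (∈-map⁺ (λ e → var (lit e)) e∈)

comp-invol : ∀ l → complement (complement l) ≡ l
comp-invol (pos x) = refl
comp-invol (neg x) = refl

comp-≢ : ∀ l → complement l ≢ l
comp-≢ (pos x) ()
comp-≢ (neg x) ()

var-comp : ∀ l → var (complement l) ≡ var l
var-comp (pos x) = refl
var-comp (neg x) = refl

same-var : ∀ l l′ → var l ≡ var l′ → l ≡ l′ ⊎ l ≡ complement l′
same-var (pos x) (pos y) refl = inj₁ refl
same-var (pos x) (neg y) refl = inj₂ refl
same-var (neg x) (pos y) refl = inj₂ refl
same-var (neg x) (neg y) refl = inj₁ refl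

lits⇒vars : ∀ t {l} → l ∈ lits t → var l ∈ vars t
lits⇒vars t l∈ with e , e∈ , refl ← ∈-map⁻ lit l∈ = ∈-map⁺ (λ e → var (lit e)) e∈

vars⇒lits : ∀ t l → var l ∈ vars t → l ∈ lits t ⊎ complement l ∈ lits t
vars⇒lits t l v∈ with e , e∈ , q ← ∈-map⁻ (λ e → var (lit e)) v∈ with same-var l (lit e) q
... | inj₁ refl = inj₁ (∈-map⁺ lit e∈)
... | inj₂ refl = inj₂ (subst (_∈ lits t) (sym (comp-invol (lit e))) (∈-map⁺ lit e∈))

-- Clause status under a partial assignment.

data StatusView (t : Trail) (c : Clause) : Status → Set where
  sat : ∀ {l} → l ∈ c → l ∈ lits t → StatusView t c satisfied
  fal : (∀ {l} → l ∈ c → complement l ∈ lits t) → StatusView t c falsified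
  uni : ∀ {m} → m ∈ c → m ∉ lits t → complement m ∉ lits t →
        (∀ {l} → l ∈ c → l ≢ m → complement l ∈ lits t) → StatusView t c (unit m)
  unr : ∀ {l l′} → l ∈ c → l′ ∈ c → l ≢ l′ → complement l ∉ lits t → complement l′ ∉ lits t →
        StatusView t c unresolved

nonFalse? : ∀ t l → Dec (¬ (isFalse t l ≡ true))
nonFalse? t l = ¬? (Data.Bool._≟_ (isFalse t l) true)

nonFalse-∈⁻ : ∀ t c {fs l} → deduplicate _≟L_ (filter (nonFalse? t) c) ≡ fs → l ∈ fs →
  l ∈ c × complement l ∉ lits t
nonFalse-∈⁻ t c refl l∈
  with l∈c , nfl ← ∈-filter⁻ (nonFalse? t) {xs = c} (∈-deduplicate⁻ _≟L_ (filter (nonFalse? t) c) l∈) =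
  l∈c , λ h → nfl (isTrue⁺ t h)

nonFalse-∉ : ∀ t c {fs l} → deduplicate _≟L_ (filter (nonFalse? t) c) ≡ fs → l ∈ c → l ∉ fs →
  complement l ∈ lits t
nonFalse-∉ t c {l = l} refl l∈ l∉ with Data.Bool._≟_ (isFalse t l) true
... | yes h = isTrue⁻ t h
... | no ¬h = contradiction (∈-deduplicate⁺ _≟L_ (∈-filter⁺ (nonFalse? t) l∈ ¬h)) l∉

any-false⁻ : ∀ t c {l} → any (isTrue t) c ≡ false → l ∈ c → l ∉ lits t
any-false⁻ t c eq l∈ l∈t = case trans (sym eq) (any-true⁺ (isTrue t) l∈ (isTrue⁺ t l∈t)) of λ ()

statusView : ∀ t c → StatusView t c (status t c)
statusView t c with any (isTrue t) c in eqA
... | true with l , l∈ , q ← any-true⁻ (isTrue t) c eqA = sat l∈ (isTrue⁻ t q)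
statusView t c | false with deduplicate _≟L_ (filter (nonFalse? t) c) in eqF
...   | [] = fal λ l∈ → nonFalse-∉ t c eqF l∈ λ ()
...   | m ∷ [] with m∈ , mf ← nonFalse-∈⁻ t c eqF (here refl) =
  uni m∈ (any-false⁻ t c eqA m∈) mf
    λ l∈ l≢ → nonFalse-∉ t c eqF l∈ λ { (here l≡) → l≢ l≡ }
statusView t c | false | a ∷ b ∷ _
  with a∈ , af ← nonFalse-∈⁻ t c eqF (here refl) | b∈ , bf ← nonFalse-∈⁻ t c eqF (there (here refl))
     | (a≢b ∷ _) ∷ _ ← subst Unique eqF (deduplicate-! (filter (nonFalse? t) c)) = unr a∈ b∈ a≢b af bf

Consistent : Trail → Set
Consistent t = ∀ {l} → l ∈ lits t → complement l ∉ lits t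

-- The literal that satisfies a clause cannot be one of the false ones, so it is `m`; an unresolved
-- clause has two distinct non-false literals, one of them other than `m`. This turns the side
-- conditions of `advance` and `decide` into facts about the trail.
quiet-force : ∀ {t c m} → Consistent t → Quiet (status t c) →
  (∀ {l} → l ∈ c → l ≢ m → complement l ∈ lits t) → m ∈ lits t
quiet-force {t} {c} {m} cons q others with status t c | statusView t c
quiet-force {m = m} cons sat-quiet others | _ | sat {l} l∈c l∈t with l ≟L m
... | yes refl = l∈t
... | no l≢m = contradiction (others l∈c l≢m) (cons l∈t)
quiet-force {m = m} cons unr-quiet others | _ | unr {l} {l′} l∈ l′∈ l≢l′ lf lf′ with l ≟L m
... | yes refl = contradiction (others l′∈ (l≢l′ ∘ sym)) lf′
... | no l≢m = contradiction (others l∈ l≢m) lf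

∈-∷ʳ-last : ∀ {X : Set} (xs : List X) {x} → x ∈ xs ∷ʳ x
∈-∷ʳ-last xs = ∈-++⁺ʳ xs (here refl)

unique-++-disjoint : ∀ {X : Set} (xs : List X) {ys x} → Unique (xs ++ ys) → x ∈ xs → x ∉ ys
unique-++-disjoint (x ∷ xs) (x∉ ∷ _) (here refl) x∈ys = All.lookup x∉ (∈-++⁺ʳ xs x∈ys) refl
unique-++-disjoint (x ∷ xs) (_ ∷ u) (there x∈) x∈ys = unique-++-disjoint xs u x∈ x∈ys

unique-∷ʳ : ∀ {X : Set} {xs : List X} {x} → Unique xs → x ∉ xs → Unique (xs ∷ʳ x)
unique-∷ʳ u x∉ = UniqueP.++⁺ u ([] ∷ []) λ { (y∈ , here refl) → x∉ y∈ }

unique⇒consistent : ∀ t → Unique (vars t) → Consistent t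
unique⇒consistent (e ∷ t) (e∉ ∷ u) {l} (here refl) (here q) = comp-≢ l q
unique⇒consistent (e ∷ t) (e∉ ∷ u) {l} (here refl) (there q) =
  All.lookup e∉ (lits⇒vars t q) (sym (var-comp l))
unique⇒consistent (e ∷ t) (e∉ ∷ u) {l} (there p) (here q) =
  All.lookup e∉ (lits⇒vars t p) (trans (cong var (sym q)) (var-comp l))
unique⇒consistent (e ∷ t) (e∉ ∷ u) (there p) (there q) = unique⇒consistent t u p q

unassigned : ∀ t {l} → l ∉ lits t → complement l ∉ lits t → var l ∉ vars t
unassigned t {l} l∉ l̄∉ v∈ = [ l∉ , l̄∉ ]′ (vars⇒lits t l v∈)

-- Row clauses and the clause database.

-- Rows c z s: c is R(z,s) = {P(i,z) | 1 ≤ i ≤ s, i ≠ z} up to order and repetition.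
InRow : ℕ → ℕ → ℕ → Set
InRow z s i = 1 ≤ i × i ≤ s × i ≢ z

record Rows (c : Clause) (z s : ℕ) : Set where
  constructor rows
  field
    rows⇒ : ∀ {l} → l ∈ c → ∃ λ i → l ≡ pos (i , z) × InRow z s i
    ⇒rows : ∀ {i} → InRow z s i → pos (i , z) ∈ c
open Rows

record Valid (n i j : ℕ) : Set where
  constructor valid
  field
    1≤row : 1 ≤ i
    row≤n : i ≤ n
    1≤col : 1 ≤ j
    col≤n : j ≤ n
    row≢col : i ≢ j
open Valid

valid-sym : ∀ {n i j} → Valid n i j → Valid n j i
valid-sym (valid a b c d e) = valid c d a b (e ∘ sym)

-- Non-minimality clauses and learned clauses share the constructor `vR`, so the search never asks
-- where a row clause came from.
data InDB (n : ℕ) (Row : ℕ → ℕ → Set) : Clause → Set where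
  vA : ∀ {i j k} → Valid n i j → Valid n j k → Valid n i k → InDB n Row (A i j k)
  vB : ∀ {i j} → Valid n i j → InDB n Row (B i j)
  vR : ∀ {c z s} → Row z s → Rows c z s → InDB n Row c

record Database (n : ℕ) (Row : ℕ → ℕ → Set) (db : List Clause) : Set where
  field
    view : ∀ {c} → c ∈ db → InDB n Row c
    hasA : ∀ {i j k} → Valid n i j → Valid n j k → Valid n i k → A i j k ∈ db
    hasB : ∀ {i j} → Valid n i j → B i j ∈ db
    hasR : ∀ {z s} → Row z s → ∃ λ c → c ∈ db × Rows c z s

concatMap-∈⁺ : ∀ {X Y : Set} (f : X → List Y) {x xs y} → x ∈ xs → y ∈ f x → y ∈ concatMap f xs
concatMap-∈⁺ f x∈ y∈ = ∈-concatMap⁺ f (lose x∈ y∈)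

concatMap-∈⁻ : ∀ {X Y : Set} (f : X → List Y) xs {y} → y ∈ concatMap f xs → ∃ λ x → x ∈ xs × y ∈ f x
concatMap-∈⁻ f xs y∈ = go xs (∈-concatMap⁻ f {xs = xs} y∈)
  where
  go : ∀ xs {y} → Any (λ x → y ∈ f x) xs → ∃ λ x → x ∈ xs × y ∈ f x
  go (x ∷ xs) (here p) = x , here refl , p
  go (x ∷ xs) (there p) with x′ , x∈ , q ← go xs p = x′ , there x∈ , q

∈-idx⁺ : ∀ {n i} → 1 ≤ i → i ≤ n → i ∈ idx n
∈-idx⁺ {i = suc i} _ i≤n = ∈-map⁺ suc (∈-upTo⁺ i≤n)

∈-idx⁻ : ∀ {n i} → i ∈ idx n → 1 ≤ i × i ≤ n
∈-idx⁻ {n} i∈ with _ , j∈ , refl ← ∈-map⁻ suc {xs = upTo n} i∈ = s≤s z≤n , ∈-upTo⁻ j∈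

distinct⁺ : ∀ {i j} → i ≢ j → distinct i j ≡ true
distinct⁺ {i} {j} i≢j with i ≟ j
... | yes i≡j = contradiction i≡j i≢j
... | no _ = refl

distinct⁻ : ∀ {i j} → distinct i j ≡ true → i ≢ j
distinct⁻ {i} {j} d with i ≟ j
... | no i≢j = i≢j

when⁻ : ∀ {X : Set} b {x y : X} → y ∈ when b x → b ≡ true × y ≡ x
when⁻ true (here q) = refl , q

and⁻ : ∀ a {b} → a Data.Bool.∧ b ≡ true → a ≡ true × b ≡ true
and⁻ true h = refl , h

∈-trans⁺ : ∀ {n i j k} → Valid n i j → Valid n j k → Valid n i k → A i j k ∈ transitivity n
∈-trans⁺ {n} {i} {j} {k} ij jk ik =
  concatMap-∈⁺ _ (∈-idx⁺ (1≤row ij) (row≤n ij)) (concatMap-∈⁺ _ (∈-idx⁺ (1≤col ij) (col≤n ij))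
    (concatMap-∈⁺ _ (∈-idx⁺ (1≤col ik) (col≤n ik)) in-when))
  where
  in-when : A i j k ∈ when (distinct i j Data.Bool.∧ distinct j k Data.Bool.∧ distinct i k) (A i j k)
  in-when rewrite distinct⁺ (row≢col ij) | distinct⁺ (row≢col jk) | distinct⁺ (row≢col ik) = here refl

∈-trans⁻ : ∀ {n c Row} → c ∈ transitivity n → InDB n Row c
∈-trans⁻ {n} c∈
  with i , i∈ , c∈₁ ← concatMap-∈⁻ _ (idx n) c∈
  with j , j∈ , c∈₂ ← concatMap-∈⁻ _ (idx n) c∈₁
  with k , k∈ , c∈₃ ← concatMap-∈⁻ _ (idx n) c∈₂
  with d , refl ← when⁻ (distinct i j Data.Bool.∧ distinct j k Data.Bool.∧ distinct i k) c∈₃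
  with dij , d′ ← and⁻ (distinct i j) d
  with djk , dik ← and⁻ (distinct j k) d′
  with 1≤i , i≤n ← ∈-idx⁻ i∈ | 1≤j , j≤n ← ∈-idx⁻ j∈ | 1≤k , k≤n ← ∈-idx⁻ k∈ =
  vA (valid 1≤i i≤n 1≤j j≤n (distinct⁻ dij)) (valid 1≤j j≤n 1≤k k≤n (distinct⁻ djk))
     (valid 1≤i i≤n 1≤k k≤n (distinct⁻ dik))

∈-anti⁺ : ∀ {n i j} → Valid n i j → B i j ∈ antisymmetry n
∈-anti⁺ {n} {i} {j} ij =
  concatMap-∈⁺ _ (∈-idx⁺ (1≤row ij) (row≤n ij)) (concatMap-∈⁺ _ (∈-idx⁺ (1≤col ij) (col≤n ij)) in-when)
  where
  in-when : B i j ∈ when (distinct i j) (B i j)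
  in-when rewrite distinct⁺ (row≢col ij) = here refl

∈-anti⁻ : ∀ {n c Row} → c ∈ antisymmetry n → InDB n Row c
∈-anti⁻ {n} c∈
  with i , i∈ , c∈₁ ← concatMap-∈⁻ _ (idx n) c∈
  with j , j∈ , c∈₂ ← concatMap-∈⁻ _ (idx n) c∈₁
  with d , refl ← when⁻ (distinct i j) c∈₂
  with 1≤i , i≤n ← ∈-idx⁻ i∈ | 1≤j , j≤n ← ∈-idx⁻ j∈ =
  vB (valid 1≤i i≤n 1≤j j≤n (distinct⁻ d))

∈-column⁺ : ∀ {n z i} → InRow z n i → (i , z) ∈ column n z
∈-column⁺ {n} {z} (1≤i , i≤n , i≢z) =
  ∈-map⁺ _ (∈-filter⁺ (λ i → ¬? (i ≟ z)) (∈-idx⁺ 1≤i i≤n) i≢z)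

∈-column⁻ : ∀ {n z x} → x ∈ column n z → ∃ λ i → x ≡ (i , z) × InRow z n i
∈-column⁻ {n} {z} x∈ with i , i∈ , refl ← ∈-map⁻ (λ i → (i , z)) x∈
  with i∈idx , i≢z ← ∈-filter⁻ (λ i → ¬? (i ≟ z)) {xs = idx n} i∈
  with 1≤i , i≤n ← ∈-idx⁻ i∈idx = i , refl , 1≤i , i≤n , i≢z

D-rows : ∀ n z → Rows (D n z) z n
D-rows n z = rows
  (λ l∈ → case ∈-map⁻ pos l∈ of λ { (x , x∈ , refl) → case ∈-column⁻ {n} {z} x∈ of λ { (i , refl , r) → i , refl , r } })
  (λ r → ∈-map⁺ pos (∈-column⁺ r))

RowsOf : ℕ → List (ℕ × ℕ) → ℕ → ℕ → Set
RowsOf n sp z s = (s ≡ n × 1 ≤ z × z ≤ n) ⊎ (z , s) ∈ sp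

-- The literal order inside a learned clause depends on the visiting order. The pairs `(z , s)` are
-- what all runs have in common, and the schedule is stated in terms of them.
Learned : List Clause → List (ℕ × ℕ) → Set
Learned = Pointwise (λ c zs → Rows c (proj₁ zs) (proj₂ zs))

pointwise-∈ˡ : ∀ {X Y : Set} {R : X → Y → Set} {xs ys x} → Pointwise R xs ys → x ∈ xs →
  ∃ λ y → y ∈ ys × R x y
pointwise-∈ˡ (r ∷ rs) (here refl) = _ , here refl , r
pointwise-∈ˡ (r ∷ rs) (there x∈) with y , y∈ , q ← pointwise-∈ˡ rs x∈ = y , there y∈ , q

pointwise-∈ʳ : ∀ {X Y : Set} {R : X → Y → Set} {xs ys y} → Pointwise R xs ys → y ∈ ys →
  ∃ λ x → x ∈ xs × R x y
pointwise-∈ʳ (r ∷ rs) (here refl) = _ , here refl , r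
pointwise-∈ʳ (r ∷ rs) (there x∈) with y , y∈ , q ← pointwise-∈ʳ rs x∈ = y , there y∈ , q

database : ∀ n {ls sp} → Learned ls sp → Database n (RowsOf n sp) (DB n ls)
database n {ls} {sp} lrn = record { view = view ; hasA = hasA ; hasB = hasB ; hasR = hasR }
  where
  inOP : ∀ {c} → c ∈ OP n → c ∈ DB n ls
  inOP = ∈-++⁺ˡ

  view : ∀ {c} → c ∈ DB n ls → InDB n (RowsOf n sp) c
  view c∈ with ∈-++⁻ (OP n) c∈
  ... | inj₂ c∈ls with (z , s) , y∈ , r ← pointwise-∈ˡ lrn c∈ls = vR (inj₂ y∈) r
  ... | inj₁ c∈OP with ∈-++⁻ (transitivity n) c∈OP
  ... | inj₁ c∈T = ∈-trans⁻ c∈T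
  ... | inj₂ c∈′ with ∈-++⁻ (antisymmetry n) c∈′
  ... | inj₁ c∈A = ∈-anti⁻ c∈A
  ... | inj₂ c∈D with z , z∈ , refl ← ∈-map⁻ (D n) c∈D = vR (inj₁ (refl , ∈-idx⁻ z∈)) (D-rows n z)

  hasA : ∀ {i j k} → Valid n i j → Valid n j k → Valid n i k → A i j k ∈ DB n ls
  hasA ij jk ik = inOP (∈-++⁺ˡ (∈-trans⁺ ij jk ik))

  hasB : ∀ {i j} → Valid n i j → B i j ∈ DB n ls
  hasB ij = inOP (∈-++⁺ʳ (transitivity n) (∈-++⁺ˡ (∈-anti⁺ ij)))

  hasR : ∀ {z s} → RowsOf n sp z s → ∃ λ c → c ∈ DB n ls × Rows c z s
  hasR {z} (inj₁ (refl , 1≤z , z≤))  =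
    D n z , inOP (∈-++⁺ʳ (transitivity n) (∈-++⁺ʳ (antisymmetry n) (∈-map⁺ (D n) (∈-idx⁺ 1≤z z≤)))) , D-rows n z
  hasR (inj₂ y∈) with c , c∈ , r ← pointwise-∈ʳ lrn y∈ = c , ∈-++⁺ʳ (OP n) c∈ , r

-- First-UIP conflict analysis

two-members : ∀ {X : Set} {xs : List X} {x y} → x ∈ xs → y ∈ xs → x ≢ y → 2 ≤ length xs
two-members (here refl) (here refl) x≢y = contradiction refl x≢y
two-members {xs = _ ∷ _ ∷ _} (here _) (there _) _ = s≤s (s≤s z≤n)
two-members {xs = _ ∷ _ ∷ _} (there _) _ _ = s≤s (s≤s z≤n)

unique-const : ∀ {X : Set} {xs : List X} {u} → Unique xs → (∀ {x} → x ∈ xs → x ≡ u) → length xs ≤ 1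
unique-const {xs = []} _ _ = z≤n
unique-const {xs = _ ∷ []} _ _ = s≤s z≤n
unique-const {xs = _ ∷ _ ∷ _} ((x≢y ∷ _) ∷ _) h =
  contradiction (trans (h (here refl)) (sym (h (there (here refl))))) x≢y

atLevel? : ∀ vs l → Dec (var l ∈ vs)
atLevel? vs l = DecMem._∈?_ _≟V_ (var l) vs

countAt≥2 : ∀ vs cl {l l′} → l ∈ cl → l′ ∈ cl → l ≢ l′ → var l ∈ vs → var l′ ∈ vs →
  ¬ countAt vs cl ≤ 1
countAt≥2 vs cl l∈ l′∈ l≢l′ v v′ le = <-irrefl refl (≤-trans
  (two-members (∈-filter⁺ (atLevel? vs) l∈ v) (∈-filter⁺ (atLevel? vs) l′∈ v′) l≢l′) le)

countAt≤1 : ∀ vs cl {u} → Unique cl → (∀ {l} → l ∈ cl → var l ∈ vs → l ≡ u) → countAt vs cl ≤ 1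
countAt≤1 vs cl uq h = unique-const (UniqueP.filter⁺ (atLevel? vs) uq)
  λ x∈ → case ∈-filter⁻ (atLevel? vs) {xs = cl} x∈ of λ { (x∈cl , v) → h x∈cl v }

analyzeGo-stop : ∀ vs e es cl → countAt vs cl ≤ 1 → analyzeGo vs (e ∷ es) cl ≡ cl
analyzeGo-stop vs e es cl le with countAt vs cl ≤? 1
... | yes _ = refl
... | no ¬le = contradiction le ¬le

analyzeGo-skip : ∀ vs e es cl → ¬ countAt vs cl ≤ 1 → complement (lit e) ∉ cl →
  analyzeGo vs (e ∷ es) cl ≡ analyzeGo vs es cl
analyzeGo-skip vs e es cl ¬le ∉cl with countAt vs cl ≤? 1
... | yes le = contradiction le ¬le
... | no _ with DecMem._∈?_ _≟L_ (complement (lit e)) cl | reason e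
...   | yes p | _ = contradiction p ∉cl
...   | no _ | just _ = refl
...   | no _ | nothing = refl

analyzeGo-resolve : ∀ vs e es cl {r} → ¬ countAt vs cl ≤ 1 → complement (lit e) ∈ cl →
  reason e ≡ just r → analyzeGo vs (e ∷ es) cl ≡ analyzeGo vs es (resolve cl (lit e) r)
analyzeGo-resolve vs e es cl ¬le ∈cl eq with countAt vs cl ≤? 1
... | yes le = contradiction le ¬le
... | no _ with DecMem._∈?_ _≟L_ (complement (lit e)) cl | reason e | eq
...   | no ∉cl | _ | _ = contradiction ∈cl ∉cl
...   | yes _ | just _ | refl = refl

∈-resolve⁻ : ∀ cl x r {l} → l ∈ resolve cl x r → (l ∈ cl × l ≢ complement x) ⊎ (l ∈ r × l ≢ x)
∈-resolve⁻ cl x r l∈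
  with ∈-++⁻ (filter (λ l → ¬? (l ≟L complement x)) cl) (∈-deduplicate⁻ _≟L_ _ l∈)
... | inj₁ p = inj₁ (∈-filter⁻ (λ l → ¬? (l ≟L complement x)) {xs = cl} p)
... | inj₂ p = inj₂ (∈-filter⁻ (λ l → ¬? (l ≟L x)) {xs = r} p)

∈-resolveˡ : ∀ cl x r {l} → l ∈ cl → l ≢ complement x → l ∈ resolve cl x r
∈-resolveˡ cl x r l∈ l≢ =
  ∈-deduplicate⁺ _≟L_ (∈-++⁺ˡ (∈-filter⁺ (λ l → ¬? (l ≟L complement x)) l∈ l≢))

∈-resolveʳ : ∀ cl x r {l} → l ∈ r → l ≢ x → l ∈ resolve cl x r
∈-resolveʳ cl x r l∈ l≢ =
  ∈-deduplicate⁺ _≟L_ (∈-++⁺ʳ (filter (λ l → ¬? (l ≟L complement x)) cl)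
    (∈-filter⁺ (λ l → ¬? (l ≟L x)) l∈ l≢))

Propagated : Entry → Set
Propagated e = ∃ λ r → reason e ≡ just r

currentLevel-++ : ∀ ps {d} z → All Propagated ps → reason d ≡ nothing →
  currentLevel (ps ++ d ∷ z) ≡ ps ++ d ∷ []
currentLevel-++ [] {d} z [] eq with reason d | eq
... | nothing | _ = refl
currentLevel-++ (e ∷ ps) z ((r , er) ∷ prs) eq with reason e | er
... | just _ | _ = cong (e ∷_) (currentLevel-++ ps z prs eq)

all-reverse : ∀ {X : Set} {P : X → Set} xs → All P xs → All P (reverse xs)
all-reverse xs ps = All.tabulate λ x∈ → All.lookup ps (AnyP.reverse⁻ x∈)

-- The first UIP is ¬P(a,c), since every intermediate clause has a literal P(a,_) and a marker
-- (a negative literal or one of row c), both of the conflict level, until the entry p₀ that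
-- follows the UIP has been resolved away.
module FirstUIP (c h a : ℕ) (a-in : InRow c h a) (X : Lit → Set) (c₀ : Clause)
  (c₀-rows : Rows c₀ c (suc h)) (h≢c : suc h ≢ c) where

  p₀ : Entry
  p₀ = entry (pos (suc h , c)) (just c₀)

  Target : Lit → Set
  Target l = ∃ λ i → l ≡ pos (i , c) × InRow c h i

  -- Row clauses have no negative literal, so in the conflict clause, and in the reason D(s) of a
  -- chained conflict, a literal of row `c` has to serve as the second literal of the conflict
  -- level. It is never a target, since column `c` has no row `c`.
  Marker : Lit → Set
  Marker l = (∃ λ v → l ≡ neg v) ⊎ (∃ λ x → l ≡ pos (c , x))

  Within : List Entry → Lit → Set
  Within es l = X l × (Target l ⊎ complement l ∈ lits (es ++ p₀ ∷ []))

  -- The entries above `p₀`, newest first. An `irr` entry is never resolved on, because `X` excludes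
  -- its complement. An `ok` entry may or may not be, so its reason has to preserve all of
  -- `Pending`; the condition on `pos (a , x)` covers the case that the known literal of row `a` is
  -- the one resolved away.
  data Chain : List Entry → Set where
    []  : Chain []
    irr : ∀ {e es} → Chain es → ¬ X (complement (lit e)) → Chain (e ∷ es)
    ok  : ∀ {e es r} → Chain es → reason e ≡ just r →
          (∀ {l} → l ∈ r → l ≢ lit e → Within es l) →
          (∀ {x} → complement (lit e) ≡ pos (a , x) → ∃ λ y → pos (a , y) ∈ r × pos (a , y) ≢ lit e) →
          (∃ λ l → l ∈ r × l ≢ lit e × Marker l) → Chain (e ∷ es)

  -- `uip` and `marker` exhibit two distinct literals of the conflict level, so the walk cannot stop
  -- before `p₀`.
  record Pending (es : List Entry) (cl : Clause) : Set where
    field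
      uniq   : Unique cl
      within : ∀ {l} → l ∈ cl → Within es l
      uip    : ∃ λ x → pos (a , x) ∈ cl
      marker : ∃ λ l → l ∈ cl × Marker l
  open Pending

  marker⇒¬target : ∀ {l} → Marker l → ¬ Target l
  marker⇒¬target (inj₁ (_ , refl)) (_ , () , _)
  marker⇒¬target (inj₂ (_ , refl)) (_ , refl , _ , _ , c≢c) = c≢c refl

  marker≢uip : ∀ {l x} → Marker l → pos (a , x) ≢ l
  marker≢uip (inj₁ (_ , refl)) ()
  marker≢uip (inj₂ (_ , refl)) refl = proj₂ (proj₂ a-in) refl

  module _ (vs : List Var) (uip∈vs : (a , c) ∈ vs) where

    not-yet : ∀ es {cl} → (∀ {v} → v ∈ vars (es ++ p₀ ∷ []) → v ∈ vs) → Pending es cl → ¬ countAt vs cl ≤ 1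
    not-yet es {cl} sub j with uip j | marker j
    ... | x , la∈ | l , l∈ , mk = countAt≥2 vs cl la∈ l∈ (marker≢uip mk) (la-vs (proj₂ (within j la∈))) l-vs
      where
      la-vs : Target (pos (a , x)) ⊎ neg (a , x) ∈ lits (es ++ p₀ ∷ []) → (a , x) ∈ vs
      la-vs (inj₁ (_ , refl , _)) = uip∈vs
      la-vs (inj₂ q) = sub (lits⇒vars (es ++ p₀ ∷ []) q)
      l-vs : var l ∈ vs
      l-vs with proj₂ (within j l∈)
      ... | inj₁ tg = contradiction tg (marker⇒¬target mk)
      ... | inj₂ q = sub (subst (_∈ vars (es ++ p₀ ∷ [])) (var-comp l) (lits⇒vars (es ++ p₀ ∷ []) q))

    Target∩vs : Set
    Target∩vs = ∀ {i} → InRow c h i → (i , c) ∈ vs → i ≡ a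

    analyze-chain : ∀ es {cl} f low → Target∩vs → Chain es → (∀ {v} → v ∈ vars (es ++ p₀ ∷ []) → v ∈ vs) →
      Pending es cl → Rows (analyzeGo vs (es ++ p₀ ∷ f ∷ low) cl) c h
    analyze-chain [] {cl} f low tv [] sub j with marker j
    ... | l , l∈ , mk with proj₂ (within j l∈)
    ... | inj₁ tg = contradiction tg (marker⇒¬target mk)
    -- No entry above `p₀` is left, so the marker can only be the complement of `p₀`. Resolving on
    -- it puts R(c,h+1) without row h+1 in its place.
    ... | inj₂ (here q) = subst (λ cl → Rows cl c h) (sym result) rows′
      where
      p̄∈ : neg (suc h , c) ∈ cl
      p̄∈ = subst (_∈ cl) (trans (sym (comp-invol l)) (cong complement q)) l∈
      cl′ = resolve cl (pos (suc h , c)) c₀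
      rows′ : Rows cl′ c h
      rows′ = rows to from
        where
        to : ∀ {l} → l ∈ cl′ → Target l
        to l∈′ with ∈-resolve⁻ cl (pos (suc h , c)) c₀ l∈′
        to l∈′ | inj₁ (l∈cl , l≢) with proj₂ (within j l∈cl)
        ... | inj₁ tg = tg
        ... | inj₂ (here q′) = contradiction (trans (sym (comp-invol _)) (cong complement q′)) l≢
        to l∈′ | inj₂ (l∈c₀ , l≢) with i , refl , 1≤i , i≤ , i≢ ← rows⇒ c₀-rows l∈c₀ =
          i , refl , 1≤i , ≤-pred (≤∧≢⇒< i≤ λ { refl → l≢ refl }) , i≢
        from : ∀ {i} → InRow c h i → pos (i , c) ∈ cl′
        from (1≤i , i≤ , i≢) = ∈-resolveʳ cl (pos (suc h , c)) c₀
          (⇒rows c₀-rows (1≤i , ≤-trans i≤ (n≤1+n h) , i≢)) λ { refl → <-irrefl refl i≤ }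
      result : analyzeGo vs (p₀ ∷ f ∷ low) cl ≡ cl′
      result = trans (analyzeGo-resolve vs p₀ (f ∷ low) cl (not-yet [] sub j) p̄∈ refl)
        -- Of the targets only `pos (a , c)` belongs to the conflict level, so the count has dropped
        -- to 1.
        (analyzeGo-stop vs f low cl′ (countAt≤1 vs cl′ (deduplicate-! _) λ l∈′ v∈ →
          case rows⇒ rows′ l∈′ of λ { (i , refl , r) → cong (λ i → pos (i , c)) (tv r v∈) }))
    analyze-chain (e ∷ es) {cl} f low tv (irr ch ¬x) sub j =
      subst (λ cl → Rows cl c h) (sym (analyzeGo-skip vs e _ cl (not-yet (e ∷ es) sub j) ∉cl))
        (analyze-chain es f low tv ch (sub ∘ there) record
          { uniq = uniq j ; within = within′ ; uip = uip j ; marker = marker j })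
      where
      ∉cl : complement (lit e) ∉ cl
      ∉cl q = ¬x (proj₁ (within j q))
      within′ : ∀ {l} → l ∈ cl → Within es l
      within′ l∈ with within j l∈
      ... | x , inj₁ tg = x , inj₁ tg
      ... | x , inj₂ (here q) =
        contradiction (subst (_∈ cl) (trans (sym (comp-invol _)) (cong complement q)) l∈) ∉cl
      ... | x , inj₂ (there q) = x , inj₂ q
    analyze-chain (e ∷ es) {cl} f low tv (ok {r = r} ch er w u m) sub j
      with DecMem._∈?_ _≟L_ (complement (lit e)) cl
    ... | no ∉cl =
      subst (λ cl → Rows cl c h) (sym (analyzeGo-skip vs e _ cl (not-yet (e ∷ es) sub j) ∉cl))
        (analyze-chain es f low tv ch (sub ∘ there) record
          { uniq = uniq j ; within = within′ ; uip = uip j ; marker = marker j })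
      where
      within′ : ∀ {l} → l ∈ cl → Within es l
      within′ l∈ with within j l∈
      ... | x , inj₁ tg = x , inj₁ tg
      ... | x , inj₂ (here q) =
        contradiction (subst (_∈ cl) (trans (sym (comp-invol _)) (cong complement q)) l∈) ∉cl
      ... | x , inj₂ (there q) = x , inj₂ q
    ... | yes ∈cl =
      subst (λ cl → Rows cl c h) (sym (analyzeGo-resolve vs e _ cl (not-yet (e ∷ es) sub j) ∈cl er))
        (analyze-chain es f low tv ch (sub ∘ there) record
          { uniq = deduplicate-! _ ; within = within′ ; uip = uip′
          ; marker = case m of λ { (l , l∈r , l≢ , mk) → l , ∈-resolveʳ cl (lit e) r l∈r l≢ , mk } })
      where
      within′ : ∀ {l} → l ∈ resolve cl (lit e) r → Within es l
      within′ l∈ with ∈-resolve⁻ cl (lit e) r l∈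
      ... | inj₂ (l∈r , l≢) = w l∈r l≢
      ... | inj₁ (l∈cl , l≢) with within j l∈cl
      ... | x , inj₁ tg = x , inj₁ tg
      ... | x , inj₂ (here q) = contradiction (trans (sym (comp-invol _)) (cong complement q)) l≢
      ... | x , inj₂ (there q) = x , inj₂ q
      uip′ : ∃ λ x → pos (a , x) ∈ resolve cl (lit e) r
      uip′ with uip j
      ... | x , la∈ with pos (a , x) ≟L complement (lit e)
      ... | no ≢e = x , ∈-resolveˡ cl (lit e) r la∈ ≢e
      ... | yes ≡e with y , y∈ , y≢ ← u (sym ≡e) = y , ∈-resolveʳ cl (lit e) r y∈ y≢

  vars-++ : ∀ xs {ys} → vars (xs ++ ys) ≡ vars xs ++ vars ys
  vars-++ xs = ListP.map-++ _ xs _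

  -- The conflict level is `d ∷ us ++ p₀ ∷ rest`. The segment `us` is there because the UIP may be a
  -- propagated literal above the decision `d`; the walk ends before any entry of `d ∷ us` is
  -- resolved on.
  analyze-rows : ∀ t₀ d us rest {cl} →
    let t = t₀ ++ d ∷ us ++ p₀ ∷ rest in
    reason d ≡ nothing → All Propagated us → All Propagated rest → Unique (vars t) →
    (a , c) ∈ vars (d ∷ us) → (∀ {i} → (i , c) ∈ vars (d ∷ us) → i ≡ a) →
    (∀ {i} → InRow c h i → (i , c) ∈ vars (t₀ ++ d ∷ us)) →
    Chain (reverse rest) →
    (∀ {l} → l ∈ cl → Within (reverse rest) l) → (∃ λ x → pos (a , x) ∈ cl) → (∃ λ l → l ∈ cl × Marker l) →
    Rows (analyze t cl) c h
  analyze-rows t₀ d us rest {cl} dd pus prest uq a∈ only-a tgt∈ ch w ua mk =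
    subst (λ seg → Rows (analyzeGo (map (λ e → var (lit e)) seg) seg (deduplicate _≟L_ cl)) c h)
      (sym seg-eq) goal
    where
    t = t₀ ++ d ∷ us ++ p₀ ∷ rest
    seg = reverse rest ++ p₀ ∷ reverse us ++ d ∷ []

    reverse-rest : reverse (us ++ p₀ ∷ rest) ≡ reverse rest ++ p₀ ∷ reverse us
    reverse-rest = begin
      reverse (us ++ p₀ ∷ rest)               ≡⟨ ListP.reverse-++ us (p₀ ∷ rest) ⟩
      reverse (p₀ ∷ rest) ++ reverse us       ≡⟨ cong (_++ reverse us) (ListP.unfold-reverse p₀ rest) ⟩
      (reverse rest ++ p₀ ∷ []) ++ reverse us ≡⟨ ListP.++-assoc (reverse rest) _ _ ⟩
      reverse rest ++ p₀ ∷ reverse us         ∎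
      where open ≡-Reasoning

    seg-eq : currentLevel (reverse t) ≡ seg
    seg-eq = begin
      currentLevel (reverse t)
        ≡⟨ cong currentLevel (ListP.reverse-++ t₀ _) ⟩
      currentLevel (reverse (d ∷ us ++ p₀ ∷ rest) ++ reverse t₀)
        ≡⟨ cong (λ z → currentLevel (z ++ reverse t₀)) (ListP.unfold-reverse d (us ++ p₀ ∷ rest)) ⟩
      currentLevel ((reverse (us ++ p₀ ∷ rest) ++ d ∷ []) ++ reverse t₀)
        ≡⟨ cong currentLevel (ListP.++-assoc (reverse (us ++ p₀ ∷ rest)) _ _) ⟩
      currentLevel (reverse (us ++ p₀ ∷ rest) ++ d ∷ reverse t₀)
        ≡⟨ currentLevel-++ _ _ (all-reverse _ (AllP.++⁺ pus ((_ , refl) ∷ prest))) dd ⟩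
      reverse (us ++ p₀ ∷ rest) ++ d ∷ []
        ≡⟨ cong (_++ d ∷ []) reverse-rest ⟩
      (reverse rest ++ p₀ ∷ reverse us) ++ d ∷ []
        ≡⟨ ListP.++-assoc (reverse rest) _ _ ⟩
      seg ∎
      where open ≡-Reasoning

    vs = map (λ e → var (lit e)) seg

    uq′ : Unique (vars (t₀ ++ d ∷ us) ++ vars (p₀ ∷ rest))
    uq′ = subst Unique (trans (cong vars (sym (ListP.++-assoc t₀ (d ∷ us) (p₀ ∷ rest))))
                              (vars-++ (t₀ ++ d ∷ us))) uq

    ∈-vars-reverse : ∀ xs {v} → v ∈ vars (reverse xs) → v ∈ vars xs
    ∈-vars-reverse xs v∈ with e , e∈ , refl ← ∈-map⁻ (λ e → var (lit e)) v∈ =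
      ∈-map⁺ _ (AnyP.reverse⁻ e∈)

    low-vs : ∀ {v} → v ∈ vars (d ∷ us) → v ∈ vs
    low-vs v∈ with e , e∈ , refl ← ∈-map⁻ (λ e → var (lit e)) v∈ =
      ∈-map⁺ _ (∈-++⁺ʳ (reverse rest) (there (move e∈)))
      where
      move : ∀ {e} → e ∈ d ∷ us → e ∈ reverse us ++ d ∷ []
      move (here refl) = ∈-∷ʳ-last (reverse us)
      move (there e∈) = ∈-++⁺ˡ (AnyP.reverse⁺ e∈)

    vs-cases : ∀ {v} → v ∈ vs → v ∈ vars (p₀ ∷ rest) ⊎ v ∈ vars (d ∷ us)
    vs-cases v∈ with e , e∈ , refl ← ∈-map⁻ (λ e → var (lit e)) v∈ with ∈-++⁻ (reverse rest) e∈
    ... | inj₁ q = inj₁ (there (∈-vars-reverse rest (∈-map⁺ _ q)))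
    ... | inj₂ (here refl) = inj₁ (here refl)
    ... | inj₂ (there q) with ∈-++⁻ (reverse us) q
    ...   | inj₁ q′ = inj₂ (there (∈-vars-reverse us (∈-map⁺ _ q′)))
    ...   | inj₂ (here refl) = inj₂ (here refl)

    tv : ∀ {i} → InRow c h i → (i , c) ∈ vs → i ≡ a
    tv r v∈ with vs-cases v∈
    ... | inj₁ q = contradiction q (unique-++-disjoint _ uq′ (tgt∈ r))
    ... | inj₂ q = only-a q

    sub : ∀ {v} → v ∈ vars (reverse rest ++ p₀ ∷ []) → v ∈ vs
    sub v∈ with e , e∈ , refl ← ∈-map⁻ (λ e → var (lit e)) v∈ with ∈-++⁻ (reverse rest) e∈
    ... | inj₁ q = ∈-map⁺ _ (∈-++⁺ˡ q)
    ... | inj₂ (here refl) = ∈-map⁺ _ (∈-++⁺ʳ (reverse rest) (here refl))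

    pending : Pending (reverse rest) (deduplicate _≟L_ cl)
    pending = record
      { uniq = deduplicate-! cl
      ; within = w ∘ ∈-deduplicate⁻ _≟L_ cl
      ; uip = case ua of λ { (x , x∈) → x , ∈-deduplicate⁺ _≟L_ x∈ }
      ; marker = case mk of λ { (l , l∈ , m) → l , ∈-deduplicate⁺ _≟L_ l∈ , m } }

    split : ∀ xs → ∃₂ λ f low → xs ++ d ∷ [] ≡ f ∷ low
    split [] = d , [] , refl
    split (x ∷ xs) = x , xs ++ d ∷ [] , refl

    goal : Rows (analyzeGo vs seg (deduplicate _≟L_ cl)) c h
    goal with split (reverse us)
    ... | f , low , eq = subst (λ z → Rows (analyzeGo vs (reverse rest ++ p₀ ∷ z) (deduplicate _≟L_ cl)) c h)
                          (sym eq) (analyze-chain vs (low-vs a∈) (reverse rest) f low tv ch sub pending)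

-- Scores and decisions

2ℚ : ℚ
2ℚ = 1ℚ ℚ.+ 1ℚ

bump-cases : ∀ {c z s} i z′ → Rows c z s →
  (bump c (i , z′) ≡ 1ℚ × z′ ≡ z × InRow z s i) ⊎ (bump c (i , z′) ≡ 0ℚ × ¬ (z′ ≡ z × InRow z s i))
bump-cases {c} i z′ R with any (λ l → ⌊ var l ≟V (i , z′) ⌋) c in eq
... | true with l , l∈ , q ← any-true⁻ _ c eq with refl ← ⌊⌋-true⁻ (var l ≟V (i , z′)) q
      with _ , refl , r ← rows⇒ R l∈ = inj₁ (refl , refl , r)
... | false = inj₂ (refl , λ { (refl , r) → case trans (sym eq) (any-true⁺ _ (⇒rows R r)
                (⌊⌋-true⁺ (_ ≟V _) refl)) of λ () })

bump-in : ∀ {c z s i} → Rows c z s → InRow z s i → bump c (i , z) ≡ 1ℚ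
bump-in {z = z} {i = i} R r with bump-cases i z R
... | inj₁ (eq , _) = eq
... | inj₂ (_ , ¬r) = contradiction (refl , r) ¬r

bump-col : ∀ {c z s i z′} → Rows c z s → z′ ≢ z → bump c (i , z′) ≡ 0ℚ
bump-col {i = i} {z′} R z′≢z with bump-cases i z′ R
... | inj₁ (_ , z′≡z , _) = contradiction z′≡z z′≢z
... | inj₂ (eq , _) = eq

0≤1 : 0ℚ ≤ℚ 1ℚ
0≤1 = ℚP.nonNegative⁻¹ 1ℚ

bump-range : ∀ {c z s} x → Rows c z s → 0ℚ ≤ℚ bump c x × bump c x ≤ℚ 1ℚ
bump-range (i , z′) R with bump-cases i z′ R
... | inj₁ (eq , _) rewrite eq = 0≤1 , ℚP.≤-refl
... | inj₂ (eq , _) rewrite eq = ℚP.≤-refl , 0≤1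

-- A row clause is an initial segment of its column. Scores therefore never increase down a column,
-- which is why decisions take the rows in increasing order.
bump-mono : ∀ {c z s} i i′ z′ → Rows c z s → 1 ≤ i → i ≤ i′ → i ≢ z′ →
  bump c (i′ , z′) ≤ℚ bump c (i , z′)
bump-mono {c} i i′ z′ R 1≤i i≤i′ i≢z′ with bump-cases i′ z′ R
... | inj₂ (eq , _) rewrite eq = proj₁ (bump-range (i , z′) R)
... | inj₁ (eq , refl , (_ , i′≤ , _)) =
  ℚP.≤-reflexive (trans eq (sym (bump-in R (1≤i , ≤-trans i≤i′ i′≤ , i≢z′))))

record ScoreInv (q : Var → ℚ) : Set where
  field
    nonneg  : ∀ x → 0ℚ ≤ℚ q x
    bounded : ∀ x → q x <ℚ 2ℚ
    mono    : ∀ {i i′ z} → 1 ≤ i → i ≤ i′ → i ≢ z → q (i′ , z) ≤ℚ q (i , z)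
open ScoreInv

-- Strict against columns on the left, weak against columns on the right: this is what the choice of
-- the first maximum in column-major order requires.
Dominates : (Var → ℚ) → ℕ → ℕ → Set
Dominates q c M = ∀ {i} → InRow c M i → ∀ i′ {z′} → 1 ≤ z′ →
  (z′ < c → q (i′ , z′) <ℚ q (i , c)) × (c < z′ → q (i′ , z′) ≤ℚ q (i , c))

module Scores (δ : ℚ) (0<δ : 0ℚ <ℚ δ) (δ≤½ : δ ≤ℚ ½) where

  update : (Var → ℚ) → Clause → Var → ℚ
  update q c x = bump c x ℚ.+ δ ℚ.* q x

  δ-mono-≤ : ∀ {p q} → p ≤ℚ q → δ ℚ.* p ≤ℚ δ ℚ.* q
  δ-mono-≤ = ℚP.*-monoˡ-≤-nonNeg δ {{ℚ.nonNegative (ℚP.<⇒≤ 0<δ)}}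

  δ-mono-< : ∀ {p q} → p <ℚ q → δ ℚ.* p <ℚ δ ℚ.* q
  δ-mono-< = ℚP.*-monoʳ-<-pos δ {{ℚ.positive 0<δ}}

  δ-nonneg : ∀ {q} → 0ℚ ≤ℚ q → 0ℚ ≤ℚ δ ℚ.* q
  δ-nonneg {q} 0≤q = subst (_≤ℚ δ ℚ.* q) (ℚP.*-zeroʳ δ) (δ-mono-≤ 0≤q)

  δ-bound : ∀ {q} → 0ℚ ≤ℚ q → q <ℚ 2ℚ → δ ℚ.* q <ℚ 1ℚ
  δ-bound {q} 0≤q q<2 = ℚP.≤-<-trans (ℚP.*-monoʳ-≤-nonNeg q {{ℚ.nonNegative 0≤q}} δ≤½)
    (ℚP.*-monoʳ-<-pos ½ q<2)

  update-inv : ∀ {q c z s} → ScoreInv q → Rows c z s → ScoreInv (update q c)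
  update-inv {q} {c} I R = record
    { nonneg  = λ x → ℚP.+-mono-≤ (proj₁ (bump-range x R)) (δ-nonneg (nonneg I x))
    ; bounded = λ x → ℚP.+-mono-≤-< (proj₂ (bump-range x R)) (δ-bound (nonneg I x) (bounded I x))
    ; mono    = λ {i} {i′} {z} a b d → ℚP.+-mono-≤ (bump-mono i i′ z R a b d) (δ-mono-≤ (mono I a b d)) }

  dominates-latest : ∀ {q c z s} → ScoreInv q → Rows c z s → Dominates (update q c) z s
  dominates-latest {q} {c} {z} {s} I R {i} r i′ {z′} _ =
    (λ lt → less (ℕP.<⇒≢ lt)) , (λ lt → ℚP.<⇒≤ (less (ℕP.<⇒≢ lt ∘ sym)))
    where
    less : z′ ≢ z → update q c (i′ , z′) <ℚ update q c (i , z)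
    less z′≢z rewrite bump-in R r | bump-col {i = i′} R z′≢z =
      ℚP.<-≤-trans (ℚP.+-mono-≤-< {0ℚ} ℚP.≤-refl (δ-bound (nonneg I _) (bounded I _)))
        (ℚP.≤-trans (ℚP.≤-reflexive (trans (ℚP.+-identityˡ 1ℚ) (sym (ℚP.+-identityʳ 1ℚ))))
                    (ℚP.+-mono-≤ {1ℚ} ℚP.≤-refl (δ-nonneg (nonneg I (i , z)))))

  -- Decay scales all scores by the same δ > 0, and only column `c` is bumped. The bound `M` does
  -- not shrink to `s`: rows that have left the recent clauses still lead all other columns, and
  -- decisions reach such rows in the `via` rounds and in the first tail round.
  dominates-keep : ∀ {q c cl s M} → ScoreInv q → Rows cl c s → Dominates q c M → Dominates (update q cl) c M
  dominates-keep {q} {c} {cl} I R dom {i} r i′ {z′} 1≤z′ = lt , le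
    where
    lt : z′ < c → update q cl (i′ , z′) <ℚ update q cl (i , c)
    lt z′<c rewrite bump-col {i = i′} R (ℕP.<⇒≢ z′<c) =
      ℚP.+-mono-≤-< (proj₁ (bump-range (i , c) R)) (δ-mono-< (proj₁ (dom r i′ 1≤z′) z′<c))
    le : c < z′ → update q cl (i′ , z′) ≤ℚ update q cl (i , c)
    le c<z′ rewrite bump-col {i = i′} R (ℕP.<⇒≢ c<z′ ∘ sym) =
      ℚP.+-mono-≤ (proj₁ (bump-range (i , c) R)) (δ-mono-≤ (proj₂ (dom r i′ 1≤z′) c<z′))

  score-∷ʳ : ∀ ls c x → score δ (ls ∷ʳ c) x ≡ update (score δ ls) c x
  score-∷ʳ ls c x = ListP.foldl-∷ʳ _ 0ℚ c ls

  zero-inv : ScoreInv (λ _ → 0ℚ)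
  zero-inv = record
    { nonneg = λ _ → ℚP.≤-refl ; bounded = λ _ → ℚP.positive⁻¹ 2ℚ ; mono = λ _ _ _ → ℚP.≤-refl }

  scoreInv-≗ : ∀ {p q} → (∀ x → p x ≡ q x) → ScoreInv q → ScoreInv p
  scoreInv-≗ eq I = record
    { nonneg  = λ x → subst (0ℚ ≤ℚ_) (sym (eq x)) (nonneg I x)
    ; bounded = λ x → subst (_<ℚ 2ℚ) (sym (eq x)) (bounded I x)
    ; mono    = λ a b d → subst₂ _≤ℚ_ (sym (eq _)) (sym (eq _)) (mono I a b d) }

  dominates-≗ : ∀ {p q c M} → (∀ x → p x ≡ q x) → Dominates q c M → Dominates p c M
  dominates-≗ eq dom r i′ 1≤z′ =
    (λ lt → subst₂ _<ℚ_ (sym (eq _)) (sym (eq _)) (proj₁ (dom r i′ 1≤z′) lt)) ,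
    (λ lt → subst₂ _≤ℚ_ (sym (eq _)) (sym (eq _)) (proj₂ (dom r i′ 1≤z′) lt))

Before : Var → Var → Set
Before (i , z) (i′ , z′) = z < z′ ⊎ (z ≡ z′ × i < i′)

idx-sorted : ∀ n → AllPairs _<_ (idx n)
idx-sorted n = AllPairsP.map⁺ (AllPairsP.applyUpTo⁺₁ id n λ i<j _ → s≤s i<j)

column-sorted : ∀ n z → AllPairs Before (column n z)
column-sorted n z = AllPairsP.map⁺ (AllPairs.map (λ lt → inj₂ (refl , lt))
  (AllPairsP.filter⁺ _ (idx-sorted n)))

variables-sorted : ∀ n → AllPairs Before (variables n)
variables-sorted n = AllPairsP.concat⁺
  (AllP.map⁺ (All.tabulate λ {z} _ → column-sorted n z))
  (AllPairsP.map⁺ (AllPairs.map (λ {z} {z′} z<z′ →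
     All.tabulate λ x∈ → All.tabulate λ y∈ → cross z<z′ x∈ y∈) (idx-sorted n)))
  where
  cross : ∀ {z z′ x y} → z < z′ → x ∈ column n z → y ∈ column n z′ → Before x y
  cross {z} {z′} z<z′ x∈ y∈
    with _ , refl , _ ← ∈-column⁻ {n} {z} x∈ | _ , refl , _ ← ∈-column⁻ {n} {z′} y∈ = inj₁ z<z′

∈-variables⁺ : ∀ {n i z} → Valid n i z → (i , z) ∈ variables n
∈-variables⁺ {n} v = concatMap-∈⁺ (column n) (∈-idx⁺ (1≤col v) (col≤n v)) (∈-column⁺ (1≤row v , row≤n v , row≢col v))

∈-variables⁻ : ∀ {n i z} → (i , z) ∈ variables n → Valid n i z
∈-variables⁻ {n} x∈ with z , z∈ , x∈′ ← concatMap-∈⁻ (column n) (idx n) x∈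
  with i , refl , 1≤i , i≤ , i≢ ← ∈-column⁻ {n} {z} x∈′ | 1≤z , z≤ ← ∈-idx⁻ {n} z∈ =
  valid 1≤i i≤ 1≤z z≤ i≢

pickFirstMax-here : ∀ s x xs → (∀ {y} → y ∈ xs → s y ≤ℚ s x) → pickFirstMax s (just x) xs ≡ just x
pickFirstMax-here s x [] h = refl
pickFirstMax-here s x (y ∷ ys) h with s x ℚP.<? s y
... | yes lt = contradiction (ℚP.<-≤-trans lt (h (here refl))) (ℚP.<-irrefl refl)
... | no _ = pickFirstMax-here s x ys (h ∘ there)

pickFirstMax-∈ : ∀ s b xs {x} → (∀ y → b ≡ just y → s y <ℚ s x) → x ∈ xs → AllPairs Before xs →
  (∀ {y} → y ∈ xs → Before y x → s y <ℚ s x) → (∀ {y} → y ∈ xs → Before x y → s y ≤ℚ s x) →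
  pickFirstMax s b xs ≡ just x
pickFirstMax-∈ s nothing (x ∷ xs) _ (here refl) (x< ∷ _) lt le =
  pickFirstMax-here s x xs λ y∈ → le (there y∈) (All.lookup x< y∈)
pickFirstMax-∈ s nothing (y ∷ xs) _ (there x∈) (y< ∷ ap) lt le =
  pickFirstMax-∈ s (just y) xs (λ { _ refl → lt (here refl) (All.lookup y< x∈) }) x∈ ap (lt ∘ there) (le ∘ there)
pickFirstMax-∈ s (just b) (y ∷ xs) hb (here refl) (x< ∷ _) lt le with s b ℚP.<? s y
... | yes _ = pickFirstMax-here s y xs λ y∈ → le (there y∈) (All.lookup x< y∈)
... | no ¬lt = contradiction (hb b refl) ¬lt
pickFirstMax-∈ s (just b) (y ∷ xs) hb (there x∈) (y< ∷ ap) lt le with s b ℚP.<? s y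
... | yes _ = pickFirstMax-∈ s (just y) xs (λ { _ refl → lt (here refl) (All.lookup y< x∈) }) x∈ ap (lt ∘ there) (le ∘ there)
... | no _ = pickFirstMax-∈ s (just b) xs hb x∈ ap (lt ∘ there) (le ∘ there)

pick-first : ∀ n δ ls t {m c M} → ScoreInv (score δ ls) → Dominates (score δ ls) c M → m ≤ M →
  Valid n m c → (m , c) ∉ vars t → (∀ {x} → 1 ≤ x → x < m → x ≢ c → (x , c) ∈ vars t) →
  pick n δ ls t ≡ just (m , c)
pick-first n δ ls t {m} {c} I dom m≤M v m∉ low =
  pickFirstMax-∈ (score δ ls) nothing _ (λ _ ())
    (∈-filter⁺ free? (∈-variables⁺ v) (m∉ ∘ isAssigned⁻ t))
    (AllPairsP.filter⁺ free? (variables-sorted n)) earlier later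
  where
  free? : ∀ x → Dec (¬ isAssigned t x ≡ true)
  free? x = ¬? (Data.Bool._≟_ (isAssigned t x) true)
  mr : InRow c _ m
  mr = 1≤row v , m≤M , row≢col v
  earlier : ∀ {y} → y ∈ filter free? (variables n) → Before y (m , c) → score δ ls y <ℚ score δ ls (m , c)
  earlier {i , z} y∈ bf with y∈v , fr ← ∈-filter⁻ free? {xs = variables n} y∈ with vy ← ∈-variables⁻ {n} y∈v | bf
  ... | inj₁ z<c = proj₁ (dom mr i (1≤col vy)) z<c
  ... | inj₂ (refl , i<m) = contradiction (isAssigned⁺ t (low (1≤row vy) i<m (row≢col vy))) fr
  later : ∀ {y} → y ∈ filter free? (variables n) → Before (m , c) y → score δ ls y ≤ℚ score δ ls (m , c)
  later {i , z} y∈ bf with y∈v , fr ← ∈-filter⁻ free? {xs = variables n} y∈ with vy ← ∈-variables⁻ {n} y∈v | bf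
  ... | inj₁ c<z = proj₂ (dom mr i (1≤col vy)) c<z
  ... | inj₂ (refl , m<i) = mono I (1≤row v) (<⇒≤ m<i) (row≢col v)

-- Propagation between two restarts

lits-++⁻ : ∀ xs {ys l} → l ∈ lits (xs ++ ys) → l ∈ lits xs ⊎ l ∈ lits ys
lits-++⁻ xs {ys} l∈ = ∈-++⁻ (lits xs) (subst (_ ∈_) (ListP.map-++ lit xs ys) l∈)

lits-++ˡ : ∀ xs {ys l} → l ∈ lits xs → l ∈ lits (xs ++ ys)
lits-++ˡ xs {ys} l∈ = subst (_ ∈_) (sym (ListP.map-++ lit xs ys)) (∈-++⁺ˡ l∈)

lits-++ʳ : ∀ xs {ys l} → l ∈ lits ys → l ∈ lits (xs ++ ys)
lits-++ʳ xs {ys} l∈ = subst (_ ∈_) (sym (ListP.map-++ lit xs ys)) (∈-++⁺ʳ (lits xs) l∈)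

lits-take : ∀ k t {l} → l ∈ lits (take k t) → l ∈ lits t
lits-take k t l∈ = subst (λ z → _ ∈ lits z) (ListP.take++drop≡id k t) (lits-++ˡ (take k t) l∈)

drop-∷ʳ : ∀ {X : Set} k (xs : List X) {e es y} → drop k xs ≡ e ∷ es → drop k (xs ∷ʳ y) ≡ e ∷ es ∷ʳ y
drop-∷ʳ zero (x ∷ xs) refl = refl
drop-∷ʳ (suc k) (x ∷ xs) eq = drop-∷ʳ k xs eq

drop-<  : ∀ {X : Set} k (xs : List X) {e es} → drop k xs ≡ e ∷ es → k < length xs
drop-< zero (x ∷ xs) eq = s≤s z≤n
drop-< (suc k) (x ∷ xs) eq = s≤s (drop-< k xs eq)

drop-[]⇒≤ : ∀ {X : Set} k (xs : List X) → drop k xs ≡ [] → length xs ≤ k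
drop-[]⇒≤ k [] eq = z≤n
drop-[]⇒≤ (suc k) (x ∷ xs) eq = s≤s (drop-[]⇒≤ k xs eq)

drop-∈ : ∀ {X : Set} k (xs : List X) {e es} → drop k xs ≡ e ∷ es → e ∈ xs
drop-∈ zero (x ∷ xs) refl = here refl
drop-∈ (suc k) (x ∷ xs) eq = there (drop-∈ k xs eq)

drop-⊆ : ∀ {X : Set} k (xs : List X) {e} → e ∈ drop k xs → e ∈ xs
drop-⊆ zero xs e∈ = e∈
drop-⊆ (suc k) (x ∷ xs) e∈ = there (drop-⊆ k xs e∈)

drop-suc-⊆ : ∀ {X : Set} k (xs : List X) {e} → e ∈ drop (suc k) xs → e ∈ drop k xs
drop-suc-⊆ zero (x ∷ xs) e∈ = there e∈
drop-suc-⊆ (suc k) (x ∷ xs) e∈ = drop-suc-⊆ k xs e∈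

take-suc : ∀ {X : Set} k (xs : List X) {e es} → drop k xs ≡ e ∷ es → take (suc k) xs ≡ take k xs ∷ʳ e
take-suc zero (x ∷ xs) refl = refl
take-suc (suc k) (x ∷ xs) eq = cong (x ∷_) (take-suc k xs eq)

take-∷ʳ : ∀ {X : Set} k (xs : List X) {y} → k ≤ length xs → take k (xs ∷ʳ y) ≡ take k xs
take-∷ʳ zero xs le = refl
take-∷ʳ (suc k) (x ∷ xs) (s≤s le) = cong (x ∷_) (take-∷ʳ k xs le)

drop-++-≥ : ∀ {X : Set} k (xs ys : List X) → length xs ≤ k → drop k (xs ++ ys) ≡ drop (k ∸ length xs) ys
drop-++-≥ k [] ys le = refl
drop-++-≥ (suc k) (x ∷ xs) ys (s≤s le) = drop-++-≥ k xs ys le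

drop-++-cases : ∀ {X : Set} k (xs : List X) {p ys e es} → drop k (xs ++ p ∷ ys) ≡ e ∷ es →
  e ∈ drop k xs ⊎ (e ≡ p ⊎ (length xs < k × e ∈ ys))
drop-++-cases zero [] refl = inj₂ (inj₁ refl)
drop-++-cases (suc k) [] {ys = ys} eq = inj₂ (inj₂ (s≤s z≤n , drop-∈ k ys eq))
drop-++-cases zero (x ∷ xs) refl = inj₁ (here refl)
drop-++-cases (suc k) (x ∷ xs) eq with drop-++-cases k xs eq
... | inj₁ a = inj₁ a
... | inj₂ (inj₁ b) = inj₂ (inj₁ b)
... | inj₂ (inj₂ (lt , c)) = inj₂ (inj₂ (s≤s lt , c))

take-++-> : ∀ k (t₁ : Trail) {p rest l} → length t₁ < k → l ∈ lits (t₁ ∷ʳ p) → l ∈ lits (take k (t₁ ++ p ∷ rest))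
take-++-> (suc k) [] lt (here refl) = here refl
take-++-> (suc k) (x ∷ t₁) (s≤s lt) (here refl) = here refl
take-++-> (suc k) (x ∷ t₁) (s≤s lt) (there l∈) = there (take-++-> k t₁ lt l∈)

-- u = nothing for a falsified clause, u = just m for a clause with unit literal m.
AllFalseBut : Trail → Clause → Maybe Lit → Set
AllFalseBut t cl u = ∀ {l} → l ∈ cl → complement l ∈ lits t ⊎ (u ≡ just l × l ∉ lits t × complement l ∉ lits t)

unit⇒allFalseBut : ∀ t cl {m} → status t cl ≡ unit m → AllFalseBut t cl (just m) × m ∈ cl × m ∉ lits t × complement m ∉ lits t
unit⇒allFalseBut t cl {m} eq with status t cl | statusView t cl
unit⇒allFalseBut t cl {m} refl | _ | uni m∈ m∉ m̄∉ others = F , m∈ , m∉ , m̄∉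
  where
  F : AllFalseBut t cl (just m)
  F {l} l∈ with l ≟L m
  ... | yes refl = inj₂ (refl , m∉ , m̄∉)
  ... | no l≢m = inj₁ (others l∈ l≢m)

falsified⇒allFalseBut : ∀ t cl → status t cl ≡ falsified → AllFalseBut t cl nothing
falsified⇒allFalseBut t cl eq l∈ with status t cl | statusView t cl
falsified⇒allFalseBut t cl refl l∈ | _ | fal f = inj₁ (f l∈)

-- A falsified transitivity clause is filed under `second`, together with the unit literal ¬P(j,k):
-- what excludes the one, usually a statement about P(i,j), excludes the other as well.
data ACase (t : Trail) (u : Maybe Lit) (i j k : ℕ) : Set where
  first  : u ≡ just (neg (i , j)) → neg (i , j) ∉ lits t → pos (j , k) ∈ lits t → neg (i , k) ∈ lits t → ACase t u i j k
  second : (u ≡ just (neg (j , k)) × neg (j , k) ∉ lits t) ⊎ pos (j , k) ∈ lits t →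
           pos (i , j) ∈ lits t → neg (i , k) ∈ lits t → ACase t u i j k
  third  : u ≡ just (pos (i , k)) → pos (i , k) ∉ lits t → neg (i , k) ∉ lits t →
           pos (i , j) ∈ lits t → pos (j , k) ∈ lits t → ACase t u i j k

aCase : ∀ {t u n i j k} → Valid n i j → AllFalseBut t (A i j k) u → ACase t u i j k
aCase v F with F (here refl) | F (there (here refl)) | F (there (there (here refl)))
... | inj₁ a | inj₁ b | inj₁ c = second (inj₂ b) a c
... | inj₁ a | inj₁ b | inj₂ (eq , c , c′) = third eq c c′ a b
... | inj₁ a | inj₂ (eq , b , _) | inj₁ c = second (inj₁ (eq , b)) a c
... | inj₁ a | inj₂ (refl , _) | inj₂ (() , _)
... | inj₂ (eq , a , _) | inj₁ b | inj₁ c = first eq a b c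
... | inj₂ (refl , _) | _ | inj₂ (() , _)
... | inj₂ (refl , _) | inj₂ (refl , _) | _ = contradiction refl (row≢col v)

-- closed: a clause whose literals other than m are falsified by the processed part of the trail
-- has been propagated. It is what makes the breadth-first queue order usable.
record Sound (n : ℕ) (db : List Clause) (t : Trail) (k : ℕ) : Set where
  field
    k≤     : k ≤ length t
    uniq   : Unique (vars t)
    ranged : ∀ {v} → v ∈ vars t → v ∈ variables n
    closed : ∀ {c m} → c ∈ db → m ∈ c → (∀ {l} → l ∈ c → l ≢ m → complement l ∈ lits (take k t)) → m ∈ lits t

  cons : Consistent t
  cons = unique⇒consistent t uniq
open Sound

inDB-var : ∀ {n Row c l} → (∀ {z s} → Row z s → 1 ≤ z × z ≤ n × z ≤ s × s ≤ n) → InDB n Row c → l ∈ c → var l ∈ variables n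
inDB-var rr (vA ij jk ik) (here refl) = ∈-variables⁺ ij
inDB-var rr (vA ij jk ik) (there (here refl)) = ∈-variables⁺ jk
inDB-var rr (vA ij jk ik) (there (there (here refl))) = ∈-variables⁺ ik
inDB-var rr (vB ij) (here refl) = ∈-variables⁺ ij
inDB-var rr (vB ij) (there (here refl)) = ∈-variables⁺ (valid-sym ij)
inDB-var rr (vR r R) l∈ with _ , refl , 1≤i , i≤s , i≢z ← rows⇒ R l∈ | 1≤z , z≤ , _ , s≤ ← rr r =
  ∈-variables⁺ (valid 1≤i (≤-trans i≤s s≤) 1≤z z≤ i≢z)

module _ {n : ℕ} {db : List Clause} where

  sound-append : ∀ {t k} e → Sound n db t k → var (lit e) ∈ variables n → var (lit e) ∉ vars t →
    Sound n db (t ∷ʳ e) k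
  sound-append {t} {k} e S v∈ v∉ = record
    { k≤     = ≤-trans (k≤ S) (subst (length t ≤_) (sym (ListP.length-++ t)) (ℕP.m≤m+n _ _))
    ; uniq   = subst Unique (sym (ListP.map-++ _ t _)) (unique-∷ʳ (uniq S) v∉)
    ; ranged = λ w∈ → case ∈-++⁻ (vars t) (subst (_ ∈_) (ListP.map-++ _ t _) w∈) of λ
        { (inj₁ w∈t) → ranged S w∈t ; (inj₂ (here refl)) → v∈ }
    ; closed = λ c∈ m∈ h → lits-++ˡ t (closed S c∈ m∈ λ l∈ l≢ →
        subst (λ z → _ ∈ lits z) (take-∷ʳ k t (k≤ S)) (h l∈ l≢)) }

  -- A clause for which the newly processed entry matters contains its complement, and these are the
  -- clauses known to be quiet. Any other clause was covered by `closed` before.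
  sound-advance : ∀ {t k e es} → Sound n db t k → drop k t ≡ e ∷ es →
    (∀ c → c ∈ db → complement (lit e) ∈ c → Quiet (status t c)) → Sound n db t (suc k)
  sound-advance {t} {k} {e} S dk quiet = record
    { k≤ = drop-< k t dk ; uniq = uniq S ; ranged = ranged S ; closed = closed′ }
    where
    closed′ : ∀ {c m} → c ∈ db → m ∈ c → (∀ {l} → l ∈ c → l ≢ m → complement l ∈ lits (take (suc k) t)) → m ∈ lits t
    closed′ {c} {m} c∈ m∈ h with DecMem._∈?_ _≟L_ (complement (lit e)) c
    ... | yes ē∈ = quiet-force (cons S) (quiet c c∈ ē∈) λ l∈ l≢ → lits-take (suc k) t (h l∈ l≢)
    ... | no ē∉ = closed S c∈ m∈ λ {l} l∈ l≢ →
      case lits-++⁻ (take k t) (subst (λ z → complement l ∈ lits z) (take-suc k t dk) (h l∈ l≢)) of λ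
        { (inj₁ q) → q
        ; (inj₂ (here q)) → contradiction (subst (_∈ c) (trans (sym (comp-invol l)) (cong complement q)) l∈) ē∉ }

  -- With an empty queue `take k t` is the whole trail, so `closed` leaves nothing to propagate. The
  -- rule `propagate₀` thus matters only at starts that are not sound, where a learned unit clause
  -- waits on an empty trail.
  sound-unit₀ : ∀ {t k c m} → Sound n db t k → drop k t ≡ [] → c ∈ db → status t c ≢ unit m
  sound-unit₀ {t} {k} {c} {m} S dk c∈ eq with F , m∈ , m∉ , _ ← unit⇒allFalseBut t c eq =
    m∉ (closed S c∈ m∈ λ {l} l∈ l≢ → subst (λ z → complement l ∈ lits z)
      (sym (ListP.take-all k t (drop-[]⇒≤ k t dk)))
      (case F l∈ of λ { (inj₁ q) → q ; (inj₂ (refl , _)) → contradiction refl l≢ }))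

  sound-falsified₀ : ∀ {t k c l} → Sound n db t k → drop k t ≡ [] → c ∈ db → l ∈ c → status t c ≢ falsified
  sound-falsified₀ {t} {k} {c} {l} S dk c∈ l∈ eq = cons S
    (closed S c∈ l∈ λ {l′} l′∈ _ → subst (λ z → complement l′ ∈ lits z)
      (sym (ListP.take-all k t (drop-[]⇒≤ k t dk))) (neg-in l′∈))
    (neg-in l∈)
    where
    neg-in : ∀ {l} → l ∈ c → complement l ∈ lits t
    neg-in l∈ with falsified⇒allFalseBut t c eq l∈
    ... | inj₁ q = q

-- The rows of column s that P(s,c) makes false: row c by antisymmetry, the other rows below s by
-- transitivity with ¬P(x,c).
NegIn : (z s x : ℕ) → Set
NegIn c s x = 1 ≤ x × (x < s ⊎ x ≡ c)

-- Bounds on the trail before and after the propagation of P(s,c). The column b is the one with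
-- P(c,b) true from an earlier stage; b = 0 encodes that there is none.
UpBefore : (s c b : ℕ) → Lit → Set
UpBefore s c b (pos (y , z)) = y ≡ c × z ≡ b × 1 ≤ b
UpBefore s c b (neg (y , z)) = (z ≡ b × 1 ≤ b × 1 ≤ y × y < s) ⊎ (z ≡ c × 1 ≤ y × y < s × y ≢ c)

UpAfter : (s c b : ℕ) → Lit → Set
UpAfter s c b (pos (y , z)) = (y ≡ c × z ≡ b × 1 ≤ b) ⊎ (y ≡ s × z ≡ c) ⊎ (y ≡ s × z ≡ b × 1 ≤ b)
UpAfter s c b (neg (y , z)) =
  (z ≡ b × 1 ≤ b × 1 ≤ y × y < s) ⊎ (z ≡ c × 1 ≤ y × y < s × y ≢ c) ⊎ (z ≡ s × NegIn c s y)

-- The possible consequences of P(s,c). `gB` and `gB′` differ only in the reason: antisymmetry of a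
-- pair is present in both literal orders, and either copy may be visited first. `gC` arises from
-- P(s,c) and P(c,b).
data Good (s c b : ℕ) : Entry → Set where
  gA : ∀ {x} → 1 ≤ x → x < s → x ≢ c → Good s c b (entry (neg (x , s)) (just (A x s c)))
  gB : Good s c b (entry (neg (c , s)) (just (B s c)))
  gB′ : Good s c b (entry (neg (c , s)) (just (B c s)))
  gC : 1 ≤ b → Good s c b (entry (pos (s , b)) (just (A s c b)))

good-propagated : ∀ {s c b e} → Good s c b e → Propagated e
good-propagated (gA _ _ _) = _ , refl
good-propagated gB = _ , refl
good-propagated gB′ = _ , refl
good-propagated (gC _) = _ , refl

NegCol : ℕ → ℕ → Entry → Set
NegCol c s e = ∃ λ x → lit e ≡ neg (x , c) × 1 ≤ x × x < s × x ≢ c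

after : Trail → ℕ → ℕ → Clause → List Entry → Trail
after t₁ s c c₀ rest = t₁ ++ entry (pos (s , c)) (just c₀) ∷ rest

-- The trail `t₁` ends just before P(s,c), which is propagated by `c₀`, the shortest row clause of
-- its column. `up` and `low` bound `t₁` from both sides, and `pend` allows for falsified literals
-- of column `c` that are still in the queue.
record PState (n : ℕ) (Row : ℕ → ℕ → Set) (s c b : ℕ) (t₁ : Trail) (c₀ : Clause) (rest : List Entry) (k : ℕ) : Set where
  field
    vsc   : Valid n s c
    b≢c   : b ≢ c
    b<s   : 1 ≤ b → b < s
    b≢s   : b ≢ s
    c₀-rows : Rows c₀ c s
    up    : ∀ {l} → l ∈ lits t₁ → UpBefore s c b l
    low   : ∀ {x} → 1 ≤ x → x < s → x ≢ c → neg (x , c) ∈ lits t₁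
    goods : All (Good s c b) rest
    pend  : ∀ {e} → e ∈ drop k t₁ → NegCol c s e
    minC  : ∀ {s′} → Row c s′ → s ≤ s′
open PState

module PPhase {n : ℕ} {Row : ℕ → ℕ → Set} {db : List Clause} (dbase : Database n Row db)
  (rowRange : ∀ {z s} → Row z s → 1 ≤ z × z ≤ n × z ≤ s × s ≤ n)
  {s c b : ℕ} {t₁ : Trail} {c₀ : Clause} where

  open Database dbase

  module _ {rest : List Entry} {k : ℕ} (P : PState n Row s c b t₁ c₀ rest k) where

    T₀ : Trail
    T₀ = after t₁ s c c₀ rest

    1≤s : 1 ≤ s
    1≤s = 1≤row (vsc P)

    s≢c : s ≢ c
    s≢c = row≢col (vsc P)

    p∈ : pos (s , c) ∈ lits T₀
    p∈ = lits-++ʳ t₁ (here refl)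

    upT : ∀ {l} → l ∈ lits T₀ → UpAfter s c b l
    upT {l} l∈ with lits-++⁻ t₁ l∈
    upT {pos _} l∈ | inj₁ q = inj₁ (up P q)
    upT {neg _} l∈ | inj₁ q = [ inj₁ , inj₂ ∘ inj₁ ]′ (up P q)
    upT l∈ | inj₂ (here refl) = inj₂ (inj₁ (refl , refl))
    upT l∈ | inj₂ (there q) with e , e∈ , refl ← ∈-map⁻ lit q with All.lookup (goods P) e∈
    ... | gA 1≤x x<s _ = inj₂ (inj₂ (refl , 1≤x , inj₁ x<s))
    ... | gB = inj₂ (inj₂ (refl , 1≤col (vsc P) , inj₂ refl))
    ... | gB′ = inj₂ (inj₂ (refl , 1≤col (vsc P) , inj₂ refl))
    ... | gC 1≤b = inj₂ (inj₂ (refl , refl , 1≤b))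

    row-s-not-neg : ∀ {y} → neg (s , y) ∉ lits T₀
    row-s-not-neg q with upT q
    ... | inj₁ (_ , _ , _ , s<s) = <-irrefl refl s<s
    ... | inj₂ (inj₁ (_ , _ , s<s , _)) = <-irrefl refl s<s
    ... | inj₂ (inj₂ (_ , _ , inj₁ s<s)) = <-irrefl refl s<s
    ... | inj₂ (inj₂ (_ , _ , inj₂ s≡c)) = s≢c s≡c

    col-s-not-pos : ∀ {y} → pos (y , s) ∉ lits T₀
    col-s-not-pos q with upT q
    ... | inj₁ (_ , s≡b , _) = b≢s P (sym s≡b)
    ... | inj₂ (inj₁ (_ , s≡c)) = s≢c s≡c
    ... | inj₂ (inj₂ (_ , s≡b , _)) = b≢s P (sym s≡b)

    row-x-pos : ∀ {x y} → NegIn c s x → pos (x , y) ∈ lits T₀ → x ≡ c × y ≡ b × 1 ≤ b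
    row-x-pos nx q with upT q
    ... | inj₁ r = r
    row-x-pos (_ , inj₁ s<s) q | inj₂ (inj₁ (refl , _)) = contradiction s<s (<-irrefl refl)
    row-x-pos (_ , inj₂ s≡c) q | inj₂ (inj₁ (refl , _)) = contradiction s≡c s≢c
    row-x-pos (_ , inj₁ s<s) q | inj₂ (inj₂ (refl , _)) = contradiction s<s (<-irrefl refl)
    row-x-pos (_ , inj₂ s≡c) q | inj₂ (inj₂ (refl , _)) = contradiction s≡c s≢c

    Filled : Set
    Filled = ∀ {x} → NegIn c s x → neg (x , s) ∈ lits T₀

    -- `length t₁ < k` says that P(s,c) has been processed, so `closed` applies to the transitivity
    -- and antisymmetry clauses in question. Column `s` is thus complete before any of its false
    -- literals is processed, in whatever order these were added.
    fill : Sound n db T₀ k → length t₁ < k → Filled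
    fill S lt {x} (1≤x , x<s) with x ≟ c
    ... | yes refl = closed S (hasB (vsc P)) (there (here refl)) λ
      { (here refl) _ → take-++-> k t₁ lt (lits-++ʳ t₁ (here refl))
      ; (there (here refl)) ≢ → contradiction refl ≢ }
    ... | no x≢c = closed S (hasA (valid 1≤x (<⇒≤ (ℕP.<-≤-trans x<s′ (row≤n (vsc P)))) 1≤s (row≤n (vsc P)) (ℕP.<⇒≢ x<s′))
        (vsc P) (valid 1≤x (<⇒≤ (ℕP.<-≤-trans x<s′ (row≤n (vsc P)))) (1≤col (vsc P)) (col≤n (vsc P)) x≢c)) (here refl) λ
      { (here refl) ≢ → contradiction refl ≢
      ; (there (here refl)) _ → take-++-> k t₁ lt (lits-++ʳ t₁ (here refl))
      ; (there (there (here refl))) _ → take-++-> k t₁ lt (lits-++ˡ t₁ (low P 1≤x x<s′ x≢c)) }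
      where
      x<s′ : x < s
      x<s′ = [ id , (λ x≡c → contradiction x≡c x≢c) ]′ x<s

    record RowCase (e : Entry) (cl : Clause) : Set where
      field
        {x s′}  : ℕ
        lit-e   : lit e ≡ neg (x , s)
        negIn   : NegIn c s x
        filled  : Filled
        row     : Row s s′
        isRows  : Rows cl s s′
        passed  : length t₁ < k

    -- The cases are the position of the pending entry: before P(s,c), P(s,c) itself, or after it.
    -- Only in the last case can a row clause react, one of column `s`; this `RowCase` is the point
    -- where the kinds of round part.
    p-clause : ∀ {e es cl u} → Sound n db T₀ k → drop k T₀ ≡ e ∷ es → cl ∈ db → complement (lit e) ∈ cl →
      AllFalseBut T₀ cl u → (∃ λ m → u ≡ just m × Good s c b (entry m (just cl))) ⊎ RowCase e cl
    p-clause {cl = cl} {u} S dk cl∈ ē∈ F with drop-++-cases k t₁ dk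
    ... | inj₁ e∈ with x , refl , 1≤x , x<s , x≢c ← pend P e∈ = goal (view cl∈) ē∈
      where
      goal : InDB n Row cl → pos (x , c) ∈ cl → (∃ λ m → u ≡ just m × Good s c b (entry m (just cl))) ⊎ RowCase _ cl
      goal (vA ij jk ik) (there (there (here refl))) with aCase ij F
      ... | third _ _ x∉ _ _ = contradiction (lits-++ˡ t₁ (low P 1≤x x<s x≢c)) x∉
      ... | second _ p _ = contradiction (proj₁ (row-x-pos (1≤x , inj₁ x<s) p)) x≢c
      ... | first eq _ p _ with upT p
      ...   | inj₁ (j≡c , _) = contradiction j≡c (row≢col jk)
      ...   | inj₂ (inj₁ (refl , _)) = inj₁ (_ , eq , gA 1≤x x<s x≢c)
      ...   | inj₂ (inj₂ (_ , c≡b , _)) = contradiction (sym c≡b) (b≢c P)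
      goal (vB _) (here ())
      goal (vB _) (there (here ()))
      -- By `minC` every row clause of column `c` contains the true literal P(s,c).
      goal (vR r R) x∈ with _ , refl , _ ← rows⇒ R x∈ with F (⇒rows R (1≤s , minC P r , s≢c))
      ... | inj₁ q = contradiction q (cons S p∈)
      ... | inj₂ (_ , q , _) = contradiction p∈ q
    ... | inj₂ (inj₁ refl) = goal (view cl∈) ē∈
      where
      goal : InDB n Row cl → neg (s , c) ∈ cl → (∃ λ m → u ≡ just m × Good s c b (entry m (just cl))) ⊎ RowCase _ cl
      goal (vA ij jk ik) (here refl) with aCase ij F
      ... | first _ _ _ q = contradiction q row-s-not-neg
      ... | second _ _ q = contradiction q row-s-not-neg
      ... | third eq _ _ _ q with upT q
      ...   | inj₁ (_ , refl , 1≤b) = inj₁ (_ , eq , gC 1≤b)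
      ...   | inj₂ (inj₁ (c≡s , _)) = contradiction (sym c≡s) s≢c
      ...   | inj₂ (inj₂ (c≡s , _)) = contradiction (sym c≡s) s≢c
      goal (vA ij jk ik) (there (here refl)) with aCase ij F
      ... | second _ p _ = contradiction p col-s-not-pos
      ... | third _ _ _ p _ = contradiction p col-s-not-pos
      ... | first eq _ _ q with upT q
      ...   | inj₁ (c≡b , _) = contradiction (sym c≡b) (b≢c P)
      ...   | inj₂ (inj₁ (_ , 1≤i , i<s , i≢c)) = inj₁ (_ , eq , gA 1≤i i<s i≢c)
      ...   | inj₂ (inj₂ (c≡s , _)) = contradiction (sym c≡s) s≢c
      goal (vA ij jk ik) (there (there (here ())))
      goal (vB ij) (here refl) with F (there (here refl))
      ... | inj₁ q = contradiction q col-s-not-pos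
      ... | inj₂ (eq , _) = inj₁ (_ , eq , gB)
      goal (vB ij) (there (here refl)) with F (here refl)
      ... | inj₁ q = contradiction q col-s-not-pos
      ... | inj₂ (eq , _) = inj₁ (_ , eq , gB′)
      goal (vR r R) x∈ with () ← proj₁ (proj₂ (rows⇒ R x∈))
    ... | inj₂ (inj₂ (lt , e∈)) = by-good (All.lookup (goods P) e∈) ē∈
      where
      filled : Filled
      filled = fill S lt

      neg-row : ∀ {e x} → lit e ≡ neg (x , s) → NegIn c s x → InDB n Row cl → pos (x , s) ∈ cl →
        (∃ λ m → u ≡ just m × Good s c b (entry m (just cl))) ⊎ RowCase e cl
      neg-row _ nx (vA ij jk ik) (there (there (here refl))) with aCase ij F
      ... | first _ _ q _ = contradiction q col-s-not-pos
      ... | third _ _ x∉ _ _ = contradiction (filled nx) x∉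
      -- The positive literal can only be P(c,b), so the clause is `A c b s`; it is satisfied, since
      -- b < s puts ¬P(b,s) on the trail.
      ... | second q p _ with refl , refl , 1≤b ← row-x-pos nx p with q
      ...   | inj₁ (_ , b∉) = contradiction (filled (1≤b , inj₁ (b<s P 1≤b))) b∉
      ...   | inj₂ q′ = contradiction q′ col-s-not-pos
      neg-row _ nx (vB _) (here ())
      neg-row _ nx (vB _) (there (here ()))
      neg-row eq nx (vR r R) x∈ with _ , refl , _ ← rows⇒ R x∈ =
        inj₂ record { lit-e = eq ; negIn = nx ; filled = filled ; row = r ; isRows = R ; passed = lt }

      aux : 1 ≤ b → InDB n Row cl → neg (s , b) ∈ cl →
        ∀ {e} → (∃ λ m → u ≡ just m × Good s c b (entry m (just cl))) ⊎ RowCase e cl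
      aux 1≤b (vA ij jk ik) (here refl) with aCase ij F
      ... | first _ _ _ q = contradiction q row-s-not-neg
      ... | second _ _ q = contradiction q row-s-not-neg
      ... | third _ _ _ _ q with upT q
      ...   | inj₁ (b≡c , _) = contradiction b≡c (b≢c P)
      ...   | inj₂ (inj₁ (b≡s , _)) = contradiction b≡s (b≢s P)
      ...   | inj₂ (inj₂ (b≡s , _)) = contradiction b≡s (b≢s P)
      aux 1≤b (vA ij jk ik) (there (here refl)) with aCase ij F
      ... | second _ p _ = contradiction p col-s-not-pos
      ... | third _ _ _ p _ = contradiction p col-s-not-pos
      ... | first _ i∉ _ q with upT q
      ...   | inj₁ (_ , _ , 1≤i , i<s) = contradiction (filled (1≤i , inj₁ i<s)) i∉
      ...   | inj₂ (inj₁ (b≡c , _)) = contradiction b≡c (b≢c P)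
      ...   | inj₂ (inj₂ (b≡s , _)) = contradiction b≡s (b≢s P)
      aux 1≤b (vA ij jk ik) (there (there (here ())))
      aux 1≤b (vB ij) (here refl) with F (there (here refl))
      ... | inj₁ q = contradiction q col-s-not-pos
      ... | inj₂ (_ , b∉ , _) = contradiction (filled (1≤b , inj₁ (b<s P 1≤b))) b∉
      aux 1≤b (vB ij) (there (here refl)) with F (here refl)
      ... | inj₁ q = contradiction q col-s-not-pos
      ... | inj₂ (_ , b∉ , _) = contradiction (filled (1≤b , inj₁ (b<s P 1≤b))) b∉
      aux 1≤b (vR r R) x∈ with () ← proj₁ (proj₂ (rows⇒ R x∈))

      by-good : ∀ {e} → Good s c b e → complement (lit e) ∈ cl →
        (∃ λ m → u ≡ just m × Good s c b (entry m (just cl))) ⊎ RowCase e cl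
      by-good (gA 1≤x x<s _) = neg-row refl (1≤x , inj₁ x<s) (view cl∈)
      by-good gB = neg-row refl (1≤col (vsc P) , inj₂ refl) (view cl∈)
      by-good gB′ = neg-row refl (1≤col (vsc P) , inj₂ refl) (view cl∈)
      by-good (gC 1≤b) ē = aux 1≤b (view cl∈) ē

-- Analysis of single and chained conflicts.

record LastLevel (t₁ : Trail) (c h : ℕ) : Set where
  field
    {t₀ us} : Trail
    {d}     : Entry
    {a}     : ℕ
    split   : t₁ ≡ t₀ ++ d ∷ us
    dec     : reason d ≡ nothing
    props   : All Propagated us
    a-row   : InRow c h a
    a-here  : (a , c) ∈ vars (d ∷ us)
    a-only  : ∀ {i} → (i , c) ∈ vars (d ∷ us) → i ≡ a

hasDecision-++ : ∀ t₀ {d us} → reason d ≡ nothing → hasDecision (t₀ ++ d ∷ us) ≡ true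
hasDecision-++ t₀ {d} {us} eq = any-true⁺ isDecision (∈-++⁺ʳ t₀ (here refl)) (isDec eq)
  where
  isDec : reason d ≡ nothing → isDecision d ≡ true
  isDec eq with reason d
  isDec refl | nothing = refl

lits-reverse : ∀ xs {l} → l ∈ lits xs → l ∈ lits (reverse xs)
lits-reverse xs l∈ with e , e∈ , refl ← ∈-map⁻ lit l∈ = ∈-map⁺ lit (AnyP.reverse⁺ e∈)

module GoodChain {c h a : ℕ} {a-in : InRow c h a} {X : Lit → Set} {c₀ : Clause}
  {c₀-rows : Rows c₀ c (suc h)} {h≢c : suc h ≢ c} where

  open FirstUIP c h a a-in X c₀ c₀-rows h≢c

  -- A `gA` reason trades P(x,h+1) for the target P(x,c) and the marker ¬P(h+1,c); for x = a the
  -- target is the new literal of row `a`. The antisymmetry entries concern row `c`, which is not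
  -- row `a`. A `gC` entry is irrelevant because `X` omits its complement.
  goods-chain : ∀ {b es} → (∀ {l} → Target l → X l) → X (neg (suc h , c)) → (1 ≤ b → ¬ X (neg (suc h , b))) →
    All (λ e → Good (suc h) c b e ⊎ ¬ X (complement (lit e))) es → Chain es
  goods-chain xt xp xb [] = []
  goods-chain xt xp xb (inj₂ ¬x ∷ gs) = irr (goods-chain xt xp xb gs) ¬x
  goods-chain {es = _ ∷ es} xt xp xb (inj₁ (gA {x} 1≤x x<s x≢c) ∷ gs) = ok (goods-chain xt xp xb gs) refl
    (λ { (here refl) ≢ → contradiction refl ≢
       ; (there (here refl)) _ → xp , inj₂ (lits-++ʳ es (here refl))
       ; (there (there (here refl))) _ → xt tgt , inj₁ tgt })
    (λ { refl → c , there (there (here refl)) , λ () })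
    (_ , there (here refl) , (λ { refl → h≢c refl }) , inj₁ (_ , refl))
    where
    tgt : Target (pos (x , c))
    tgt = x , refl , 1≤x , ≤-pred x<s , x≢c
  goods-chain {es = _ ∷ es} xt xp xb (inj₁ gB ∷ gs) = ok (goods-chain xt xp xb gs) refl
    (λ { (here refl) _ → xp , inj₂ (lits-++ʳ es (here refl))
       ; (there (here refl)) ≢ → contradiction refl ≢ })
    (λ { refl → contradiction refl (proj₂ (proj₂ a-in)) })
    (_ , here refl , (λ { refl → h≢c refl }) , inj₁ (_ , refl))
  goods-chain {es = _ ∷ es} xt xp xb (inj₁ gB′ ∷ gs) = ok (goods-chain xt xp xb gs) refl
    (λ { (here refl) ≢ → contradiction refl ≢
       ; (there (here refl)) _ → xp , inj₂ (lits-++ʳ es (here refl)) })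
    (λ { refl → contradiction refl (proj₂ (proj₂ a-in)) })
    (_ , there (here refl) , (λ { refl → h≢c refl }) , inj₁ (_ , refl))
  goods-chain xt xp xb (inj₁ (gC 1≤b) ∷ gs) = irr (goods-chain xt xp xb gs) (xb 1≤b)

∉-vars-fresh : ∀ t {junk e l} → Unique (vars (t ++ junk)) → e ∈ junk → complement (lit e) ≡ l → complement l ∉ lits t
∉-vars-fresh t {junk} {e} uq e∈ refl l∈ = unique-++-disjoint (vars t) (subst Unique (ListP.map-++ _ t junk) uq)
  (subst (_∈ vars t) (cong var (comp-invol (lit e))) (lits⇒vars t l∈)) (∈-map⁺ (λ e → var (lit e)) e∈)

module _ {n : ℕ} {Row : ℕ → ℕ → Set} {db : List Clause} (dbase : Database n Row db)
  (rowRange : ∀ {z s} → Row z s → 1 ≤ z × z ≤ n × z ≤ s × s ≤ n) (z₀ h₀ : ℕ) where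

  open PPhase dbase rowRange using (Filled; upT)

  Learns : Trail → Clause → Set
  Learns t cl = hasDecision t ≡ true × Rows (analyze t cl) z₀ h₀

  -- Quantified over everything that depends on the visiting order after P(s,c), so that it can be
  -- established when P(s,c) is propagated and used whenever the conflict is met.
  Analyzable : (s c b : ℕ) → Trail → Clause → Set
  Analyzable s c b t₁ c₀ = ∀ {rest k junk cl} (P : PState n Row s c b t₁ c₀ rest k) → Filled P →
    All Propagated junk → Unique (vars (after t₁ s c c₀ rest ++ junk)) → Rows cl s s → c < s →
    Learns (after t₁ s c c₀ rest ++ junk) cl

  neg-in-rest : ∀ {s c b t₁ c₀ rest k x} → PState n Row s c b t₁ c₀ rest k →
    neg (x , s) ∈ lits (after t₁ s c c₀ rest) → neg (x , s) ∈ lits rest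
  neg-in-rest {t₁ = t₁} P q with lits-++⁻ t₁ q
  ... | inj₂ (there q′) = q′
  ... | inj₁ q′ with up P q′
  ...   | inj₁ (s≡b , _) = contradiction (sym s≡b) (b≢s P)
  ...   | inj₂ (s≡c , _) = contradiction s≡c (row≢col (vsc P))

  below : ∀ {c s i} → c < s → NegIn c s i → i < s
  below c<s (_ , inj₁ i<s) = i<s
  below c<s (_ , inj₂ refl) = c<s

  conf-analyzable : ∀ {c b t₁ c₀} → z₀ ≡ c → LastLevel t₁ c h₀ → Analyzable (suc h₀) c b t₁ c₀
  conf-analyzable {c} {b} {t₁} {c₀} refl L {rest} {k} {junk} {cl} P filled pj uq R c<s
    with t₀ ← LastLevel.t₀ L | d ← LastLevel.d L | us ← LastLevel.us L | a ← LastLevel.a L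
       | refl ← LastLevel.split L | dec ← LastLevel.dec L | props ← LastLevel.props L
       | a-row ← LastLevel.a-row L | a-here ← LastLevel.a-here L | a-only ← LastLevel.a-only L
    = subst (λ t → Learns t cl) (sym assoc) (hasDecision-++ t₀ dec ,
        analyze-rows t₀ d us (rest ++ junk) dec props (AllP.++⁺ (All.map good-propagated (goods P)) pj)
          (subst (Unique ∘ vars) assoc uq) a-here a-only
          (λ (1≤i , i≤h , i≢c) → lits⇒vars (t₀ ++ d ∷ us) (low P 1≤i (s≤s i≤h) i≢c))
          (goods-chain {b = b} inj₁ (inj₂ (inj₁ refl)) ¬Xb (all-reverse _ (AllP.++⁺ (All.map inj₁ (goods P)) (All.tabulate (inj₂ ∘ junk-irr)))))
          within
          (s , ⇒rows R (proj₁ a-row , ≤-trans (proj₁ (proj₂ a-row)) (n≤1+n h₀) , λ { refl → <-irrefl refl (proj₁ (proj₂ a-row)) }))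
          (_ , ⇒rows R (1≤col (vsc P) , <⇒≤ c<s , row≢col (vsc P) ∘ sym) , inj₂ (_ , refl)))
    where
    s = suc h₀
    X : Lit → Set
    X l = (∃ λ i → l ≡ pos (i , c) × InRow c h₀ i) ⊎ l ≡ neg (s , c) ⊎ (∃ λ x → l ≡ pos (x , s) × NegIn c s x)

    open FirstUIP c h₀ a a-row X c₀ (c₀-rows P) (row≢col (vsc P))
    open GoodChain {a-in = a-row} {X} {c₀} {c₀-rows P} {row≢col (vsc P)}

    T₁ = t₀ ++ d ∷ us
    T = after T₁ s c c₀ rest

    assoc : T ++ junk ≡ t₀ ++ d ∷ us ++ p₀ ∷ rest ++ junk
    assoc = trans (ListP.++-assoc T₁ (p₀ ∷ rest) junk) (ListP.++-assoc t₀ (d ∷ us) (p₀ ∷ rest ++ junk))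

    ¬Xb : 1 ≤ b → ¬ X (neg (s , b))
    ¬Xb _ (inj₂ (inj₁ refl)) = b≢c P refl
    ¬Xb _ (inj₁ (_ , () , _))
    ¬Xb _ (inj₂ (inj₂ (_ , () , _)))

    -- Every literal of `X` has its variable assigned in `T`, whereas junk assigns new variables; so
    -- no junk entry is ever resolved on.
    junk-irr : ∀ {e} → e ∈ junk → ¬ X (complement (lit e))
    junk-irr e∈ (inj₁ (i , eq , 1≤i , i≤h , i≢c)) = ∉-vars-fresh T uq e∈ eq (lits-++ˡ T₁ (low P 1≤i (s≤s i≤h) i≢c))
    junk-irr e∈ (inj₂ (inj₁ eq)) = ∉-vars-fresh T uq e∈ eq (lits-++ʳ T₁ (here refl))
    junk-irr e∈ (inj₂ (inj₂ (x , eq , nx))) = ∉-vars-fresh T uq e∈ eq (filled nx)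

    within : ∀ {l} → l ∈ cl → Within (reverse (rest ++ junk)) l
    within l∈ with i , refl , 1≤i , i≤s , i≢s ← rows⇒ R l∈ =
      inj₂ (inj₂ (i , refl , nx)) ,
      inj₂ (lits-++ˡ (reverse (rest ++ junk)) (lits-reverse (rest ++ junk) (lits-++ˡ rest (neg-in-rest P (filled nx)))))
      where
      nx : NegIn c s i
      nx = 1≤i , inj₁ (≤∧≢⇒< i≤s i≢s)

  -- Two stages lie on one decision level: P(s,c) falsifies column s, then D(s) propagates P(n,s),
  -- which falsifies column n. Walking back, the later stage reduces R(n,n) to literals of column s
  -- and ¬P(n,s); resolution with D(s) leaves column s alone, and the earlier stage then proceeds as
  -- for a single conflict.
  chain-analyzable : ∀ {c t₁ c₀ cD rest₁ k₁} → n ≡ suc (suc h₀) → z₀ ≡ c → c < suc h₀ → LastLevel t₁ c h₀ →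
    (P₁ : PState n Row (suc h₀) c 0 t₁ c₀ rest₁ k₁) → Filled P₁ → Rows cD (suc h₀) n →
    Analyzable n (suc h₀) c (after t₁ (suc h₀) c c₀ rest₁) cD
  chain-analyzable {c} {t₁} {c₀} {cD} {rest₁} refl refl c<s L P₁ filled₁ RD {rest} {k} {junk} {cl} P filled pj uq R s<n
    with t₀ ← LastLevel.t₀ L | d ← LastLevel.d L | us ← LastLevel.us L | a ← LastLevel.a L
       | refl ← LastLevel.split L | dec ← LastLevel.dec L | props ← LastLevel.props L
       | a-row ← LastLevel.a-row L | a-here ← LastLevel.a-here L | a-only ← LastLevel.a-only L
    = subst (λ t → Learns t cl) (sym assoc) (hasDecision-++ t₀ dec ,
        analyze-rows t₀ d us (rest₁ ++ q ∷ rest ++ junk) dec props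
          (AllP.++⁺ (All.map good-propagated (goods P₁)) ((_ , refl) ∷ AllP.++⁺ (All.map good-propagated (goods P)) pj))
          (subst (Unique ∘ vars) assoc uq) a-here a-only
          (λ (1≤i , i≤h , i≢c) → lits⇒vars (t₀ ++ d ∷ us) (low P₁ 1≤i (s≤s i≤h) i≢c))
          (subst Chain (sym rev-eq) (second-chain (reverse (rest ++ junk))
            (all-reverse _ (AllP.++⁺ (All.map inj₁ (goods P)) (All.tabulate (inj₂ ∘ junk-irr))))))
          within
          (n , ⇒rows R (proj₁ a-row , ≤-trans a≤h (≤-trans (n≤1+n h₀) (n≤1+n s)) , ℕP.<⇒≢ (s≤s (≤-trans a≤h (n≤1+n h₀)))))
          (_ , ⇒rows R (1≤col (vsc P₁) , <⇒≤ (<-trans c<s (n<1+n s)) , ℕP.<⇒≢ (<-trans c<s (n<1+n s))) , inj₂ (_ , refl)))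
    where
    s = suc h₀
    a≤h = proj₁ (proj₂ a-row)
    X : Lit → Set
    X l = (∃ λ i → l ≡ pos (i , c) × InRow c h₀ i) ⊎ l ≡ neg (s , c) ⊎ (∃ λ x → l ≡ pos (x , s) × NegIn c s x)
        ⊎ l ≡ neg (n , s) ⊎ (∃ λ x → l ≡ pos (x , n) × NegIn s n x)

    open FirstUIP c h₀ a a-row X c₀ (c₀-rows P₁) (row≢col (vsc P₁))
    open GoodChain {a-in = a-row} {X} {c₀} {c₀-rows P₁} {row≢col (vsc P₁)}

    q : Entry
    q = entry (pos (n , s)) (just cD)
    T₁ = t₀ ++ d ∷ us
    T₂ = after T₁ s c c₀ rest₁
    T = after T₂ n s cD rest

    assoc : T ++ junk ≡ t₀ ++ d ∷ us ++ p₀ ∷ rest₁ ++ q ∷ rest ++ junk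
    assoc = trans (ListP.++-assoc T₂ (q ∷ rest) junk) (trans (ListP.++-assoc T₁ (p₀ ∷ rest₁) (q ∷ rest ++ junk))
      (ListP.++-assoc t₀ (d ∷ us) (p₀ ∷ rest₁ ++ q ∷ rest ++ junk)))

    rev-eq : reverse (rest₁ ++ q ∷ rest ++ junk) ≡ reverse (rest ++ junk) ++ q ∷ reverse rest₁
    rev-eq = begin
      reverse (rest₁ ++ q ∷ rest ++ junk)              ≡⟨ ListP.reverse-++ rest₁ (q ∷ rest ++ junk) ⟩
      reverse (q ∷ rest ++ junk) ++ reverse rest₁      ≡⟨ cong (_++ reverse rest₁) (ListP.unfold-reverse q (rest ++ junk)) ⟩
      (reverse (rest ++ junk) ++ q ∷ []) ++ reverse rest₁ ≡⟨ ListP.++-assoc (reverse (rest ++ junk)) _ _ ⟩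
      reverse (rest ++ junk) ++ q ∷ reverse rest₁      ∎
      where open ≡-Reasoning

    neg-s : ∀ {x} es → NegIn c s x → neg (x , s) ∈ lits ((es ++ reverse rest₁) ++ p₀ ∷ [])
    neg-s es nx = lits-++ˡ (es ++ reverse rest₁) (lits-++ʳ es (lits-reverse rest₁ (neg-in-rest P₁ (filled₁ nx))))

    neg-s′ : ∀ {x} es → NegIn c s x → neg (x , s) ∈ lits ((es ++ q ∷ reverse rest₁) ++ p₀ ∷ [])
    neg-s′ es nx = lits-++ˡ (es ++ q ∷ reverse rest₁)
      (lits-++ʳ es (there (lits-reverse rest₁ (neg-in-rest P₁ (filled₁ nx)))))

    q∈ : ∀ es → pos (n , s) ∈ lits ((es ++ q ∷ reverse rest₁) ++ p₀ ∷ [])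
    q∈ es = lits-++ˡ (es ++ q ∷ reverse rest₁) (lits-++ʳ es (here refl))

    first-chain : Chain (reverse rest₁)
    first-chain = goods-chain {b = 0} inj₁ (inj₂ (inj₁ refl)) (λ ()) (all-reverse _ (All.map inj₁ (goods P₁)))

    second-chain : ∀ es → All (λ e → Good n s c e ⊎ ¬ X (complement (lit e))) es → Chain (es ++ q ∷ reverse rest₁)
    second-chain [] [] = ok first-chain refl
      (λ l∈ l≢ → case rows⇒ RD l∈ of λ { (i , refl , 1≤i , i≤n , i≢s) →
         let nx = 1≤i , inj₁ (≤∧≢⇒< (≤-pred (≤∧≢⇒< i≤n λ { refl → l≢ refl })) i≢s)
         in inj₂ (inj₂ (inj₁ (i , refl , nx))) , inj₂ (neg-s [] nx) })
      (λ ())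
      (_ , ⇒rows RD (1≤col (vsc P₁) , <⇒≤ (<-trans c<s (n<1+n s)) , row≢col (vsc P₁) ∘ sym) ,
        (λ { refl → <-irrefl refl (<-trans c<s (n<1+n s)) }) , inj₂ (_ , refl))
    second-chain (e ∷ es) (inj₂ ¬x ∷ gs) = irr (second-chain es gs) ¬x
    second-chain (_ ∷ es) (inj₁ (gA {x} 1≤x x<n x≢s) ∷ gs) = ok (second-chain es gs) refl
      (λ { (here refl) ≢ → contradiction refl ≢
         ; (there (here refl)) _ → inj₂ (inj₂ (inj₂ (inj₁ refl))) , inj₂ (q∈ es)
         ; (there (there (here refl))) _ → inj₂ (inj₂ (inj₁ (x , refl , nx))) , inj₂ (neg-s′ es nx) })
      (λ { refl → s , there (there (here refl)) , λ () })
      (_ , there (here refl) , (λ { () }) , inj₁ (_ , refl))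
      where
      nx : NegIn c s x
      nx = 1≤x , inj₁ (≤∧≢⇒< (≤-pred x<n) x≢s)
    second-chain (_ ∷ es) (inj₁ gB ∷ gs) = ok (second-chain es gs) refl
      (λ { (here refl) _ → inj₂ (inj₂ (inj₂ (inj₁ refl))) , inj₂ (q∈ es)
         ; (there (here refl)) ≢ → contradiction refl ≢ })
      (λ { refl → contradiction a≤h (<-irrefl refl) })
      (_ , here refl , (λ { () }) , inj₁ (_ , refl))
    second-chain (_ ∷ es) (inj₁ gB′ ∷ gs) = ok (second-chain es gs) refl
      (λ { (here refl) ≢ → contradiction refl ≢
         ; (there (here refl)) _ → inj₂ (inj₂ (inj₂ (inj₁ refl))) , inj₂ (q∈ es) })
      (λ { refl → contradiction a≤h (<-irrefl refl) })
      (_ , there (here refl) , (λ { () }) , inj₁ (_ , refl))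
    second-chain (_ ∷ es) (inj₁ (gC _) ∷ gs) = irr (second-chain es gs) λ
      { (inj₁ (_ , () , _)) ; (inj₂ (inj₁ ())) ; (inj₂ (inj₂ (inj₁ (_ , () , _))))
      ; (inj₂ (inj₂ (inj₂ (inj₁ refl)))) → <-irrefl refl c<s ; (inj₂ (inj₂ (inj₂ (inj₂ (_ , () , _))))) }

    junk-irr : ∀ {e} → e ∈ junk → ¬ X (complement (lit e))
    junk-irr e∈ (inj₁ (i , eq , 1≤i , i≤h , i≢c)) =
      ∉-vars-fresh T uq e∈ eq (lits-++ˡ T₂ (lits-++ˡ T₁ (low P₁ 1≤i (s≤s i≤h) i≢c)))
    junk-irr e∈ (inj₂ (inj₁ eq)) = ∉-vars-fresh T uq e∈ eq (lits-++ˡ T₂ (lits-++ʳ T₁ (here refl)))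
    junk-irr e∈ (inj₂ (inj₂ (inj₁ (x , eq , nx)))) = ∉-vars-fresh T uq e∈ eq (lits-++ˡ T₂ (filled₁ nx))
    junk-irr e∈ (inj₂ (inj₂ (inj₂ (inj₁ eq)))) = ∉-vars-fresh T uq e∈ eq (lits-++ʳ T₂ (here refl))
    junk-irr e∈ (inj₂ (inj₂ (inj₂ (inj₂ (x , eq , nx))))) = ∉-vars-fresh T uq e∈ eq (filled nx)

    within : ∀ {l} → l ∈ cl → Within (reverse (rest₁ ++ q ∷ rest ++ junk)) l
    within l∈ with i , refl , 1≤i , i≤n , i≢n ← rows⇒ R l∈ =
      inj₂ (inj₂ (inj₂ (inj₂ (i , refl , nx)))) ,
      inj₂ (lits-++ˡ (reverse (rest₁ ++ q ∷ rest ++ junk)) (lits-reverse (rest₁ ++ q ∷ rest ++ junk)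
        (lits-++ʳ rest₁ (there (lits-++ˡ rest (neg-in-rest P (filled nx)))))))
      where
      nx : NegIn s n i
      nx = 1≤i , inj₁ (≤∧≢⇒< i≤n i≢n)

-- The phases of a search.

-- While a literal ¬P(x,s) that falsifies R(s,s) is pending, the longer row clauses of column s may
-- still propagate before the conflict is visited; junk entries are the ones this can create.
Junk : ℕ → ℕ → Entry → Set
Junk s x e = Propagated e × ((∃ λ y → lit e ≡ pos (y , s) × s < y) ⊎ (∃ λ y → lit e ≡ neg (x , y)))

-- Trails of the decision stage in which column j is falsified below row m. If b ≠ 0, P(j,b) is
-- true, and decisions ¬P(a,b) in column b force ¬P(a,j) by transitivity.
UpQ : (j b m : ℕ) → Lit → Set
UpQ j b m (pos (y , z)) = y ≡ j × z ≡ b × 1 ≤ b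
UpQ j b m (neg (y , z)) = (z ≡ b × 1 ≤ b × 1 ≤ y × y < m) ⊎ (z ≡ j × 1 ≤ y × y < m × y ≢ j)

-- The only entries that may be unprocessed; except for `none` they are also the last decision
-- level. `none` carries `m < r`, so at least one decision precedes the propagation of P(r,j).
data Tail (r j b m : ℕ) (t : Trail) : Trail → Set where
  none    : m < r → Tail r j b m t []
  direct  : ∀ {a} → 1 ≤ a → a < m → a ≢ j → Tail r j b m t (entry (neg (a , j)) nothing ∷ [])
  implied : ∀ {a cl} → 1 ≤ a → a < m → a ≢ j → pos (j , b) ∈ lits t →
            Tail r j b m t (entry (neg (a , b)) nothing ∷ entry (neg (a , j)) (just cl) ∷ [])

∷ʳ-∈⁻ : ∀ t e {l} → l ∈ lits (t ∷ʳ e) → l ∈ lits t ⊎ l ≡ lit e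
∷ʳ-∈⁻ t e l∈ with lits-++⁻ t l∈
... | inj₁ q = inj₁ q
... | inj₂ (here q) = inj₂ q

drop-2-cases : ∀ {X : Set} k {x y e : X} {es} → drop k (x ∷ y ∷ []) ≡ e ∷ es → e ≡ x ⊎ (e ≡ y × drop k (x ∷ y ∷ []) ≡ y ∷ [])
drop-2-cases zero refl = inj₁ refl
drop-2-cases (suc zero) refl = inj₂ (refl , refl)
drop-2-cases (suc (suc zero)) ()
drop-2-cases (suc (suc (suc k))) ()

drop-1-case : ∀ {X : Set} k {x e : X} {es} → drop k (x ∷ []) ≡ e ∷ es → e ≡ x × drop k (x ∷ []) ≡ x ∷ []
drop-1-case zero refl = refl , refl
drop-1-case (suc zero) ()
drop-1-case (suc (suc k)) ()

drop-length : ∀ {X : Set} (xs ys : List X) → drop (length xs) (xs ++ ys) ≡ ys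
drop-length [] ys = refl
drop-length (x ∷ xs) ys = drop-length xs ys

module Search (n : ℕ) (δ : ℚ) (ls : List Clause) {Row : ℕ → ℕ → Set} (dbase : Database n Row (DB n ls))
  (rowRange : ∀ {z s} → Row z s → 1 ≤ z × z ≤ n × z ≤ s × s ≤ n) (z₀ h₀ : ℕ)
  (scoreInv : ScoreInv (score δ ls)) where

  open Database dbase
  open PPhase dbase rowRange using (Filled; upT; p-clause; RowCase; fill; p∈; col-s-not-pos; row-x-pos)

  PSt : (s c b : ℕ) → Trail → Clause → List Entry → ℕ → Set
  PSt = PState n Row

  Lrn : Trail → Clause → Set
  Lrn = Learns dbase rowRange z₀ h₀

  Anl : (s c b : ℕ) → Trail → Clause → Set
  Anl = Analyzable dbase rowRange z₀ h₀

  -- What happens after P(r,j) has made all P(i,r) with i < r false: R(r,r) is known and falsified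
  -- (kconf), r = n − 1 and D(r) forces P(n,r) (kchain), or the search goes on in column r (kopen).
  mutual
    data Kind (r j b : ℕ) : Set where
      kconf  : Row r r → j < r → z₀ ≡ j → r ≡ suc h₀ → Kind r j b
      kchain : suc r ≡ n → b ≡ 0 → (∀ {s′} → Row r s′ → s′ ≡ n) → j < r → z₀ ≡ j → r ≡ suc h₀ →
               Row r n → Row n n → Kind r j b
      kopen  : b ≡ 0 → ∀ {r′ dc m₀} → OpenData r′ r j dc m₀ → Kind r j b

    record OpenData (r s c dc m₀ : ℕ) : Set where
      inductive
      field
        qc  : QC r s c dc
        m₀<r : m₀ < r
        s<m₀ : s < m₀
        c<m₀ : c < m₀
        below-m₀ : ∀ {x} → x < m₀ → x < s ⊎ x ≡ s ⊎ x ≡ c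

    -- R(j,r) is the shortest row clause of column `j`, and `dc` is the column of the decisions. By
    -- `minB` every row clause of column `b` contains P(j,b), hence is satisfied once that literal
    -- is true.
    record QC (r j b dc : ℕ) : Set where
      inductive
      field
        vrj   : Valid n r j
        b≢j   : b ≢ j
        b≢r   : b ≢ r
        rowJ  : ∃ λ cl → cl ∈ DB n ls × Rows cl j r
        minJ  : ∀ {s′} → Row j s′ → r ≤ s′
        minB  : ∀ {s′} → Row b s′ → j ≤ s′
        dcv   : dc ≡ j ⊎ (dc ≡ b × 1 ≤ b × b ≤ n)
        dom   : ∃ λ M → r ≤ suc M × Dominates (score δ ls) dc M
        kind  : Kind r j b
  open OpenData
  open QC

  -- `m` is the least row of column `j` that is not yet false; when it reaches `r`, the clause
  -- R(j,r) is unit.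
  record QState (r j b dc m : ℕ) (t : Trail) (k : ℕ) : Set where
    field
      {t′ tl} : Trail
      split  : t ≡ t′ ++ tl
      t′≤k   : length t′ ≤ k
      tail   : Tail r j b m t tl
      upQ    : ∀ {l} → l ∈ lits t → UpQ j b m l
      lowQ   : ∀ {x} → 1 ≤ x → x < m → x ≢ j → neg (x , j) ∈ lits t
      lowDc  : ∀ {x} → 1 ≤ x → x < m → x ≢ dc → (x , dc) ∈ vars t
      ambDc  : dc ≢ j → pos (j , b) ∈ lits t
      m≤r    : m ≤ r
      m≢j    : m ≢ j
      b<m    : b < m
      1≤m    : 1 ≤ m
  open QState

  -- R(s,s) is falsified and contains the complement of the pending literal, so `advance` is blocked
  -- until the conflict is taken. Junk can accumulate meanwhile, but no other clause becomes a
  -- conflict.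
  record Doomed (s c b : ℕ) (t₁ : Trail) (c₀ : Clause) (rest junk : List Entry) (k : ℕ) : Set where
    field
      {kp x}  : ℕ
      {e}     : Entry
      {es}    : List Entry
      P       : PSt s c b t₁ c₀ rest kp
      filled  : Filled P
      negIn   : NegIn c s x
      dk      : drop k (after t₁ s c c₀ rest ++ junk) ≡ e ∷ es
      lit-e   : lit e ≡ neg (x , s)
      junks   : All (Junk s x) junk
      rowSS   : Row s s
      c<s     : c < s
      analyzable : Anl s c b t₁ c₀

  -- A round stays in `deciding`, alternating with `decided` when decisions are copied from column
  -- `b`, until P(r,j) is propagated. `closing` leads back to `deciding` in another column,
  -- `chaining` to `conflicting`, and `conflicting`, perhaps through `doomed`, to the learned
  -- clause.
  data Phase : Trail → ℕ → Set where
    deciding   : ∀ {r j b dc m t k} → QC r j b dc → QState r j b dc m t k → Phase t k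
    decided  : ∀ {r j b dc m t k k₀} → QC r j b dc → m < r → dc ≢ j → QState r j b dc m t k₀ → length t ≡ k →
           Phase (t ∷ʳ entry (neg (m , b)) nothing) k
    conflicting : ∀ {s c b t₁ c₀ rest k} → PSt s c b t₁ c₀ rest k → Row s s → c < s → Anl s c b t₁ c₀ →
           Phase (after t₁ s c c₀ rest) k
    chaining : ∀ {s c t₁ c₀ rest k} → PSt s c 0 t₁ c₀ rest k → suc s ≡ n → (∀ {s′} → Row s s′ → s′ ≡ n) →
           c < s → z₀ ≡ c → s ≡ suc h₀ → Row s n → Row n n → LastLevel t₁ c h₀ → Phase (after t₁ s c c₀ rest) k
    closing : ∀ {s c t₁ c₀ rest k r dc m₀} → PSt s c 0 t₁ c₀ rest k → OpenData r s c dc m₀ →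
           Phase (after t₁ s c c₀ rest) k
    doomed : ∀ {s c b t₁ c₀ rest junk k} → Doomed s c b t₁ c₀ rest junk k →
           Phase (after t₁ s c c₀ rest ++ junk) k

  record Steps (t : Trail) (k : ℕ) : Set where
    field
      onUnit : ∀ {e es cl m} → drop k t ≡ e ∷ es → cl ∈ DB n ls → complement (lit e) ∈ cl → status t cl ≡ unit m →
               Phase (t ∷ʳ entry m (just cl)) k
      onConf : ∀ {e es cl} → drop k t ≡ e ∷ es → cl ∈ DB n ls → complement (lit e) ∈ cl → status t cl ≡ falsified →
               Lrn t cl
      onAdv  : ∀ {e es} → drop k t ≡ e ∷ es → (∀ cl → cl ∈ DB n ls → complement (lit e) ∈ cl → Quiet (status t cl)) →
               Phase t (suc k)
      onDec  : drop k t ≡ [] → (∀ cl → cl ∈ DB n ls → Quiet (status t cl)) →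
               ∃ λ x → pick n δ ls t ≡ just x × x ∈ variables n × x ∉ vars t × Phase (t ∷ʳ entry (neg x) nothing) k
  open Steps public

  after-∷ʳ : ∀ t₁ {s c c₀} rest e → after t₁ s c c₀ (rest ∷ʳ e) ≡ after t₁ s c c₀ rest ∷ʳ e
  after-∷ʳ t₁ rest e = sym (ListP.++-assoc t₁ (_ ∷ rest) (e ∷ []))

  p-extend : ∀ {s c b t₁ c₀ rest k e} → PSt s c b t₁ c₀ rest k → Good s c b e → PSt s c b t₁ c₀ (rest ∷ʳ e) k
  p-extend P g = record
    { vsc = vsc P ; b≢c = b≢c P ; b<s = b<s P ; b≢s = b≢s P ; c₀-rows = c₀-rows P ; up = up P ; low = low P
    ; goods = AllP.∷ʳ⁺ (goods P) g ; pend = pend P ; minC = minC P }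

  p-advance : ∀ {s c b t₁ c₀ rest k} → PSt s c b t₁ c₀ rest k → PSt s c b t₁ c₀ rest (suc k)
  p-advance {t₁ = t₁} {k = k} P = record
    { vsc = vsc P ; b≢c = b≢c P ; b<s = b<s P ; b≢s = b≢s P ; c₀-rows = c₀-rows P ; up = up P ; low = low P
    ; goods = goods P ; pend = pend P ∘ drop-suc-⊆ k t₁ ; minC = minC P }

  module _ {s c b t₁ c₀ rest junk k} (Dm : Doomed s c b t₁ c₀ rest junk k) where
    open Doomed Dm

    T₂ : Trail
    T₂ = after t₁ s c c₀ rest ++ junk

    junk-case : ∀ {l} → l ∈ lits T₂ → UpAfter s c b l ⊎ (∃ λ y → l ≡ pos (y , s) × s < y) ⊎ (∃ λ y → l ≡ neg (x , y))
    junk-case l∈ with lits-++⁻ (after t₁ s c c₀ rest) l∈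
    ... | inj₁ q = inj₁ (upT P q)
    ... | inj₂ q with e , e∈ , refl ← ∈-map⁻ lit q = inj₂ (proj₂ (All.lookup junks e∈))

    x∈ : neg (x , s) ∈ lits T₂
    x∈ = lits-++ˡ (after t₁ s c c₀ rest) (filled negIn)

    row-x : ∀ {y} → pos (x , y) ∈ lits T₂ → y ≢ s → x ≡ c × y ≡ b × 1 ≤ b
    row-x q y≢s with lits-++⁻ (after t₁ s c c₀ rest) q
    ... | inj₁ q′ = row-x-pos P negIn q′
    ... | inj₂ q′ with e , e∈ , eq ← ∈-map⁻ lit q′ with proj₂ (All.lookup junks e∈)
    ...   | inj₁ (y′ , eq′ , _) with refl ← trans eq eq′ = contradiction refl y≢s
    ...   | inj₂ (y′ , eq′) with () ← trans eq eq′

    x<s : x < s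
    x<s = below dbase rowRange z₀ h₀ c<s negIn

    doom-clause : ∀ {cl u} → Consistent T₂ → InDB n Row cl → pos (x , s) ∈ cl → AllFalseBut T₂ cl u →
      (∃ λ m → u ≡ just m × Junk s x (entry m (just cl))) ⊎ Rows cl s s
    doom-clause cs (vA ij jk ik) (there (there (here refl))) F with aCase ij F
    ... | first eq _ _ _ = inj₁ (_ , eq , (_ , refl) , inj₂ (_ , refl))
    ... | third _ _ x∉ _ _ = contradiction x∈ x∉
    ... | second q p _ with refl , refl , 1≤b ← row-x p (row≢col jk) with q
            | lits-++ˡ (after t₁ s c c₀ rest) {junk} (filled (1≤b , inj₁ (b<s P 1≤b)))
    ...   | inj₁ (_ , b∉) | b∈ = contradiction b∈ b∉
    ...   | inj₂ b∈′ | b∈ = contradiction b∈ (cs b∈′)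
    doom-clause cs (vB _) (here ()) F
    doom-clause cs (vB _) (there (here ())) F
    doom-clause cs (vR {s = s′} r R) x∈cl F with _ , refl , _ ← rows⇒ R x∈cl with s ≟ s′
    ... | yes refl = inj₂ R
    -- A longer row clause contains P(s+1,s), which is not false; if the clause reacts, this is its
    -- unit literal.
    ... | no s≢s′ with F (⇒rows R {suc s} (s≤s z≤n , ≤∧≢⇒< (proj₁ (proj₂ (proj₂ (rowRange r)))) s≢s′ , λ ()))
    ...   | inj₂ (eq , _) = inj₁ (_ , eq , (_ , refl) , inj₁ (_ , refl , n<1+n s))
    ...   | inj₁ q with junk-case q
    ...     | inj₂ (inj₂ (_ , refl)) = contradiction (<-trans x<s (n<1+n s)) (<-irrefl refl)
    ...     | inj₁ (inj₁ (s≡b , _)) = contradiction (sym s≡b) (b≢s P)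
    ...     | inj₁ (inj₂ (inj₁ (s≡c , _))) = contradiction s≡c (row≢col (vsc P))
    ...     | inj₁ (inj₂ (inj₂ (_ , ns))) =
                contradiction (<-trans (below dbase rowRange z₀ h₀ c<s ns) (n<1+n s)) (<-irrefl refl)

    ss-false : ∀ {cl l} → Rows cl s s → l ∈ cl → complement l ∈ lits T₂
    ss-false R l∈ with i , refl , 1≤i , i≤s , i≢s ← rows⇒ R l∈ =
      lits-++ˡ (after t₁ s c c₀ rest) (filled (1≤i , inj₁ (≤∧≢⇒< i≤s i≢s)))

    doom-pending : ∀ {e′ es′ cl} → drop k T₂ ≡ e′ ∷ es′ → complement (lit e′) ∈ cl → pos (x , s) ∈ cl
    doom-pending dk′ ē∈ with refl ← trans (sym dk) dk′ = subst (λ l → complement l ∈ _) lit-e ē∈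

    doom-steps : Sound n (DB n ls) T₂ k → Steps T₂ k
    doom-steps S = record
      { onUnit = λ dk′ cl∈ ē∈ st → unit-case st (doom-clause (cons S) (view cl∈) (doom-pending dk′ ē∈) (proj₁ (unit⇒allFalseBut T₂ _ st)))
      ; onConf = λ dk′ cl∈ ē∈ st → conf-case (doom-clause (cons S) (view cl∈) (doom-pending dk′ ē∈) (falsified⇒allFalseBut T₂ _ st))
      ; onAdv  = λ dk′ quiet → ⊥-elim (no-advance dk′ quiet)
      ; onDec  = λ dk′ _ → case trans (sym dk) dk′ of λ () }
      where
      unit-case : ∀ {cl m} → status T₂ cl ≡ unit m → (∃ λ m′ → just m ≡ just m′ × Junk s x (entry m′ (just cl))) ⊎ Rows cl s s →
        Phase (T₂ ∷ʳ entry m (just cl)) k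
      unit-case {cl} {m} st (inj₁ (_ , refl , jk)) =
        subst (λ t → Phase t k) (sym (ListP.++-assoc (after t₁ s c c₀ rest) junk _)) (doomed record
          { P = P ; filled = filled ; negIn = negIn
          ; dk = subst (λ t → drop k t ≡ e ∷ es ∷ʳ entry m (just cl)) (ListP.++-assoc (after t₁ s c c₀ rest) junk _) (drop-∷ʳ k T₂ dk)
          ; lit-e = lit-e ; junks = AllP.∷ʳ⁺ junks jk ; rowSS = rowSS ; c<s = c<s ; analyzable = analyzable })
      unit-case {cl} {m} st (inj₂ R) with _ , m∈ , _ , m̄∉ ← unit⇒allFalseBut T₂ cl st = contradiction (ss-false R m∈) m̄∉

      conf-case : ∀ {cl} → (∃ λ m → nothing ≡ just m × Junk s x (entry m (just cl))) ⊎ Rows cl s s → Lrn T₂ cl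
      conf-case (inj₂ R) = analyzable P filled (All.map proj₁ junks) (uniq S) R c<s

      no-advance : ∀ {e′ es′} → drop k T₂ ≡ e′ ∷ es′ →
        (∀ cl → cl ∈ DB n ls → complement (lit e′) ∈ cl → Quiet (status T₂ cl)) → ⊥
      no-advance dk′ quiet with refl ← trans (sym dk) dk′ with cl , cl∈ , R ← hasR rowSS =
        cons S (quiet-force (cons S) (quiet cl cl∈ (subst (λ l → complement l ∈ cl) (sym lit-e) x∈cl)) λ l∈ _ → ss-false R l∈) x∈
        where
        x∈cl : pos (x , s) ∈ _
        x∈cl = ⇒rows R (proj₁ negIn , <⇒≤ x<s , ℕP.<⇒≢ x<s)

  empty-passed : ∀ {k} (t₁ : Trail) {p rest} → drop k (t₁ ++ p ∷ rest) ≡ [] → length t₁ < k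
  empty-passed {k} t₁ {p} {rest} dk = ≤-trans
    (subst (suc (length t₁) ≤_) (sym (trans (ListP.length-++ t₁) (ℕP.+-suc (length t₁) (length rest)))) (s≤s (ℕP.m≤m+n _ _)))
    (drop-[]⇒≤ k (t₁ ++ p ∷ rest) dk)

  drop-passed : ∀ {k} (t₁ : Trail) {p rest e} → length t₁ < k → e ∈ drop k (t₁ ++ p ∷ rest) → e ∈ rest
  drop-passed {suc k} [] {rest = rest} lt e∈ = drop-⊆ k rest e∈
  drop-passed {suc k} (x ∷ t₁) (s≤s lt) e∈ = drop-passed t₁ lt e∈

  just-injective : ∀ {l l′ : Lit} {u : Maybe Lit} → u ≡ just l → u ≡ just l′ → l ≡ l′
  just-injective refl refl = refl

  conflicting-steps : ∀ {s c b t₁ c₀ rest k} → PSt s c b t₁ c₀ rest k → Row s s → c < s → Anl s c b t₁ c₀ →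
    Sound n (DB n ls) (after t₁ s c c₀ rest) k → Steps (after t₁ s c c₀ rest) k
  conflicting-steps {s} {c} {b} {t₁} {c₀} {rest} {k} P rowSS c<s an S = record
    { onUnit = λ dk cl∈ ē∈ st → unit-case dk cl∈ ē∈ st (p-clause P S dk cl∈ ē∈ (proj₁ (unit⇒allFalseBut T₂′ _ st)))
    ; onConf = λ dk cl∈ ē∈ st → conf-case dk cl∈ ē∈ st (p-clause P S dk cl∈ ē∈ (falsified⇒allFalseBut T₂′ _ st))
    ; onAdv  = λ _ _ → conflicting (p-advance P) rowSS c<s an
    ; onDec  = λ dk quiet → ⊥-elim (no-decide dk quiet) }
    where
    T₂′ = after t₁ s c c₀ rest
    id-++ = ListP.++-identityʳ T₂′

    doom-now : ∀ {e es cl} → drop k T₂′ ≡ e ∷ es → RowCase P e cl → Steps T₂′ k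
    doom-now {e} {es} dk rc = subst (λ t → Steps t k) id-++ (doom-steps
      (record { P = P ; filled = RowCase.filled rc ; negIn = RowCase.negIn rc
              ; dk = subst (λ t → drop k t ≡ e ∷ es) (sym id-++) dk ; lit-e = RowCase.lit-e rc
              ; junks = [] ; rowSS = rowSS ; c<s = c<s ; analyzable = an })
      (subst (λ t → Sound n (DB n ls) t k) (sym id-++) S))

    unit-case : ∀ {e es cl m} → drop k T₂′ ≡ e ∷ es → cl ∈ DB n ls → complement (lit e) ∈ cl → status T₂′ cl ≡ unit m →
      (∃ λ m′ → just m ≡ just m′ × Good s c b (entry m′ (just cl))) ⊎ RowCase P e cl → Phase (T₂′ ∷ʳ entry m (just cl)) k
    unit-case dk cl∈ ē∈ st (inj₁ (_ , refl , g)) =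
      subst (λ t → Phase t k) (after-∷ʳ t₁ rest _) (conflicting (p-extend P g) rowSS c<s an)
    unit-case dk cl∈ ē∈ st (inj₂ rc) = onUnit (doom-now dk rc) dk cl∈ ē∈ st

    conf-case : ∀ {e es cl} → drop k T₂′ ≡ e ∷ es → cl ∈ DB n ls → complement (lit e) ∈ cl → status T₂′ cl ≡ falsified →
      (∃ λ m′ → nothing ≡ just m′ × Good s c b (entry m′ (just cl))) ⊎ RowCase P e cl → Lrn T₂′ cl
    conf-case dk cl∈ ē∈ st (inj₂ rc) = onConf (doom-now dk rc) dk cl∈ ē∈ st

    no-decide : drop k T₂′ ≡ [] → (∀ cl → cl ∈ DB n ls → Quiet (status T₂′ cl)) → ⊥
    no-decide dk quiet with cl , cl∈ , R ← hasR rowSS = col-s-not-pos P {c}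
      (quiet-force (cons S) (quiet cl cl∈) λ l∈ _ → all-false R l∈)
      where
      all-false : ∀ {cl l} → Rows cl s s → l ∈ cl → complement l ∈ lits T₂′
      all-false R l∈ with i , refl , 1≤i , i≤s , i≢s ← rows⇒ R l∈ =
        fill P S (empty-passed t₁ dk) (1≤i , inj₁ (≤∧≢⇒< i≤s i≢s))

  chaining-steps : ∀ {s c t₁ c₀ rest k} → PSt s c 0 t₁ c₀ rest k → suc s ≡ n → (∀ {s′} → Row s s′ → s′ ≡ n) →
    c < s → z₀ ≡ c → s ≡ suc h₀ → Row s n → Row n n → LastLevel t₁ c h₀ →
    Sound n (DB n ls) (after t₁ s c c₀ rest) k → Steps (after t₁ s c c₀ rest) k
  chaining-steps {s} {c} {t₁} {c₀} {rest} {k} P refl only-n c<s refl refl rowSn rowNN L S = record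
    { onUnit = λ dk cl∈ ē∈ st → unit-case (proj₁ (unit⇒allFalseBut T₂′ _ st)) (p-clause P S dk cl∈ ē∈ (proj₁ (unit⇒allFalseBut T₂′ _ st)))
    ; onConf = λ dk cl∈ ē∈ st → conf-case (falsified⇒allFalseBut T₂′ _ st) (p-clause P S dk cl∈ ē∈ (falsified⇒allFalseBut T₂′ _ st))
    ; onAdv  = λ _ _ → chaining (p-advance P) refl only-n c<s refl refl rowSn rowNN L
    ; onDec  = λ dk quiet → ⊥-elim (no-decide dk quiet) }
    where
    T₂′ = after t₁ s c c₀ rest
    c<n = <-trans c<s (n<1+n s)

    n-not-neg : neg (n , s) ∉ lits T₂′
    n-not-neg n∈ with upT P n∈
    ... | inj₁ (_ , () , _)
    ... | inj₂ (inj₁ (s≡c , _)) = row≢col (vsc P) s≡c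
    ... | inj₂ (inj₂ (_ , ns)) = <-irrefl refl (<-trans (below dbase rowRange z₀ h₀ c<s ns) (n<1+n s))

    nRow : InRow s n n
    nRow = s≤s z≤n , ≤-refl , λ ()

    up′ : ∀ {l} → UpAfter s c 0 l → UpBefore n s c l
    up′ {pos _} (inj₂ (inj₁ (refl , refl))) = refl , refl , 1≤col (vsc P)
    up′ {neg _} (inj₂ (inj₁ (refl , 1≤y , y<s , _))) = inj₁ (refl , 1≤col (vsc P) , 1≤y , <-trans y<s (n<1+n s))
    up′ {neg _} (inj₂ (inj₂ (refl , ns))) =
      inj₂ (refl , proj₁ ns , <-trans (below dbase rowRange z₀ h₀ c<s ns) (n<1+n s) , ℕP.<⇒≢ (below dbase rowRange z₀ h₀ c<s ns))

    negCol : ∀ {e} → Good s c 0 e → NegCol s n e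
    negCol (gA 1≤x x<s _) = _ , refl , 1≤x , <-trans x<s (n<1+n s) , ℕP.<⇒≢ x<s
    negCol gB = _ , refl , 1≤col (vsc P) , c<n , ℕP.<⇒≢ c<s
    negCol gB′ = _ , refl , 1≤col (vsc P) , c<n , ℕP.<⇒≢ c<s

    unit-case : ∀ {e cl m} → AllFalseBut T₂′ cl (just m) →
      (∃ λ m′ → just m ≡ just m′ × Good s c 0 (entry m′ (just cl))) ⊎ RowCase P e cl → Phase (T₂′ ∷ʳ entry m (just cl)) k
    unit-case F (inj₁ (_ , refl , g)) =
      subst (λ t → Phase t k) (after-∷ʳ t₁ rest _) (chaining (p-extend P g) refl only-n c<s refl refl rowSn rowNN L)
    unit-case {cl = cl} F (inj₂ rc) with refl ← only-n (RowCase.row rc) with F (⇒rows (RowCase.isRows rc) nRow)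
    ... | inj₁ n∈ = contradiction n∈ n-not-neg
    -- P(n,s) opens the second stage: `n`, `s`, `c` take the places of `s`, `c`, `b`, and the clause
    -- to be falsified is D(n).
    ... | inj₂ (refl , _) = conflicting {s = n} {s} {c} {T₂′} {cl} {[]} record
      { vsc = valid (s≤s z≤n) ≤-refl (1≤row (vsc P)) (n≤1+n s) (λ ()) ; b≢c = ℕP.<⇒≢ c<s ; b<s = λ _ → c<n
      ; b≢s = ℕP.<⇒≢ c<n ; c₀-rows = RowCase.isRows rc ; up = λ {l} l∈ → up′ {l} (upT P l∈)
      ; low = λ 1≤x x<n x≢s → RowCase.filled rc (1≤x , inj₁ (≤∧≢⇒< (≤-pred x<n) x≢s))
      ; goods = [] ; pend = λ e∈ → negCol (All.lookup (goods P) (drop-passed t₁ (RowCase.passed rc) e∈))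
      ; minC = λ r → subst (n ≤_) (sym (only-n r)) ≤-refl }
      rowNN (n<1+n s) (chain-analyzable dbase rowRange z₀ h₀ refl refl c<s L P (RowCase.filled rc) (RowCase.isRows rc))

    conf-case : ∀ {e cl} → AllFalseBut T₂′ cl nothing →
      (∃ λ m′ → nothing ≡ just m′ × Good s c 0 (entry m′ (just cl))) ⊎ RowCase P e cl → Lrn T₂′ cl
    conf-case F (inj₂ rc) with refl ← only-n (RowCase.row rc) with F (⇒rows (RowCase.isRows rc) nRow)
    ... | inj₁ n∈ = contradiction n∈ n-not-neg

    no-decide : drop k T₂′ ≡ [] → (∀ cl → cl ∈ DB n ls → Quiet (status T₂′ cl)) → ⊥
    no-decide dk quiet with cl , cl∈ , R ← hasR rowSn = col-s-not-pos P
      (quiet-force (cons S) (quiet cl cl∈) λ l∈ l≢ → others R l∈ l≢)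
      where
      others : ∀ {cl l} → Rows cl s n → l ∈ cl → l ≢ pos (n , s) → complement l ∈ lits T₂′
      others R l∈ l≢ with i , refl , 1≤i , i≤n , i≢s ← rows⇒ R l∈ =
        fill P S (empty-passed t₁ dk) (1≤i , inj₁ (≤∧≢⇒< (≤-pred (≤∧≢⇒< i≤n λ { refl → l≢ refl })) i≢s))

  next-row : ∀ {m j r} → m < r → r ≢ j →
    ∃ λ m′ → m < m′ × m′ ≤ r × m′ ≢ j × (∀ {x} → x < m′ → x < m ⊎ x ≡ m ⊎ x ≡ j)
  next-row {m} {j} {r} m<r r≢j with suc m ≟ j
  ... | no ≢j = suc m , n<1+n m , m<r , ≢j , below-suc
    where
    below-suc : ∀ {x} → x < suc m → x < m ⊎ x ≡ m ⊎ x ≡ j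
    below-suc {x} (s≤s x≤m) with x ≟ m
    ... | yes x≡m = inj₂ (inj₁ x≡m)
    ... | no x≢m = inj₁ (≤∧≢⇒< x≤m x≢m)
  ... | yes refl = suc (suc m) , <-trans (n<1+n m) (n<1+n (suc m)) , ≤∧≢⇒< m<r (r≢j ∘ sym) , (λ ()) , below-suc
    where
    below-suc : ∀ {x} → x < suc (suc m) → x < m ⊎ x ≡ m ⊎ x ≡ suc m
    below-suc {x} (s≤s x≤sm) with x ≟ suc m | x ≟ m
    ... | yes x≡sm | _ = inj₂ (inj₂ x≡sm)
    ... | no _ | yes x≡m = inj₂ (inj₁ x≡m)
    ... | no x≢sm | no x≢m = inj₁ (≤∧≢⇒< (≤-pred (≤∧≢⇒< x≤sm x≢sm)) x≢m)

  upQ-weaken : ∀ {j b m m′ l} → m < m′ → UpQ j b m l → UpQ j b m′ l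
  upQ-weaken {l = pos _} _ u = u
  upQ-weaken {l = neg _} m<m′ (inj₁ (e , f , g , lt)) = inj₁ (e , f , g , <-trans lt m<m′)
  upQ-weaken {l = neg _} m<m′ (inj₂ (e , f , lt , g)) = inj₂ (e , f , <-trans lt m<m′ , g)

  last-level : ∀ {r j b dc m t k} → QC r j b dc → QState r j b dc m t k → m ≡ r → r ≡ suc h₀ → LastLevel t j h₀
  last-level qc st refl refl with split st | tail st
  ... | refl | none m<m = contradiction m<m (<-irrefl refl)
  ... | refl | direct 1≤a a<m a≢j = record
    { split = refl ; dec = refl ; props = [] ; a-row = 1≤a , ≤-pred a<m , a≢j ; a-here = here refl
    ; a-only = λ { (here refl) → refl } }
  ... | refl | implied 1≤a a<m a≢j _ = record
    { split = refl ; dec = refl ; props = (_ , refl) ∷ [] ; a-row = 1≤a , ≤-pred a<m , a≢j ; a-here = there (here refl)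
    ; a-only = λ { (here refl) → contradiction refl (b≢j qc) ; (there (here refl)) → refl } }

  module _ {r j b dc m t k} (qc : QC r j b dc) (st : QState r j b dc m t k) (S : Sound n (DB n ls) t k) where

    1≤r : 1 ≤ r
    1≤r = 1≤row (vrj qc)

    m-not-neg : ∀ {y z} → m ≤ y → neg (y , z) ∉ lits t
    m-not-neg m≤y y∈ with upQ st y∈
    ... | inj₁ (_ , _ , _ , y<m) = <-irrefl refl (≤-trans y<m m≤y)
    ... | inj₂ (_ , _ , y<m , _) = <-irrefl refl (≤-trans y<m m≤y)

    -- Every row clause of column `j` contains P(m,j) and P(r,j), neither of them false, so one that
    -- reacts has `m = r`. A row beyond `m` would be a further non-false literal, which leaves
    -- R(j,r).
    pending-neg-j : ∀ {a cl u} → 1 ≤ a → a < m → a ≢ j → InDB n Row cl → pos (a , j) ∈ cl →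
      neg (a , j) ∈ lits t → AllFalseBut t cl u → m ≡ r × u ≡ just (pos (r , j)) × Rows cl j r
    pending-neg-j 1≤a a<m a≢j (vA ij jk ik) (there (there (here refl))) a∈ F with aCase ij F
    ... | third _ _ x∉ _ _ = contradiction a∈ x∉
    ... | second _ p _ = contradiction (proj₁ (upQ st p)) a≢j
    ... | first _ _ p _ = contradiction (sym (proj₁ (proj₂ (upQ st p)))) (b≢j qc)
    pending-neg-j _ _ _ (vB _) (here ()) a∈ F
    pending-neg-j _ _ _ (vB _) (there (here ())) a∈ F
    pending-neg-j {cl = cl} {u} _ _ _ (vR {s = s′} ρ R) x∈ a∈ F with _ , refl , _ ← rows⇒ R x∈
      with F (⇒rows R (1≤r , minJ qc ρ , row≢col (vrj qc))) | F (⇒rows R (1≤m st , ≤-trans (m≤r st) (minJ qc ρ) , m≢j st))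
    ... | inj₁ q | _ = contradiction q (m-not-neg (m≤r st))
    ... | _ | inj₁ q = contradiction q (m-not-neg ≤-refl)
    ... | inj₂ (eq , _) | inj₂ (eq′ , _) with refl ← just-injective eq eq′ = refl , eq , rows to from
      where
      to : ∀ {l} → l ∈ cl → ∃ λ i → l ≡ pos (i , j) × InRow j m i
      to l∈ with i , refl , 1≤i , _ , i≢j ← rows⇒ R l∈ with i ≤? m
      ... | yes i≤m = i , refl , 1≤i , i≤m , i≢j
      ... | no i≰m with F l∈
      ...   | inj₁ q = contradiction q (m-not-neg (<⇒≤ (≰⇒> i≰m)))
      ...   | inj₂ (eq″ , _) with refl ← just-injective eq eq″ = contradiction ≤-refl i≰m
      from : ∀ {i} → InRow j m i → pos (i , j) ∈ cl
      from (1≤i , i≤m , i≢j) = ⇒rows R (1≤i , ≤-trans i≤m (minJ qc ρ) , i≢j)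

    -- The one clause that could react is `A a j b`, and its consequence ¬P(a,j) is already on the
    -- trail.
    pending-neg-b : ∀ {a cl u} → a ≢ j → InDB n Row cl → pos (a , b) ∈ cl → neg (a , b) ∈ lits t →
      neg (a , j) ∈ lits t → pos (j , b) ∈ lits t → ¬ AllFalseBut t cl u
    pending-neg-b a≢j (vA ij jk ik) (there (there (here refl))) ab∈ aj∈ jb∈ F with aCase ij F
    ... | third _ _ x∉ _ _ = contradiction ab∈ x∉
    ... | second _ p _ = contradiction (proj₁ (upQ st p)) a≢j
    ... | first _ x∉ p _ with refl ← proj₁ (upQ st p) = contradiction aj∈ x∉
    pending-neg-b a≢j (vB _) (here ()) ab∈ aj∈ jb∈ F
    pending-neg-b a≢j (vB _) (there (here ())) ab∈ aj∈ jb∈ F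
    pending-neg-b a≢j (vR ρ R) x∈ ab∈ aj∈ jb∈ F with _ , refl , _ ← rows⇒ R x∈
      with F (⇒rows R (1≤col (vrj qc) , minB qc ρ , b≢j qc ∘ sym))
    ... | inj₁ q = cons S jb∈ q
    ... | inj₂ (_ , q , _) = q jb∈

    pending-clause : ∀ {e es cl u} → drop k t ≡ e ∷ es → cl ∈ DB n ls → complement (lit e) ∈ cl → AllFalseBut t cl u →
      m ≡ r × u ≡ just (pos (r , j)) × Rows cl j r × (∀ {e} → e ∈ drop k t → NegCol j m e)
    pending-clause {e} {es} {cl} {u} dk cl∈ ē∈ F =
      go (split st) (tail st) (trans (sym (trans (cong (drop k) (split st)) (drop-++-≥ k (t′ st) (tl st) (t′≤k st)))) dk)
      where
      go : ∀ {tl′} → t ≡ t′ st ++ tl′ → Tail r j b m t tl′ → drop (k ∸ length (t′ st)) tl′ ≡ e ∷ es →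
        m ≡ r × u ≡ just (pos (r , j)) × Rows cl j r × (∀ {e} → e ∈ drop k t → NegCol j m e)
      go eq (none _) dk′ with () ← trans (sym (ListP.drop-[] (k ∸ length (t′ st)))) dk′
      go eq (direct {a} 1≤a a<m a≢j) dk′ with refl , dk″ ← drop-1-case (k ∸ length (t′ st)) dk′
        with m≡r , u≡ , R ← pending-neg-j 1≤a a<m a≢j (view cl∈) ē∈
               (subst (λ t → neg (a , j) ∈ lits t) (sym eq) (lits-++ʳ (t′ st) (here refl))) F =
        m≡r , u≡ , R , λ e∈ → case subst (_ ∈_) (trans dk (trans (sym dk′) dk″)) e∈ of λ
          { (here refl) → a , refl , 1≤a , a<m , a≢j }
      go eq (implied {a} 1≤a a<m a≢j jb∈) dk′ with drop-2-cases (k ∸ length (t′ st)) dk′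
      ... | inj₁ refl = ⊥-elim (pending-neg-b a≢j (view cl∈) ē∈
              (subst (λ t → neg (a , b) ∈ lits t) (sym eq) (lits-++ʳ (t′ st) (here refl)))
              (subst (λ t → neg (a , j) ∈ lits t) (sym eq) (lits-++ʳ (t′ st) (there (here refl)))) jb∈ F)
      ... | inj₂ (refl , dk″)
        with m≡r , u≡ , R ← pending-neg-j 1≤a a<m a≢j (view cl∈) ē∈
               (subst (λ t → neg (a , j) ∈ lits t) (sym eq) (lits-++ʳ (t′ st) (there (here refl)))) F =
        m≡r , u≡ , R , λ e∈ → case subst (_ ∈_) (trans dk (trans (sym dk′) dk″)) e∈ of λ
          { (here refl) → a , refl , 1≤a , a<m , a≢j }

    found : ∀ {cl} → m ≡ r → Rows cl j r → (∀ {e} → e ∈ drop k t → NegCol j m e) →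
      Phase (t ∷ʳ entry (pos (r , j)) (just cl)) k
    found {cl} refl R pd = by-kind (kind qc)
      where
      upB : ∀ {l} → UpQ j b r l → UpBefore r j b l
      upB {pos _} u = u
      upB {neg _} u = u
      P : PSt r j b t cl [] k
      P = record
        { vsc = vrj qc ; b≢c = b≢j qc ; b<s = λ _ → b<m st ; b≢s = b≢r qc ; c₀-rows = R
        ; up = λ {l} l∈ → upB {l} (upQ st l∈) ; low = lowQ st ; goods = [] ; pend = pd ; minC = minJ qc }
      by-kind : Kind r j b → Phase (t ∷ʳ entry (pos (r , j)) (just cl)) k
      by-kind (kconf row j<r z₀≡ refl) = conflicting P row j<r (conf-analyzable dbase rowRange z₀ h₀ z₀≡ (last-level qc st refl refl))
      by-kind (kchain sr refl only-n j<r z₀≡ r≡ rowRn rowNN) =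
        chaining P sr only-n j<r z₀≡ r≡ rowRn rowNN (last-level qc st refl r≡)
      by-kind (kopen refl od) = closing P od

    deciding-advance : QState r j b dc m t (suc k)
    deciding-advance = record
      { split = split st ; t′≤k = ≤-trans (t′≤k st) (n≤1+n k) ; tail = tail st ; upQ = upQ st ; lowQ = lowQ st
      ; lowDc = lowDc st ; ambDc = ambDc st ; m≤r = m≤r st ; m≢j = m≢j st ; b<m = b<m st ; 1≤m = 1≤m st }

    decide-step : drop k t ≡ [] → (∀ cl → cl ∈ DB n ls → Quiet (status t cl)) →
      ∃ λ x → pick n δ ls t ≡ just x × x ∈ variables n × x ∉ vars t × Phase (t ∷ʳ entry (neg x) nothing) k
    decide-step dk quiet with m ≟ r
    -- With all rows below `r` false, quietness of R(j,r) would put P(r,j) on the trail, which `upQ`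
    -- excludes.
    ... | yes refl with cl , cl∈ , R ← rowJ qc =
      contradiction (sym (proj₁ (upQ st (quiet-force (cons S) (quiet cl cl∈) λ l∈ l≢ → others R l∈ l≢)))) (row≢col (vrj qc) ∘ sym)
      where
      others : ∀ {cl l} → Rows cl j m → l ∈ cl → l ≢ pos (m , j) → complement l ∈ lits t
      others R l∈ l≢ with i , refl , 1≤i , i≤m , i≢j ← rows⇒ R l∈ =
        lowQ st 1≤i (≤∧≢⇒< i≤m λ { refl → l≢ refl }) i≢j
    ... | no m≢r = (m , dc) , pick-first n δ ls t scoreInv (proj₂ (proj₂ (dom qc))) (≤-pred (≤-trans m<r (proj₁ (proj₂ (dom qc))))) vm fresh (lowDc st)
                 , ∈-variables⁺ vm , fresh , next (dcv qc)
      where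
      m<r : m < r
      m<r = ≤∧≢⇒< (m≤r st) m≢r
      vm : Valid n m dc
      vm with dcv qc
      ... | inj₁ refl = valid (1≤m st) (≤-trans (m≤r st) (row≤n (vrj qc))) (1≤col (vrj qc)) (col≤n (vrj qc)) (m≢j st)
      ... | inj₂ (refl , 1≤b , b≤n) = valid (1≤m st) (≤-trans (m≤r st) (row≤n (vrj qc))) 1≤b b≤n λ { refl → <-irrefl refl (b<m st) }
      fresh : (m , dc) ∉ vars t
      fresh = unassigned t (λ p → m≢j st (proj₁ (upQ st p))) (m-not-neg ≤-refl)

      next : dc ≡ j ⊎ (dc ≡ b × 1 ≤ b × b ≤ n) → Phase (t ∷ʳ entry (neg (m , dc)) nothing) k
      next (inj₂ (refl , _)) = decided qc m<r (b≢j qc) st (≤-antisym (drop-[]⇒≤ k t dk) (k≤ S))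
      next (inj₁ refl) with m′ , m<m′ , m′≤r , m′≢j , bel ← next-row m<r (row≢col (vrj qc)) = deciding qc record
        { split = refl ; t′≤k = drop-[]⇒≤ k t dk ; tail = direct (1≤m st) m<m′ (m≢j st)
        ; upQ = up′ ; lowQ = low′ ; lowDc = λ a b c → lits⇒vars (t ∷ʳ e) (low′ a b c) ; ambDc = contradiction refl
        ; m≤r = m′≤r ; m≢j = m′≢j ; b<m = <-trans (b<m st) m<m′ ; 1≤m = ≤-trans (1≤m st) (<⇒≤ m<m′) }
        where
        e = entry (neg (m , j)) nothing
        up′ : ∀ {l} → l ∈ lits (t ∷ʳ e) → UpQ j b m′ l
        up′ {l} l∈ with ∷ʳ-∈⁻ t e l∈
        ... | inj₁ l∈t = upQ-weaken {l = l} m<m′ (upQ st l∈t)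
        ... | inj₂ refl = inj₂ (refl , 1≤m st , m<m′ , m≢j st)
        low′ : ∀ {x} → 1 ≤ x → x < m′ → x ≢ j → neg (x , j) ∈ lits (t ∷ʳ e)
        low′ 1≤x x<m′ x≢j with bel x<m′
        ... | inj₁ x<m = lits-++ˡ t (lowQ st 1≤x x<m x≢j)
        ... | inj₂ (inj₁ refl) = lits-++ʳ t (here refl)
        ... | inj₂ (inj₂ x≡j) = contradiction x≡j x≢j

    deciding-steps : Steps t k
    deciding-steps = record
      { onUnit = λ dk cl∈ ē∈ eq → unit-case (pending-clause dk cl∈ ē∈ (proj₁ (unit⇒allFalseBut t _ eq)))
      ; onConf = λ dk cl∈ ē∈ eq → case proj₁ (proj₂ (pending-clause dk cl∈ ē∈ (falsified⇒allFalseBut t _ eq))) of λ ()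
      ; onAdv  = λ _ _ → deciding qc deciding-advance
      ; onDec  = decide-step }
      where
      unit-case : ∀ {cl u} → m ≡ r × just u ≡ just (pos (r , j)) × Rows cl j r × (∀ {e} → e ∈ drop k t → NegCol j m e) →
        Phase (t ∷ʳ entry u (just cl)) k
      unit-case (m≡r , refl , R , pd) = found m≡r R pd

  -- The decision ¬P(m,b) is the only pending literal and makes only `A m j b` unit. As this clause
  -- is not quiet, ¬P(m,j) is propagated next, which keeps column `j` in step with column `b`.
  decided-steps : ∀ {r j b dc m t k k₀} (qc : QC r j b dc) → m < r → dc ≢ j → QState r j b dc m t k₀ → length t ≡ k →
    Sound n (DB n ls) (t ∷ʳ entry (neg (m , b)) nothing) k → Steps (t ∷ʳ entry (neg (m , b)) nothing) k
  decided-steps {r} {j} {b} {dc} {m} {t} qc m<r dc≢j st refl S = record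
    { onUnit = λ dk cl∈ ē∈ eq → unit-case (view cl∈) (at-d dk ē∈) (proj₁ (unit⇒allFalseBut T₁ _ eq))
    ; onConf = λ dk cl∈ ē∈ eq → ⊥-elim (conf-case (clause-case (view cl∈) (at-d dk ē∈) (falsified⇒allFalseBut T₁ _ eq)))
    ; onAdv  = λ dk quiet → ⊥-elim (no-advance λ cl cl∈ ē∈ → quiet cl cl∈ (back dk ē∈))
    ; onDec  = λ dk _ → case trans (sym (drop-length t (d ∷ []))) dk of λ () }
    where
    d = entry (neg (m , b)) nothing
    T₁ = t ∷ʳ d

    d∈ : neg (m , b) ∈ lits T₁
    d∈ = lits-++ʳ t (here refl)

    dc-b : dc ≡ b × 1 ≤ b × b ≤ n
    dc-b = [ (λ dc≡j → contradiction dc≡j dc≢j) , id ]′ (dcv qc)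

    jb∈ : pos (j , b) ∈ lits t
    jb∈ = ambDc st dc≢j

    at-d : ∀ {e es cl} → drop (length t) T₁ ≡ e ∷ es → complement (lit e) ∈ cl → pos (m , b) ∈ cl
    at-d dk ē∈ with refl ← trans (sym (drop-length t (d ∷ []))) dk = ē∈

    back : ∀ {e es cl} → drop (length t) T₁ ≡ e ∷ es → pos (m , b) ∈ cl → complement (lit e) ∈ cl
    back dk ē∈ with refl ← trans (sym (drop-length t (d ∷ []))) dk = ē∈

    posQ : ∀ {y z} → pos (y , z) ∈ lits T₁ → y ≡ j × z ≡ b × 1 ≤ b
    posQ p with ∷ʳ-∈⁻ t d p
    ... | inj₁ p′ = upQ st p′

    clause-case : ∀ {cl u} → InDB n Row cl → pos (m , b) ∈ cl → AllFalseBut T₁ cl u →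
      u ≡ just (neg (m , j)) × cl ≡ A m j b
    clause-case (vA ij jk ik) (there (there (here refl))) F with aCase ij F
    ... | third _ _ x∉ _ _ = contradiction d∈ x∉
    ... | second _ p _ = contradiction (proj₁ (posQ p)) (m≢j st)
    ... | first eq _ p _ with refl ← proj₁ (posQ p) = eq , refl
    clause-case (vB _) (here ()) F
    clause-case (vB _) (there (here ())) F
    clause-case (vR ρ R) x∈ F with _ , refl , _ ← rows⇒ R x∈
      with F (⇒rows R (1≤col (vrj qc) , minB qc ρ , b≢j qc ∘ sym))
    ... | inj₁ q = ⊥-elim (cons S (lits-++ˡ t jb∈) q)
    ... | inj₂ (_ , q , _) = contradiction (lits-++ˡ t jb∈) q

    conf-case : ∀ {cl} → ¬ (nothing ≡ just (neg (m , j)) × cl ≡ A m j b)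
    conf-case (() , _)

    vmj : Valid n m j
    vmj = valid (1≤m st) (≤-trans (m≤r st) (row≤n (vrj qc))) (1≤col (vrj qc)) (col≤n (vrj qc)) (m≢j st)

    vjb : Valid n j b
    vjb = valid (1≤col (vrj qc)) (col≤n (vrj qc)) (proj₁ (proj₂ dc-b)) (proj₂ (proj₂ dc-b)) (b≢j qc ∘ sym)

    vmb : Valid n m b
    vmb = valid (1≤row vmj) (row≤n vmj) (1≤col vjb) (col≤n vjb) λ { refl → <-irrefl refl (b<m st) }

    no-advance : (∀ cl → cl ∈ DB n ls → pos (m , b) ∈ cl → Quiet (status T₁ cl)) → ⊥
    no-advance quiet with ∷ʳ-∈⁻ t d (quiet-force {c = A m j b} {m = neg (m , j)} (cons S) (quiet _ (hasA vmj vjb vmb) (there (there (here refl)))) λ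
      { (here refl) ≢ → contradiction refl ≢ ; (there (here refl)) _ → lits-++ˡ t jb∈ ; (there (there (here refl))) _ → d∈ })
    ... | inj₂ refl = b≢j qc refl
    ... | inj₁ q with upQ st q
    ...   | inj₁ (j≡b , _) = b≢j qc (sym j≡b)
    ...   | inj₂ (_ , _ , m<m , _) = <-irrefl refl m<m

    unit-case : ∀ {cl u} → InDB n Row cl → pos (m , b) ∈ cl → AllFalseBut T₁ cl (just u) → Phase (T₁ ∷ʳ entry u (just cl)) (length t)
    unit-case v x∈ F with refl , refl ← clause-case v x∈ F
      with m′ , m<m′ , m′≤r , m′≢j , bel ← next-row m<r (row≢col (vrj qc)) = deciding qc record
        { split = ListP.++-assoc t (d ∷ []) (e ∷ []) ; t′≤k = ≤-refl
        ; tail = implied (1≤m st) m<m′ (m≢j st) (lits-++ˡ T₁ (lits-++ˡ t jb∈))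
        ; upQ = up′ ; lowQ = low′ ; lowDc = lowDc′ ; ambDc = λ _ → lits-++ˡ T₁ (lits-++ˡ t jb∈)
        ; m≤r = m′≤r ; m≢j = m′≢j ; b<m = <-trans (b<m st) m<m′ ; 1≤m = ≤-trans (1≤m st) (<⇒≤ m<m′) }
      where
      e = entry (neg (m , j)) (just (A m j b))
      up′ : ∀ {l} → l ∈ lits (T₁ ∷ʳ e) → UpQ j b m′ l
      up′ {l} l∈ with ∷ʳ-∈⁻ T₁ e l∈
      ... | inj₂ refl = inj₂ (refl , 1≤m st , m<m′ , m≢j st)
      ... | inj₁ l∈T with ∷ʳ-∈⁻ t d l∈T
      ...   | inj₁ l∈t = upQ-weaken {l = l} m<m′ (upQ st l∈t)
      ...   | inj₂ refl = inj₁ (refl , proj₁ (proj₂ dc-b) , 1≤m st , m<m′)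
      low′ : ∀ {x} → 1 ≤ x → x < m′ → x ≢ j → neg (x , j) ∈ lits (T₁ ∷ʳ e)
      low′ 1≤x x<m′ x≢j with bel x<m′
      ... | inj₁ x<m = lits-++ˡ T₁ (lits-++ˡ t (lowQ st 1≤x x<m x≢j))
      ... | inj₂ (inj₁ refl) = lits-++ʳ T₁ (here refl)
      ... | inj₂ (inj₂ x≡j) = contradiction x≡j x≢j
      lowDc′ : ∀ {x} → 1 ≤ x → x < m′ → x ≢ dc → (x , dc) ∈ vars (T₁ ∷ʳ e)
      lowDc′ {x} 1≤x x<m′ x≢dc with bel x<m′
      ... | inj₁ x<m = subst ((x , dc) ∈_) (sym (ListP.map-++ _ T₁ (e ∷ [])))
              (∈-++⁺ˡ (subst ((x , dc) ∈_) (sym (ListP.map-++ _ t (d ∷ []))) (∈-++⁺ˡ (lowDc st 1≤x x<m x≢dc))))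
      ... | inj₂ (inj₁ refl) = subst (λ dc → (m , dc) ∈ vars (T₁ ∷ʳ e)) (sym (proj₁ dc-b))
              (lits⇒vars (T₁ ∷ʳ e) {neg (m , b)} (lits-++ˡ T₁ d∈))
      ... | inj₂ (inj₂ refl) = subst (λ dc → (j , dc) ∈ vars (T₁ ∷ʳ e)) (sym (proj₁ dc-b))
              (lits⇒vars (T₁ ∷ʳ e) {pos (j , b)} (lits-++ˡ T₁ (lits-++ˡ t jb∈)))

  -- Once the queue is empty, the search resumes as a decision stage with `s` in the role of `j` and
  -- `c` in that of `b`; `m₀` is the first row of column `s` that P(s,c) has not settled.
  closing-steps : ∀ {s c t₁ c₀ rest k r dc m₀} → PSt s c 0 t₁ c₀ rest k → OpenData r s c dc m₀ →
    Sound n (DB n ls) (after t₁ s c c₀ rest) k → Steps (after t₁ s c c₀ rest) k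
  closing-steps {s} {c} {t₁} {c₀} {rest} {k} {r} {dc} {m₀} P od S = record
    { onUnit = λ dk cl∈ ē∈ st → unit-case (proj₁ (unit⇒allFalseBut T₂′ _ st)) (p-clause P S dk cl∈ ē∈ (proj₁ (unit⇒allFalseBut T₂′ _ st)))
    ; onConf = λ dk cl∈ ē∈ st → conf-case (falsified⇒allFalseBut T₂′ _ st) (p-clause P S dk cl∈ ē∈ (falsified⇒allFalseBut T₂′ _ st))
    ; onAdv  = λ _ _ → closing (p-advance P) od
    ; onDec  = λ dk quiet → decide-step (qc od) (start dk) S dk quiet }
    where
    T₂′ = after t₁ s c c₀ rest

    free : ∀ {y} → m₀ ≤ y → neg (y , s) ∉ lits T₂′
    free m₀≤y y∈ with upT P y∈
    ... | inj₁ (_ , () , _)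
    ... | inj₂ (inj₁ (s≡c , _)) = row≢col (vsc P) s≡c
    ... | inj₂ (inj₂ (_ , _ , inj₁ y<s)) = <-irrefl refl (<-trans y<s (≤-trans (s<m₀ od) m₀≤y))
    ... | inj₂ (inj₂ (_ , _ , inj₂ refl)) = <-irrefl refl (≤-trans (c<m₀ od) m₀≤y)

    -- Rows `m₀` and `r` of column `s` are both non-false and occur in each of its row clauses, so
    -- none of these reacts yet.
    no-row : ∀ {e cl u} → RowCase P e cl → ¬ AllFalseBut T₂′ cl u
    no-row rc F with R ← RowCase.isRows rc | r≤ ← minJ (qc od) (RowCase.row rc)
      with F (⇒rows R (≤-trans (s≤s z≤n) (s<m₀ od) , ≤-trans (<⇒≤ (m₀<r od)) r≤ , λ { refl → <-irrefl refl (s<m₀ od) }))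
         | F (⇒rows R (≤-trans (s≤s z≤n) (m₀<r od) , r≤ , row≢col (vrj (qc od))))
    ... | inj₁ x | _ = free ≤-refl x
    ... | _ | inj₁ x = free (<⇒≤ (m₀<r od)) x
    ... | inj₂ (eq , _) | inj₂ (eq′ , _) with refl ← just-injective eq eq′ = <-irrefl refl (m₀<r od)

    unit-case : ∀ {e cl m} → AllFalseBut T₂′ cl (just m) →
      (∃ λ m′ → just m ≡ just m′ × Good s c 0 (entry m′ (just cl))) ⊎ RowCase P e cl → Phase (T₂′ ∷ʳ entry m (just cl)) k
    unit-case F (inj₁ (_ , refl , g)) = subst (λ t → Phase t k) (after-∷ʳ t₁ rest _) (closing (p-extend P g) od)
    unit-case F (inj₂ rc) = ⊥-elim (no-row rc F)

    conf-case : ∀ {e cl} → AllFalseBut T₂′ cl nothing →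
      (∃ λ m′ → nothing ≡ just m′ × Good s c 0 (entry m′ (just cl))) ⊎ RowCase P e cl → Lrn T₂′ cl
    conf-case F (inj₂ rc) = ⊥-elim (no-row rc F)

    up′ : ∀ {l} → UpAfter s c 0 l → UpQ s c m₀ l
    up′ {pos _} (inj₂ (inj₁ (refl , refl))) = refl , refl , 1≤col (vsc P)
    up′ {neg _} (inj₂ (inj₁ (refl , 1≤y , y<s , _))) = inj₁ (refl , 1≤col (vsc P) , 1≤y , <-trans y<s (s<m₀ od))
    up′ {neg _} (inj₂ (inj₂ (refl , 1≤y , inj₁ y<s))) = inj₂ (refl , 1≤y , <-trans y<s (s<m₀ od) , ℕP.<⇒≢ y<s)
    up′ {neg _} (inj₂ (inj₂ (refl , 1≤y , inj₂ refl))) = inj₂ (refl , 1≤y , c<m₀ od , row≢col (vsc P) ∘ sym)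

    start : drop k T₂′ ≡ [] → QState r s c dc m₀ T₂′ k
    start dk = record
      { t′ = T₂′ ; tl = [] ; split = sym (ListP.++-identityʳ T₂′) ; t′≤k = drop-[]⇒≤ k T₂′ dk ; tail = none (m₀<r od)
      ; upQ = λ {l} l∈ → up′ {l} (upT P l∈) ; lowQ = low′ ; lowDc = lowDc′ (dcv (qc od)) ; ambDc = λ _ → p∈ P
      ; m≤r = <⇒≤ (m₀<r od) ; m≢j = (λ { refl → <-irrefl refl (s<m₀ od) }) ; b<m = c<m₀ od ; 1≤m = ≤-trans (s≤s z≤n) (s<m₀ od) }
      where
      filled : Filled P
      filled = fill P S (empty-passed t₁ dk)
      low′ : ∀ {x} → 1 ≤ x → x < m₀ → x ≢ s → neg (x , s) ∈ lits T₂′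
      low′ 1≤x x<m₀ x≢s with below-m₀ od x<m₀
      ... | inj₁ x<s = filled (1≤x , inj₁ x<s)
      ... | inj₂ (inj₁ x≡s) = contradiction x≡s x≢s
      ... | inj₂ (inj₂ x≡c) = filled (1≤x , inj₂ x≡c)
      lowDc′ : ∀ {x} → dc ≡ s ⊎ (dc ≡ c × 1 ≤ c × c ≤ n) → 1 ≤ x → x < m₀ → x ≢ dc → (x , dc) ∈ vars T₂′
      lowDc′ (inj₁ refl) 1≤x x<m₀ x≢s = lits⇒vars T₂′ (low′ 1≤x x<m₀ x≢s)
      lowDc′ (inj₂ (refl , _)) 1≤x x<m₀ x≢c with below-m₀ od x<m₀
      ... | inj₁ x<s = lits⇒vars T₂′ (lits-++ˡ t₁ (low P 1≤x x<s x≢c))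
      ... | inj₂ (inj₁ refl) = lits⇒vars T₂′ (p∈ P)
      ... | inj₂ (inj₂ x≡c) = contradiction x≡c x≢c

  steps : ∀ {t k} → Phase t k → Sound n (DB n ls) t k → Steps t k
  steps (deciding qc st) S = deciding-steps qc st S
  steps (decided qc m<r dc≢j st eq) S = decided-steps qc m<r dc≢j st eq S
  steps (conflicting P row c<s an) S = conflicting-steps P row c<s an S
  steps (chaining P sn only-n c<s z₀≡ s≡ rowSn rowNN L) S = chaining-steps P sn only-n c<s z₀≡ s≡ rowSn rowNN L S
  steps (closing P od) S = closing-steps P od S
  steps (doomed Dm) S = doom-steps Dm S

-- Termination and the schedule of restarts

unique-⊆-length : ∀ {X : Set} {xs ys : List X} → Unique xs → (∀ {x} → x ∈ xs → x ∈ ys) → length xs ≤ length ys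
unique-⊆-length {xs = []} _ _ = z≤n
unique-⊆-length {xs = x ∷ xs} (x∉ ∷ u) sub with pre , post , refl ← ∈-∃++ (sub (here refl)) =
  subst (suc (length xs) ≤_) (sym (trans (ListP.length-++ pre) (trans (ℕP.+-suc (length pre) (length post))
      (cong suc (sym (ListP.length-++ pre)))))) (s≤s (unique-⊆-length u sub′))
  where
  sub′ : ∀ {y} → y ∈ xs → y ∈ pre ++ post
  sub′ y∈ with ∈-++⁻ pre (sub (there y∈))
  ... | inj₁ p = ∈-++⁺ˡ p
  ... | inj₂ (here refl) = contradiction refl (All.lookup x∉ y∈)
  ... | inj₂ (there p) = ∈-++⁺ʳ pre p

sound-size : ∀ {n db t k} → Sound n db t k → length t + k ≤ length (variables n) + length (variables n)
sound-size {n} {t = t} S = ℕP.+-mono-≤ len (≤-trans (k≤ S) len)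
  where
  len : length t ≤ length (variables n)
  len = subst (_≤ length (variables n)) (ListP.length-map _ t) (unique-⊆-length (uniq S) (ranged S))

module Runner (n : ℕ) (δ : ℚ) (Res : List Clause → Set) where

  Goal : Config → Set
  Goal c = Acc (λ c′ c → Step n δ c c′) c
         × (∀ c′ → Star (Step n δ) c c′ → Stuck n δ c′ → ∃ λ ls → c′ ≡ unsat ls × Res ls)

  goal : ∀ {c} → (∀ {c′} → Step n δ c c′ → Goal c′) → ¬ Stuck n δ c → Goal c
  goal next ¬stuck = acc (λ st → proj₁ (next st)) , λ
    { _ ε stuck → contradiction stuck ¬stuck
    ; c′ (st ◅ sts) stuck → proj₂ (next st) c′ sts stuck }

  goal-unsat : ∀ {ls} → Res ls → Goal (unsat ls)
  goal-unsat {ls} res = acc (λ ()) , λ { _ ε _ → ls , refl , res ; _ (() ◅ _) _ }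

  -- There is no search for a non-quiet clause: in a stuck state any unit or falsified clause would
  -- give a step, so all relevant clauses are quiet, and then `advance` or `decide` applies.
  not-stuck : ∀ {ls t k} →
    (drop k t ≡ [] → (∀ c → c ∈ DB n ls → Quiet (status t c)) → ∃ λ x → pick n δ ls t ≡ just x) →
    ¬ Stuck n δ (running ⟨ ls , t , k ⟩)
  not-stuck {ls} {t} {k} dec stuck with drop k t in dk
  ... | e ∷ es = stuck _ (advance dk quiet)
    where
    quiet : ∀ c → c ∈ DB n ls → complement (lit e) ∈ c → Quiet (status t c)
    quiet c c∈ ē∈ with status t c in st
    ... | satisfied = sat-quiet
    ... | unresolved = unr-quiet
    ... | falsified = ⊥-elim (stuck _ (conflict dk c∈ ē∈ st))
    ... | unit m = ⊥-elim (stuck _ (propagate dk c∈ ē∈ st))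
  ... | [] = stuck _ (decide dk quiet (proj₂ (dec refl quiet)))
    where
    quiet : ∀ c → c ∈ DB n ls → Quiet (status t c)
    quiet c c∈ with status t c in st
    ... | satisfied = sat-quiet
    ... | unresolved = unr-quiet
    ... | falsified = ⊥-elim (stuck _ (conflict₀ dk c∈ st))
    ... | unit m = ⊥-elim (stuck _ (propagate₀ dk c∈ st))

  size : Trail → ℕ → ℕ
  size t k = length t + k

  capacity : ℕ
  capacity = length (variables n) + length (variables n)

  size-∷ʳ : ∀ t e k → size (t ∷ʳ e) k ≡ suc (size t k)
  size-∷ʳ t e k = cong (_+ k) (trans (ListP.length-++ t) (ℕP.+-comm (length t) 1))

  size-advance : ∀ t k → size t (suc k) ≡ suc (size t k)
  size-advance t k = ℕP.+-suc (length t) k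

  fuel-step : ∀ {f a b} → b ≡ suc a → capacity < suc f + a → capacity < f + b
  fuel-step {f} {a} refl lt = subst (capacity <_) (sym (ℕP.+-suc f a)) lt

  module _ (ls : List Clause) {Row : ℕ → ℕ → Set} (dbase : Database n Row (DB n ls))
    (rowRange : ∀ {z s} → Row z s → 1 ≤ z × z ≤ n × z ≤ s × s ≤ n) where

    open Database dbase

    unit-var : ∀ {t cl m} → cl ∈ DB n ls → status t cl ≡ unit m → var m ∈ variables n × var m ∉ vars t
    unit-var {t} cl∈ eq with _ , m∈ , m∉ , m̄∉ ← unit⇒allFalseBut t _ eq =
      inDB-var rowRange (view cl∈) m∈ , unassigned t m∉ m̄∉

    module _ (nonempty : ∀ {z s} → Row z s → ∃ λ i → InRow z s i) where

      has-literal : ∀ {cl} → cl ∈ DB n ls → ∃ λ l → l ∈ cl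
      has-literal cl∈ with view cl∈
      ... | vA _ _ _ = _ , here refl
      ... | vB _ = _ , here refl
      ... | vR r R = _ , ⇒rows R (proj₂ (nonempty r))

      module _ (z₀ h₀ : ℕ) (scoreInv : ScoreInv (score δ ls))
        (learnt : ∀ {cl} → Rows cl z₀ h₀ → Goal (running ⟨ ls ∷ʳ cl , [] , 0 ⟩)) where

        open Search n δ ls dbase rowRange z₀ h₀ scoreInv

        on-conflict : ∀ {t cl} → Lrn t cl → Goal (onConflict ls t cl)
        on-conflict {t} (hd , R) with hasDecision t
        on-conflict (refl , R) | true = learnt R

        -- A step without conflict lengthens the trail or its processed part by one, and both are
        -- bounded by the number of variables. A conflict hands over to `learnt`.
        run : ∀ f {t k} → Phase t k → Sound n (DB n ls) t k → capacity < f + size t k → Goal (running ⟨ ls , t , k ⟩)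
        run zero ph S lt = contradiction (≤-trans lt (sound-size S)) (<-irrefl refl)
        run (suc f) {t} {k} ph S lt = goal next (not-stuck λ dk quiet → case onDec st dk quiet of λ (x , eq , _) → x , eq)
          where
          st : Steps t k
          st = steps ph S
          next : ∀ {c′} → Step n δ (running ⟨ ls , t , k ⟩) c′ → Goal c′
          next (propagate {c = c} {m} dk c∈ ē∈ eq) with v∈ , v∉ ← unit-var {t} c∈ eq =
            run f (onUnit st dk c∈ ē∈ eq) (sound-append (entry m (just c)) S v∈ v∉) (fuel-step {f} (size-∷ʳ t _ k) lt)
          next (conflict {c = c} dk c∈ ē∈ eq) = on-conflict {t} {c} (onConf st dk c∈ ē∈ eq)
          next (advance dk quiet) = run f (onAdv st dk quiet) (sound-advance S dk quiet) (fuel-step {f} (size-advance t k) lt)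
          next (propagate₀ dk c∈ eq) = contradiction eq (sound-unit₀ S dk c∈)
          next (conflict₀ dk c∈ eq) = contradiction eq (sound-falsified₀ S dk c∈ (proj₂ (has-literal c∈)))
          next (decide dk quiet eq) with y , eq′ , v∈ , v∉ , ph′ ← onDec st dk quiet with refl ← trans (sym eq) eq′ =
            run f ph′ (sound-append (entry (neg y) nothing) S v∈ v∉) (fuel-step {f} (size-∷ʳ t _ k) lt)

    -- `Sound` is used over the empty database, only for the size bound: no phase has to be tracked.
    -- Since some clause is always non-quiet, no decision is ever made, and any conflict whatever
    -- gives `unsat`.
    run-final : Res ls → (∀ {t} → Consistent t → ¬ (∀ c → c ∈ DB n ls → Quiet (status t c))) →
      ∀ f {t k} → hasDecision t ≡ false → Sound n [] t k → capacity < f + size t k → Goal (running ⟨ ls , t , k ⟩)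
    run-final res loud zero nd S lt = contradiction (≤-trans lt (sound-size S)) (<-irrefl refl)
    run-final res loud (suc f) {t} {k} nd S lt = goal next (not-stuck λ _ quiet → ⊥-elim (loud (cons S) quiet))
      where
      extend : ∀ {c m} → c ∈ DB n ls → status t c ≡ unit m → Goal (running ⟨ ls , t ∷ʳ entry m (just c) , k ⟩)
      extend {c} {m} c∈ eq with v∈ , v∉ ← unit-var {t} c∈ eq =
        run-final res loud f (no-dec t nd) (sound-append (entry m (just c)) S v∈ v∉) (fuel-step {f} (size-∷ʳ t _ k) lt)
        where
        no-dec : ∀ t → hasDecision t ≡ false → hasDecision (t ∷ʳ entry m (just c)) ≡ false
        no-dec [] _ = refl
        no-dec (e ∷ t) h with isDecision e
        ... | false = no-dec t h
      next : ∀ {c′} → Step n δ (running ⟨ ls , t , k ⟩) c′ → Goal c′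
      next (propagate _ c∈ _ eq) = extend c∈ eq
      next (propagate₀ _ c∈ eq) = extend c∈ eq
      next (conflict _ _ _ _) rewrite nd = goal-unsat res
      next (conflict₀ _ _ _) rewrite nd = goal-unsat res
      next (advance dk _) = run-final res loud f nd (sound-advance S dk λ _ ()) (fuel-step {f} (size-advance t k) lt)
      next (decide dk quiet _) = ⊥-elim (loud (cons S) quiet)

∈-snoc⁻ : ∀ {X : Set} (xs : List X) {x y} → y ∈ xs ∷ʳ x → y ∈ xs ⊎ y ≡ x
∈-snoc⁻ xs y∈ with ∈-++⁻ xs y∈
... | inj₁ p = inj₁ p
... | inj₂ (here p) = inj₂ p

-- The diagonal row does not occur in its column. So the last clause of block j+1 also acts as
-- R(j+1,j) and propagates P(j,j+1) in the next block; for j = 1 it is the unit clause P(1,2).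
rows-skip : ∀ {c j} → Rows c (suc j) (suc j) → Rows c (suc j) j
rows-skip {c} {j} R = rows
  (λ l∈ → case rows⇒ R l∈ of λ { (i , eq , 1≤i , i≤ , i≢) → i , eq , 1≤i , ≤-pred (≤∧≢⇒< i≤ i≢) , i≢ })
  (λ (1≤i , i≤j , i≢) → ⇒rows R (1≤i , ≤-trans i≤j (n≤1+n j) , i≢))

-- The rounds and the facts each of them relies on.

module Schedule (n₃ : ℕ) (3≤n₃ : 3 ≤ n₃) where

  n₂ n₁ n : ℕ
  n₂ = suc n₃
  n₁ = suc n₂
  n  = suc n₁

  -- The last conjunct rules out the singleton R(1,2) and the empty R(1,1), so that R(2,2) is the
  -- only row clause with fewer than two literals.
  SpecOK : List (ℕ × ℕ) → Set
  SpecOK sp = ∀ {z s} → (z , s) ∈ sp → 1 ≤ z × z ≤ s × s < n × z ≤ n₂ × (z ≡ 1 → 3 ≤ s)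

  MinCol : List (ℕ × ℕ) → ℕ → ℕ → Set
  MinCol sp z m = ∀ {s′} → (z , s′) ∈ sp → m ≤ s′

  NoCol : List (ℕ × ℕ) → ℕ → Set
  NoCol sp z = ∀ {s′} → (z , s′) ∉ sp

  Diagonal : List (ℕ × ℕ) → ℕ → Set
  Diagonal sp a = ∀ {z} → a ≤ z → z ≤ n₂ → (z , z) ∈ sp

  -- R(1,n-2) remains the shortest clause of column 1 during the whole cascade. It propagates
  -- P(n-2,1) in the first `via` round and again in the first tail round.
  Ones : List (ℕ × ℕ) → Set
  Ones sp = (1 , n₂) ∈ sp × MinCol sp 1 n₂

  -- Named after how they learn: dir c s learns R(c,s−1) by decisions in column c; via b j learns
  -- R(j,n−1) by decisions in column b; tail₁ learns R(1,n−3) by decisions in column 2 and tail s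
  -- learns R(1,s−1) by decisions in column 1, both below the level-0 unit P(1,2). The run ends at tail 3.
  data Round : Set where
    head₁ head₂ tail₁ : Round
    dir via : ℕ → ℕ → Round
    tail : ℕ → Round

  -- The succession of rounds without any solver state; the list holds the clauses still to be
  -- learned. `wins` recurses on it, and `full-plan` matches it with `expectedLearned`.
  data Plan : Round → List (ℕ × ℕ) → Set where
    p-end      : Plan (tail 3) []
    p-head₁    : ∀ {xs} → Plan head₂ xs → Plan head₁ ((1 , n₁) ∷ xs)
    p-head₂    : ∀ {xs} → Plan (via 1 n₂) xs → Plan head₂ ((1 , n₂) ∷ xs)
    p-via      : ∀ {b j xs} → Plan (dir j n₁) xs → Plan (via b j) ((j , n₁) ∷ xs)
    p-dir      : ∀ {c h xs} → c < h → Plan (dir c h) xs → Plan (dir c (suc h)) ((c , h) ∷ xs)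
    p-dir-via  : ∀ {j xs} → 2 ≤ j → Plan (via (suc j) j) xs → Plan (dir (suc j) (suc (suc j))) ((suc j , suc j) ∷ xs)
    p-dir-tail : ∀ {xs} → Plan tail₁ xs → Plan (dir 2 3) ((2 , 2) ∷ xs)
    p-tail₁    : ∀ {xs} → Plan (tail n₃) xs → Plan tail₁ ((1 , n₃) ∷ xs)
    p-tail     : ∀ {h xs} → 3 ≤ h → Plan (tail h) xs → Plan (tail (suc h)) ((1 , h) ∷ xs)

  ViaCol : ℕ → ℕ → Set
  ViaCol b j = (b ≡ 1 × j ≡ n₂) ⊎ (b ≡ suc j × suc j ≤ n₂)

  data Facts (sp : List (ℕ × ℕ)) (q : Var → ℚ) : Round → Set where
    fHead₁ : sp ≡ [] → Dominates q 1 n₁ → Facts sp q head₁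
    fHead₂ : sp ≡ (1 , n₁) ∷ [] → Dominates q 1 n₁ → Facts sp q head₂
    fDir   : ∀ {c s} → 2 ≤ c → c < s → s ≤ n₁ → c ≤ n₂ → (c , s) ∈ sp → MinCol sp c s →
             (∀ {z} → 2 ≤ z → z < c → NoCol sp z) → Diagonal sp (suc c) → Ones sp → Dominates q c n₁ →
             Facts sp q (dir c s)
    fVia   : ∀ {b j} → ViaCol b j → 2 ≤ j → j ≤ n₂ → (∀ {z} → 2 ≤ z → z ≤ j → NoCol sp z) →
             Diagonal sp (suc j) → Ones sp → Dominates q b n₁ → Facts sp q (via b j)
    fTail₁ : Diagonal sp 2 → Ones sp → Dominates q 2 n₁ → Facts sp q tail₁
    fTail  : ∀ {s} → 3 ≤ s → s ≤ n₃ → (1 , s) ∈ sp → MinCol sp 1 s → Diagonal sp 2 → Dominates q 1 s →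
             Facts sp q (tail s)

  3≤n : 3 ≤ n
  3≤n = s≤s (s≤s (s≤s z≤n))

  module _ {sp : List (ℕ × ℕ)} (ok : SpecOK sp) where

    rowRange : ∀ {z s} → RowsOf n sp z s → 1 ≤ z × z ≤ n × z ≤ s × s ≤ n
    rowRange (inj₁ (refl , 1≤z , z≤)) = 1≤z , z≤ , z≤ , ≤-refl
    rowRange (inj₂ y∈) with 1≤z , z≤s , s<n , _ ← ok y∈ = 1≤z , ≤-trans z≤s (<⇒≤ s<n) , z≤s , <⇒≤ s<n

    one-3≤ : ∀ {s} → RowsOf n sp 1 s → 3 ≤ s
    one-3≤ (inj₁ (refl , _)) = 3≤n
    one-3≤ (inj₂ y∈) = proj₂ (proj₂ (proj₂ (proj₂ (ok y∈)))) refl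

    two-rows : ∀ {z s} → RowsOf n sp z s →
      (∃₂ λ i i′ → i ≢ i′ × InRow z s i × InRow z s i′) ⊎ (z ≡ 2 × s ≡ 2 × (2 , 2) ∈ sp)
    two-rows {z} {s} ρ with rowRange ρ
    two-rows {suc zero} ρ | _ with 3≤s ← one-3≤ ρ =
      inj₁ (2 , 3 , (λ ()) , (s≤s z≤n , ≤-trans (n≤1+n 2) 3≤s , λ ()) , (s≤s z≤n , 3≤s , λ ()))
    two-rows {suc (suc zero)} {s} ρ | _ , _ , 2≤s , _ with s ≟ 2
    two-rows {suc (suc zero)} {s} (inj₁ (() , _)) | _ | yes refl
    two-rows {suc (suc zero)} {s} (inj₂ y∈) | _ | yes refl = inj₂ (refl , refl , y∈)
    ... | no s≢2 = inj₁ (1 , 3 , (λ ()) , (s≤s z≤n , ≤-trans (s≤s z≤n) 2≤s , λ ()) , (s≤s z≤n , ≤∧≢⇒< 2≤s (s≢2 ∘ sym) , λ ()))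
    two-rows {suc (suc (suc z))} ρ | _ , _ , s≤s (s≤s le) , _ =
      inj₁ (1 , 2 , (λ ()) , (s≤s z≤n , s≤s z≤n , λ ()) , (s≤s z≤n , s≤s (s≤s z≤n) , λ ()))

    nonempty : ∀ {z s} → RowsOf n sp z s → ∃ λ i → InRow z s i
    nonempty ρ with two-rows ρ
    ... | inj₁ (i , _ , _ , r , _) = i , r
    ... | inj₂ (refl , refl , _) = 1 , s≤s z≤n , s≤s z≤n , λ ()

    two-literals : ∀ {cl} → InDB n (RowsOf n sp) cl →
      (∃₂ λ l l′ → l ≢ l′ × l ∈ cl × l′ ∈ cl) ⊎ (Rows cl 2 2 × (2 , 2) ∈ sp)
    two-literals (vA _ _ _) = inj₁ (_ , _ , (λ ()) , here refl , there (there (here refl)))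
    two-literals (vB ij) = inj₁ (_ , _ , (λ { refl → row≢col ij refl }) , here refl , there (here refl))
    two-literals (vR ρ R) with two-rows ρ
    ... | inj₂ (refl , refl , y∈) = inj₂ (R , y∈)
    ... | inj₁ (i , i′ , i≢i′ , r , r′) = inj₁ (_ , _ , (λ { refl → i≢i′ refl }) , ⇒rows R r , ⇒rows R r′)

    singleton : ∀ {cl m} → InDB n (RowsOf n sp) cl → (∀ {l} → l ∈ cl → l ≢ m → ⊥) → Rows cl 2 2 × (2 , 2) ∈ sp
    singleton {m = m} v h with two-literals v
    ... | inj₂ r = r
    ... | inj₁ (l , l′ , l≢l′ , l∈ , l′∈) with l ≟L m
    ...   | no l≢m = ⊥-elim (h l∈ l≢m)
    ...   | yes refl = ⊥-elim (h l′∈ (l≢l′ ∘ sym))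

  module Play (δ : ℚ) (0<δ : 0ℚ <ℚ δ) (δ≤½ : δ ≤ℚ ½) (Res : List Clause → Set) where

    open Scores δ 0<δ δ≤½
    open Runner n δ Res

    capacity-start : capacity < suc capacity + size [] 0
    capacity-start = subst (capacity <_) (sym (ℕP.+-identityʳ (suc capacity))) (n<1+n capacity)

    module _ {sp : List (ℕ × ℕ)} {ls : List Clause} (ok : SpecOK sp) (lrn : Learned ls sp) (I : ScoreInv (score δ ls)) where

      dbase : Database n (RowsOf n sp) (DB n ls)
      dbase = database n lrn

      open Database dbase

      rr : ∀ {z s} → RowsOf n sp z s → 1 ≤ z × z ≤ n × z ≤ s × s ≤ n
      rr = rowRange ok

      D-row : ∀ {z} → 1 ≤ z → z ≤ n → RowsOf n sp z n
      D-row a b = inj₁ (refl , a , b)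

      min-row : ∀ {z m} → MinCol sp z m → m ≤ n → ∀ {s′} → RowsOf n sp z s′ → m ≤ s′
      min-row mc m≤n (inj₁ (refl , _)) = m≤n
      min-row mc m≤n (inj₂ y∈) = mc y∈

      sound-[] : (2 , 2) ∉ sp → Sound n (DB n ls) [] 0
      sound-[] no22 = record { k≤ = z≤n ; uniq = [] ; ranged = λ () ; closed = λ c∈ m∈ h →
        contradiction (proj₂ (singleton ok (view c∈) λ l∈ l≢ → case h l∈ l≢ of λ ())) no22 }

      module Target (z₀ h₀ : ℕ) (learnt : ∀ {cl} → Rows cl z₀ h₀ → Goal (running ⟨ ls ∷ʳ cl , [] , 0 ⟩)) where

        open Search n δ ls dbase rr z₀ h₀ I

        deciding-goal : ∀ {r j dc} → QC r j 0 dc → dc ≡ j → (2 , 2) ∉ sp → 1 < r → (j ≡ 1 → 2 < r) →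
          Goal (running ⟨ ls , [] , 0 ⟩)
        deciding-goal {r} {j} qc refl no22 1<r 2<r = run ls dbase rr (nonempty ok) z₀ h₀ I learnt (suc capacity)
          (start (j ≟ 1)) (sound-[] no22) capacity-start
          where
          low₂ : ∀ {x} {P : Set} → 1 ≤ x → x < 2 → x ≢ 1 → P
          low₂ 1≤x x<2 x≢1 = contradiction (≤-antisym (≤-pred x<2) 1≤x) x≢1
          -- The first row of a column is 1, except in column 1, where it is 2.
          start : Dec (j ≡ 1) → Phase [] 0
          start (no j≢1) = deciding {m = 1} qc (record
            { t′ = [] ; tl = [] ; split = refl ; t′≤k = z≤n ; tail = none 1<r ; upQ = λ ()
            ; lowQ = λ { (s≤s _) (s≤s ()) _ } ; lowDc = λ { (s≤s _) (s≤s ()) _ } ; ambDc = λ j≢j → contradiction refl j≢j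
            ; m≤r = <⇒≤ 1<r ; m≢j = j≢1 ∘ sym ; b<m = s≤s z≤n ; 1≤m = s≤s z≤n })
          start (yes refl) = deciding {m = 2} qc (record
            { t′ = [] ; tl = [] ; split = refl ; t′≤k = z≤n ; tail = none (2<r refl) ; upQ = λ ()
            ; lowQ = low₂
            ; lowDc = low₂ ; ambDc = λ j≢j → contradiction refl j≢j
            ; m≤r = <⇒≤ (2<r refl) ; m≢j = (λ ()) ; b<m = s≤s z≤n ; 1≤m = s≤s z≤n })

        -- The empty trail is not sound here, because the unit clause R(2,2) has not been
        -- propagated. The only possible first step is `propagate₀` with P(1,2), which then plays
        -- the part of P(s,c) with `s = 1` and `c = 2`.
        closing-goal : ∀ {r dc} → OpenData r 1 2 dc 3 → (2 , 2) ∈ sp → Goal (running ⟨ ls , [] , 0 ⟩)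
        closing-goal {r} {dc} od 22∈ = goal next (not-stuck λ _ quiet → ⊥-elim (no-decide quiet))
          where
          no-decide : ¬ (∀ c → c ∈ DB n ls → Quiet (status [] c))
          no-decide quiet with c , c∈ , R ← hasR (inj₂ 22∈) =
            case quiet-force {[]} {c} {pos (1 , 2)} (λ ()) (quiet c c∈) (others R) of λ ()
            where
            others : ∀ {c} → Rows c 2 2 → ∀ {l} → l ∈ c → l ≢ pos (1 , 2) → complement l ∈ lits []
            others R l∈ l≢ with rows⇒ R l∈
            ... | suc zero , refl , _ = contradiction refl l≢
            ... | suc (suc zero) , refl , _ , _ , 2≢2 = contradiction refl 2≢2
            ... | suc (suc (suc _)) , refl , _ , s≤s (s≤s ()) , _

          only-literal : ∀ {c l} → Rows c 2 2 → l ∈ c → l ≡ pos (1 , 2)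
          only-literal R l∈ with rows⇒ R l∈
          ... | suc zero , refl , _ = refl
          ... | suc (suc zero) , refl , _ , _ , 2≢2 = contradiction refl 2≢2
          ... | suc (suc (suc _)) , refl , _ , s≤s (s≤s ()) , _

          others-false : ∀ {c u} → AllFalseBut [] c (just u) → ∀ {l} → l ∈ c → l ≢ u → ⊥
          others-false F l∈ l≢ with F l∈
          ... | inj₂ (refl , _) = l≢ refl

          first-entry : ∀ {c} → Rows c 2 2 → Goal (running ⟨ ls , entry (pos (1 , 2)) (just c) ∷ [] , 0 ⟩)
          first-entry {c} R = run ls dbase rr (nonempty ok) z₀ h₀ I learnt (suc capacity)
            (closing {t₁ = []} {rest = []} record
              { vsc = valid ≤-refl (s≤s z≤n) (s≤s z≤n) (s≤s (s≤s z≤n)) (λ ()) ; b≢c = (λ ()) ; b<s = (λ ()) ; b≢s = (λ ())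
              ; c₀-rows = rows-skip R ; up = (λ ()) ; low = (λ { (s≤s _) (s≤s ()) _ }) ; goods = [] ; pend = (λ ())
              ; minC = λ ρ → ≤-trans (proj₁ (rr ρ)) (proj₁ (proj₂ (proj₂ (rr ρ)))) } od)
            (record
              { k≤ = z≤n ; uniq = [] ∷ [] ; ranged = λ { (here refl) → ∈-variables⁺ {n} (valid (s≤s z≤n) (s≤s z≤n) (s≤s z≤n) (s≤s (s≤s z≤n)) λ ()) }
              ; closed = λ c∈ m∈ h → here (only-literal (proj₁ (singleton ok (view c∈) λ l∈ l≢ → case h l∈ l≢ of λ ())) m∈) })
            (≤-trans capacity-start (ℕP.+-monoʳ-≤ (suc capacity) {size [] 0} z≤n))

          next : ∀ {c′} → Step n δ (running ⟨ ls , [] , 0 ⟩) c′ → Goal c′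
          next (propagate () _ _ _)
          next (conflict () _ _ _)
          next (advance () _)
          next (propagate₀ {c = c} _ c∈ eq) with F , m∈ , _ ← unit⇒allFalseBut [] c eq
            with R , _ ← singleton ok (view c∈) (others-false F) with refl ← only-literal R m∈ = first-entry R
          next (conflict₀ {c = c} _ c∈ eq) with _ , l∈ ← has-literal ls dbase rr (nonempty ok) c∈
            with falsified⇒allFalseBut [] c eq l∈
          ... | inj₁ ()
          next (decide _ quiet _) = ⊥-elim (no-decide quiet)

        only-n : ∀ {s′} → RowsOf n sp n₁ s′ → s′ ≡ n
        only-n (inj₁ (eq , _)) = eq
        only-n (inj₂ y∈) = contradiction (proj₁ (proj₂ (proj₂ (proj₂ (ok y∈))))) (<-irrefl refl)

        n-n : RowsOf n sp n n
        n-n = D-row (s≤s z≤n) ≤-refl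

        chain-kind : ∀ {c} → c < n₁ → z₀ ≡ c → n₁ ≡ suc h₀ → Kind n₁ c 0
        chain-kind c<s z₀≡ s≡ = kchain refl refl only-n c<s z₀≡ s≡ (D-row (s≤s z≤n) (n≤1+n n₁)) n-n

        direct-qc : ∀ {c s} → 1 ≤ c → c < s → s ≤ n → RowsOf n sp c s → (∀ {s′} → RowsOf n sp c s′ → s ≤ s′) →
          Dominates (score δ ls) c n₁ → Kind s c 0 → QC s c 0 c
        direct-qc {c} {s} 1≤c c<s s≤n ρ min dm kd = record
          { vrj = valid (≤-trans (s≤s z≤n) c<s) s≤n 1≤c (≤-trans (<⇒≤ c<s) s≤n) (ℕP.<⇒≢ c<s ∘ sym)
          ; b≢j = ℕP.<⇒≢ 1≤c ; b≢r = ℕP.<⇒≢ (≤-trans (s≤s z≤n) c<s) ; rowJ = hasR ρ ; minJ = min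
          ; minB = λ ρ′ → case proj₁ (rr ρ′) of λ () ; dcv = inj₁ refl ; dom = n₁ , s≤n , dm ; kind = kd }

        head₁-goal : sp ≡ [] → Dominates (score δ ls) 1 n₁ → z₀ ≡ 1 → h₀ ≡ n₁ → Goal (running ⟨ ls , [] , 0 ⟩)
        head₁-goal refl dm refl refl = deciding-goal
          (direct-qc ≤-refl (s≤s (s≤s z≤n)) ≤-refl (D-row ≤-refl (s≤s z≤n)) (λ { (inj₁ (refl , _)) → ≤-refl ; (inj₂ ()) }) dm
            (kconf n-n (s≤s (s≤s z≤n)) refl refl))
          refl (λ ()) (s≤s (s≤s z≤n)) (λ _ → 3≤n)

        head₂-goal : sp ≡ (1 , n₁) ∷ [] → Dominates (score δ ls) 1 n₁ → z₀ ≡ 1 → h₀ ≡ n₂ → Goal (running ⟨ ls , [] , 0 ⟩)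
        head₂-goal refl dm refl refl = deciding-goal
          (direct-qc ≤-refl (s≤s (s≤s z≤n)) (n≤1+n n₁) (inj₂ (here refl))
            (min-row {1} (λ { (here refl) → ≤-refl }) (n≤1+n n₁)) dm (chain-kind (s≤s (s≤s z≤n)) refl refl))
          refl (λ { (here ()) }) (s≤s (s≤s z≤n)) (λ _ → s≤s (s≤s (≤-trans (s≤s z≤n) 3≤n₃)))

        dir-goal : ∀ {c h} → Facts sp (score δ ls) (dir c (suc h)) → z₀ ≡ c → h₀ ≡ h → Goal (running ⟨ ls , [] , 0 ⟩)
        dir-goal {c} {h} (fDir 2≤c c<s s≤n₁ c≤n₂ row mc nc dg _ dm) refl refl = deciding-goal
          (direct-qc (≤-trans (s≤s z≤n) 2≤c) c<s (≤-trans s≤n₁ (n≤1+n n₁)) (inj₂ row) (min-row {c} mc (≤-trans s≤n₁ (n≤1+n n₁))) dm kd)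
          refl no22 (≤-trans 2≤c (<⇒≤ c<s)) (λ { refl → case 2≤c of λ { (s≤s ()) } })
          where
          -- Learned clauses stop at column n-2, so column n-1 only has its D clause and the
          -- conflict is chained; for a smaller s the clause R(s,s) is known from an earlier block.
          kd : Kind (suc h) c 0
          kd with suc h ≟ n₁
          ... | yes refl = chain-kind c<s refl refl
          ... | no ≢n₁ = kconf (inj₂ (dg c<s (≤-pred (≤∧≢⇒< s≤n₁ ≢n₁)))) c<s refl refl
          no22 : (2 , 2) ∉ sp
          no22 22∈ with c ≟ 2
          ... | yes refl = <-irrefl refl (≤-trans c<s (mc 22∈))
          ... | no c≢2 = nc ≤-refl (≤∧≢⇒< 2≤c (c≢2 ∘ sym)) 22∈

        -- Two nested searches: R(b,j) propagates P(j,b), then further decisions in column `b` are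
        -- copied to column `j` until D(j), so far its only row clause, propagates P(n,j) into the
        -- conflict with D(n).
        via-goal : ∀ {b j} → Facts sp (score δ ls) (via b j) → z₀ ≡ j → h₀ ≡ n₁ → Goal (running ⟨ ls , [] , 0 ⟩)
        via-goal {b} {j} (fVia vc 2≤j j≤n₂ nc dg (one∈ , one-min) dm) refl refl = deciding-goal
          (record
            { vrj = valid 1≤j j≤n 1≤b b≤n j≢b ; b≢j = ℕP.<⇒≢ 1≤b ; b≢r = ℕP.<⇒≢ 1≤j ; rowJ = rowB vc ; minJ = minB′ vc
            ; minB = λ ρ → case proj₁ (rr ρ) of λ () ; dcv = inj₁ refl ; dom = n₁ , j≤n , dm
            ; kind = kopen refl record
                { qc = record
                    { vrj = valid (s≤s z≤n) ≤-refl 1≤j j≤n n≢j ; b≢j = j≢b ∘ sym ; b≢r = b≢n vc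
                    ; rowJ = hasR (D-row 1≤j j≤n)
                    ; minJ = λ { (inj₁ (refl , _)) → ≤-refl ; (inj₂ y∈) → contradiction y∈ (nc 2≤j ≤-refl) }
                    ; minB = minB′ vc ; dcv = inj₂ (refl , 1≤b , b≤n) ; dom = n₁ , ≤-refl , dm
                    ; kind = kconf n-n j<n refl refl }
                ; m₀<r = m₀<n vc ; s<m₀ = s≤s (j≤top vc) ; c<m₀ = s≤s (b≤top vc) ; below-m₀ = below-top vc } })
          refl no22 2≤j (two vc)
          where
          1≤j : 1 ≤ j
          1≤j = ≤-trans (s≤s z≤n) 2≤j
          j<n₁ : j < n₁
          j<n₁ = s≤s j≤n₂
          j<n : j < n
          j<n = <-trans j<n₁ (n<1+n n₁)
          j≤n : j ≤ n
          j≤n = <⇒≤ j<n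
          n≢j : n ≢ j
          n≢j = ℕP.<⇒≢ j<n ∘ sym
          bounds : ViaCol b j → 1 ≤ b × b ≤ n × j ≢ b
          bounds (inj₁ (refl , _)) = ≤-refl , s≤s z≤n , λ { refl → case 2≤j of λ { (s≤s ()) } }
          bounds (inj₂ (refl , _)) = s≤s z≤n , j<n , λ ()
          1≤b = proj₁ (bounds vc)
          b≤n = proj₁ (proj₂ (bounds vc))
          j≢b = proj₂ (proj₂ (bounds vc))
          b≢n : ViaCol b j → b ≢ n
          b≢n (inj₁ (refl , _)) ()
          b≢n (inj₂ (refl , le)) refl = <-irrefl refl (<-trans (n<1+n n₂) le)
          rowB : ViaCol b j → ∃ λ cl → cl ∈ DB n ls × Rows cl b j
          rowB (inj₁ (refl , refl)) = hasR (inj₂ one∈)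
          rowB (inj₂ (refl , le)) with cl , cl∈ , R ← hasR (inj₂ (dg ≤-refl le)) = cl , cl∈ , rows-skip R
          minB′ : ViaCol b j → ∀ {s′} → RowsOf n sp b s′ → j ≤ s′
          minB′ (inj₁ (refl , refl)) = min-row {1} one-min j≤n
          minB′ (inj₂ (refl , _)) ρ = ≤-trans (n≤1+n j) (proj₁ (proj₂ (proj₂ (rr ρ))))
          -- The larger of `j` and `b`: up to this row P(j,b) settles column `j`.
          top : ViaCol b j → ℕ
          top (inj₁ _) = j
          top (inj₂ _) = suc j
          m₀<n : (v : ViaCol b j) → suc (top v) < n
          m₀<n (inj₁ _) = s≤s j<n₁
          m₀<n (inj₂ (_ , le)) = s≤s (s≤s le)
          j≤top : (v : ViaCol b j) → j ≤ top v
          j≤top (inj₁ _) = ≤-refl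
          j≤top (inj₂ _) = n≤1+n j
          b≤top : (v : ViaCol b j) → b ≤ top v
          b≤top (inj₁ (refl , _)) = 1≤j
          b≤top (inj₂ (refl , _)) = ≤-refl
          below-top : (v : ViaCol b j) → ∀ {x} → x < suc (top v) → x < j ⊎ x ≡ j ⊎ x ≡ b
          below-top (inj₁ _) {x} (s≤s x≤j) with x ≟ j
          ... | yes x≡j = inj₂ (inj₁ x≡j)
          ... | no x≢j = inj₁ (≤∧≢⇒< x≤j x≢j)
          below-top (inj₂ (refl , _)) {x} (s≤s x≤sj) with x ≟ suc j | x ≟ j
          ... | yes x≡sj | _ = inj₂ (inj₂ x≡sj)
          ... | no _ | yes x≡j = inj₂ (inj₁ x≡j)
          ... | no x≢sj | no x≢j = inj₁ (≤∧≢⇒< (≤-pred (≤∧≢⇒< x≤sj x≢sj)) x≢j)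
          no22 : (2 , 2) ∉ sp
          no22 = nc ≤-refl 2≤j
          two : ViaCol b j → b ≡ 1 → 2 < j
          two (inj₁ (_ , refl)) _ = ≤-trans 3≤n₃ (n≤1+n n₃)
          two (inj₂ (refl , _)) refl = case 2≤j of λ ()

        tail-goal : ∀ {s dc M} → 4 ≤ s → s ≤ n₂ → (1 , s) ∈ sp → MinCol sp 1 s → Diagonal sp 2 →
          dc ≡ 1 ⊎ (dc ≡ 2 × 1 ≤ 2 × 2 ≤ n) → Dominates (score δ ls) dc M → s ≤ suc M → z₀ ≡ 1 → s ≡ suc h₀ →
          Goal (running ⟨ ls , [] , 0 ⟩)
        tail-goal {s} {dc} {M} 4≤s s≤n₂ row mc dg dcv′ dm s≤M z₀≡ s≡ = closing-goal {s} {dc}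
          (record
            { qc = record
                { vrj = valid (≤-trans (s≤s z≤n) 4≤s) s≤n ≤-refl (s≤s z≤n) (λ { refl → case 4≤s of λ { (s≤s ()) } })
                ; b≢j = (λ ()) ; b≢r = (λ { refl → case 4≤s of λ { (s≤s (s≤s ())) } }) ; rowJ = hasR (inj₂ row)
                ; minJ = min-row {1} mc s≤n ; minB = λ ρ → ≤-trans (proj₁ (rr ρ)) (proj₁ (proj₂ (proj₂ (rr ρ))))
                ; dcv = dcv′ ; dom = M , s≤M , dm
                ; kind = kconf (inj₂ (dg (≤-trans (s≤s (s≤s z≤n)) 4≤s) s≤n₂)) (≤-trans (s≤s (s≤s z≤n)) 4≤s) z₀≡ s≡ }
            ; m₀<r = 4≤s ; s<m₀ = s≤s (s≤s z≤n) ; c<m₀ = ≤-refl ; below-m₀ = below-3 })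
          (dg ≤-refl (s≤s (≤-trans (s≤s z≤n) 3≤n₃)))
          where
          s≤n : s ≤ n
          s≤n = ≤-trans s≤n₂ (≤-trans (n≤1+n n₂) (n≤1+n n₁))
          below-3 : ∀ {x} → x < 3 → x < 1 ⊎ x ≡ 1 ⊎ x ≡ 2
          below-3 {zero} _ = inj₁ (s≤s z≤n)
          below-3 {suc zero} _ = inj₂ (inj₁ refl)
          below-3 {suc (suc zero)} _ = inj₂ (inj₂ refl)
          below-3 {suc (suc (suc _))} (s≤s (s≤s (s≤s ())))

    min-snoc : ∀ {sp z m z′ s′} → MinCol sp z m → (z ≡ z′ → m ≤ s′) → MinCol (sp ∷ʳ (z′ , s′)) z m
    min-snoc {sp} mc new y∈ with ∈-snoc⁻ sp y∈
    ... | inj₁ y∈sp = mc y∈sp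
    ... | inj₂ refl = new refl

    noCol-snoc : ∀ {sp z z′ s′} → NoCol sp z → z ≢ z′ → NoCol (sp ∷ʳ (z′ , s′)) z
    noCol-snoc {sp} nc z≢ y∈ with ∈-snoc⁻ sp y∈
    ... | inj₁ y∈sp = nc y∈sp
    ... | inj₂ refl = z≢ refl

    diag-snoc : ∀ {sp a x} → Diagonal sp a → Diagonal (sp ∷ʳ x) a
    diag-snoc dg a≤z z≤n₂ = ∈-++⁺ˡ (dg a≤z z≤n₂)

    diag-new : ∀ {sp a} → Diagonal sp (suc a) → Diagonal (sp ∷ʳ (a , a)) a
    diag-new {sp} {a} dg {z} a≤z z≤n₂ with a ≟ z
    ... | yes refl = ∈-∷ʳ-last sp
    ... | no a≢z = ∈-++⁺ˡ (dg (≤∧≢⇒< a≤z a≢z) z≤n₂)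

    ones-snoc : ∀ {sp z s} → Ones sp → 2 ≤ z → Ones (sp ∷ʳ (z , s))
    ones-snoc {sp} (one∈ , mc) 2≤z = ∈-++⁺ˡ one∈ , min-snoc {sp} mc λ { refl → case 2≤z of λ { (s≤s ()) } }

    Wins : Round → List (ℕ × ℕ) → Set
    Wins ρ xs = ∀ {sp ls} → SpecOK sp → Facts sp (score δ ls) ρ → Learned ls sp → ScoreInv (score δ ls) →
      (∀ {ls′} → Learned ls′ (sp ++ xs) → Res ls′) → Goal (running ⟨ ls , [] , 0 ⟩)

    continue : ∀ {ρ xs z s sp ls} → Wins ρ xs → SpecOK sp → Learned ls sp → ScoreInv (score δ ls) →
      (∀ {ls′} → Learned ls′ (sp ++ (z , s) ∷ xs) → Res ls′) →
      1 ≤ z × z ≤ s × s < n × z ≤ n₂ × (z ≡ 1 → 3 ≤ s) →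
      (∀ {cl} → Rows cl z s → Facts (sp ∷ʳ (z , s)) (score δ (ls ∷ʳ cl)) ρ) →
      ∀ {cl} → Rows cl z s → Goal (running ⟨ ls ∷ʳ cl , [] , 0 ⟩)
    continue {xs = xs} {z} {s} {sp} {ls} wins ok lrn I res new facts {cl} R =
      wins ok′ (facts R) (PW.++⁺ lrn (R ∷ [])) (scoreInv-≗ (score-∷ʳ ls cl) (update-inv I R))
        (λ {ls′} L → res (subst (Learned ls′) (ListP.++-assoc sp ((z , s) ∷ []) xs) L))
      where
      ok′ : SpecOK (sp ∷ʳ (z , s))
      ok′ y∈ with ∈-snoc⁻ sp y∈
      ... | inj₁ y∈sp = ok y∈sp
      ... | inj₂ refl = new

    latest : ∀ {ls cl z s} → ScoreInv (score δ ls) → Rows cl z s → Dominates (score δ (ls ∷ʳ cl)) z s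
    latest {ls} {cl} I R = dominates-≗ (score-∷ʳ ls cl) (dominates-latest I R)

    keep : ∀ {ls cl z s M} → ScoreInv (score δ ls) → Dominates (score δ ls) z M → Rows cl z s →
      Dominates (score δ (ls ∷ʳ cl)) z M
    keep {ls} {cl} I dm R = dominates-≗ (score-∷ʳ ls cl) (dominates-keep I R dm)

    n₂≤n₁ : n₂ ≤ n₁
    n₂≤n₁ = n≤1+n n₂

    2≤n₂ : 2 ≤ n₂
    2≤n₂ = s≤s (≤-trans (s≤s z≤n) 3≤n₃)

    3≤n₂ : 3 ≤ n₂
    3≤n₂ = ≤-trans 3≤n₃ (n≤1+n n₃)

    one-ok : ∀ {s} → 3 ≤ s → s ≤ n₁ → 1 ≤ 1 × 1 ≤ s × s < n × 1 ≤ n₂ × (1 ≡ 1 → 3 ≤ s)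
    one-ok 3≤s s≤n₁ = ≤-refl , ≤-trans (s≤s z≤n) 3≤s , s≤s s≤n₁ , s≤s z≤n , λ _ → 3≤s

    big-ok : ∀ {z s} → 2 ≤ z → z ≤ s → s ≤ n₁ → z ≤ n₂ → 1 ≤ z × z ≤ s × s < n × z ≤ n₂ × (z ≡ 1 → 3 ≤ s)
    big-ok 2≤z z≤s s≤n₁ z≤n₂ = ≤-trans (s≤s z≤n) 2≤z , z≤s , s≤s s≤n₁ , z≤n₂ , λ { refl → case 2≤z of λ { (s≤s ()) } }

    wins : ∀ {ρ xs} → Plan ρ xs → Wins ρ xs
    wins (p-head₁ pl) {sp} {ls} ok (fHead₁ refl dm) lrn I res = Target.head₁-goal {sp} ok lrn I 1 n₁
      (continue (wins pl) ok lrn I res (one-ok (≤-trans 3≤n₂ n₂≤n₁) ≤-refl)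
        (λ R → fHead₂ refl (latest {ls} I R)))
      refl dm refl refl
    wins (p-head₂ pl) {sp} {ls} ok (fHead₂ refl dm) lrn I res = Target.head₂-goal {sp} ok lrn I 1 n₂
      (continue (wins pl) ok lrn I res (one-ok 3≤n₂ n₂≤n₁)
        (λ R → fVia (inj₁ (refl , refl)) 2≤n₂ ≤-refl
          (λ { (s≤s ()) _ (here refl) ; (s≤s ()) _ (there (here refl)) })
          (λ n₁≤z z≤n₂ → contradiction (≤-trans n₁≤z z≤n₂) (<-irrefl refl))
          (there (here refl) , λ { (here refl) → n₂≤n₁ ; (there (here refl)) → ≤-refl })
          (keep {ls} I dm R)))
      refl dm refl refl
    wins (p-via {b} {j} pl) {sp} {ls} ok fc@(fVia vc 2≤j j≤n₂ nc dg on dm) lrn I res = Target.via-goal {sp} ok lrn I j n₁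
      (continue (wins pl) ok lrn I res (big-ok 2≤j (≤-trans j≤n₂ n₂≤n₁) ≤-refl j≤n₂)
        (λ R → fDir 2≤j (s≤s j≤n₂) ≤-refl j≤n₂ (∈-∷ʳ-last sp)
          (min-snoc {sp} (λ y∈ → contradiction y∈ (nc 2≤j ≤-refl)) λ _ → ≤-refl)
          (λ 2≤z z<j → noCol-snoc {sp} (nc 2≤z (<⇒≤ z<j)) (ℕP.<⇒≢ z<j)) (diag-snoc dg) (ones-snoc on 2≤j) (latest {ls} I R)))
      fc refl refl
    wins (p-dir {c} {h} c<h pl) {sp} {ls} ok fc@(fDir 2≤c c<s s≤n₁ c≤n₂ row mc nc dg on dm) lrn I res =
      Target.dir-goal {sp} ok lrn I c h
      (continue (wins pl) ok lrn I res (big-ok 2≤c (<⇒≤ c<h) (≤-trans (n≤1+n h) s≤n₁) c≤n₂)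
        (λ R → fDir 2≤c c<h (≤-trans (n≤1+n h) s≤n₁) c≤n₂ (∈-∷ʳ-last sp)
          (min-snoc {sp} (≤-trans (n≤1+n h) ∘ mc) λ _ → ≤-refl)
          (λ 2≤z z<c → noCol-snoc {sp} (nc 2≤z z<c) (ℕP.<⇒≢ z<c)) (diag-snoc dg) (ones-snoc on 2≤c) (keep {ls} I dm R)))
      fc refl refl
    wins (p-dir-via {j} 2≤j pl) {sp} {ls} ok fc@(fDir 2≤c c<s s≤n₁ c≤n₂ row mc nc dg on dm) lrn I res =
      Target.dir-goal {sp} ok lrn I (suc j) (suc j)
      (continue (wins pl) ok lrn I res (big-ok 2≤c ≤-refl (≤-trans (n≤1+n (suc j)) s≤n₁) c≤n₂)
        (λ R → fVia (inj₂ (refl , c≤n₂)) 2≤j (≤-trans (n≤1+n j) c≤n₂)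
          (λ 2≤z z≤j → noCol-snoc {sp} (nc 2≤z (s≤s z≤j)) (ℕP.<⇒≢ (s≤s z≤j)))
          (diag-new dg) (ones-snoc on 2≤c) (keep {ls} I dm R)))
      fc refl refl
    wins (p-dir-tail pl) {sp} {ls} ok fc@(fDir 2≤c c<s s≤n₁ c≤n₂ row mc nc dg on dm) lrn I res =
      Target.dir-goal {sp} ok lrn I 2 2
      (continue (wins pl) ok lrn I res (big-ok 2≤c ≤-refl (≤-trans (n≤1+n 2) s≤n₁) c≤n₂)
        (λ R → fTail₁ (diag-new dg) (ones-snoc on 2≤c) (keep {ls} I dm R)))
      fc refl refl
    wins (p-tail₁ pl) {sp} {ls} ok (fTail₁ dg (one∈ , one-min) dm) lrn I res =
      Target.tail-goal {sp} ok lrn I 1 n₃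
      (continue (wins pl) ok lrn I res (one-ok 3≤n₃ (≤-trans (n≤1+n n₃) n₂≤n₁))
        (λ R → fTail 3≤n₃ ≤-refl (∈-∷ʳ-last sp) (min-snoc {sp} (≤-trans (n≤1+n n₃) ∘ one-min) λ _ → ≤-refl)
          (diag-snoc dg) (latest {ls} I R)))
      (s≤s 3≤n₃) ≤-refl one∈ one-min dg (inj₂ (refl , s≤s z≤n , s≤s (s≤s z≤n))) dm (≤-trans n₂≤n₁ (n≤1+n n₁)) refl refl
    wins (p-tail {h} 3≤h pl) {sp} {ls} ok (fTail _ s≤n₃ row mc dg dm) lrn I res =
      Target.tail-goal {sp} ok lrn I 1 h
      (continue (wins pl) ok lrn I res (one-ok 3≤h (≤-trans h≤n₃ (≤-trans (n≤1+n n₃) n₂≤n₁)))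
        (λ R → fTail 3≤h h≤n₃ (∈-∷ʳ-last sp) (min-snoc {sp} (≤-trans (n≤1+n h) ∘ mc) λ _ → ≤-refl)
          (diag-snoc dg) (latest {ls} I R)))
      (s≤s 3≤h) (≤-trans s≤n₃ (n≤1+n n₃)) row mc dg (inj₁ refl) dm (n≤1+n (suc h)) refl refl
      where
      h≤n₃ : h ≤ n₃
      h≤n₃ = ≤-trans (n≤1+n h) s≤n₃
    wins p-end {sp} {ls} ok (fTail _ _ row mc dg dm) lrn I res =
      run-final ls (database n lrn) (rowRange ok) (res (subst (Learned ls) (sym (ListP.++-identityʳ sp)) lrn)) loud
        (suc capacity) refl (record { k≤ = z≤n ; uniq = [] ; ranged = λ () ; closed = λ () }) capacity-start
      where
      open Database (database n lrn)
      v : ∀ {i j} → 1 ≤ i → i ≤ 3 → 1 ≤ j → j ≤ 3 → i ≢ j → Valid n i j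
      v a b c d e = valid a (≤-trans b 3≤n) c (≤-trans d 3≤n) e
      1≤1 = ≤-refl {1}
      1≤2 : 1 ≤ 2
      1≤2 = s≤s z≤n
      1≤3 : 1 ≤ 3
      1≤3 = s≤s z≤n
      2≤3 : 2 ≤ 3
      2≤3 = s≤s (s≤s z≤n)
      v31 = v 1≤3 ≤-refl 1≤1 1≤3 λ ()
      v23 = v 1≤2 2≤3 1≤3 ≤-refl λ ()
      v21 = v 1≤2 2≤3 1≤1 1≤3 λ ()

      -- R(2,2), R(1,3) and R(3,3) with transitivity and antisymmetry on rows 1 to 3 are refuted by
      -- unit propagation alone, so no trail makes all of them quiet.
      loud : ∀ {t} → Consistent t → ¬ (∀ c → c ∈ DB n ls → Quiet (status t c))
      loud {t} cs quiet = cs p13 n13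
        where
        force : ∀ {c m} → c ∈ DB n ls → (∀ {l} → l ∈ c → l ≢ m → complement l ∈ lits t) → m ∈ lits t
        force c∈ = quiet-force cs (quiet _ c∈)

        forceR : ∀ {z s m} → RowsOf n sp z s → (∀ {i} → InRow z s i → i ≢ m → neg (i , z) ∈ lits t) → pos (m , z) ∈ lits t
        forceR {z} {s} {m} ρ h with c , c∈ , R ← hasR ρ = force c∈ λ l∈ l≢ → others R l∈ l≢
          where
          others : ∀ {c l} → Rows c z s → l ∈ c → l ≢ pos (m , z) → complement l ∈ lits t
          others R l∈ l≢ with i , refl , r ← rows⇒ R l∈ = h r λ { refl → l≢ refl }

        p12 : pos (1 , 2) ∈ lits t
        p12 = forceR (inj₂ (dg ≤-refl 2≤n₂)) λ
          { {suc zero} _ 1≢1 → contradiction refl 1≢1 ; {suc (suc zero)} (_ , _ , 2≢2) _ → contradiction refl 2≢2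
          ; {suc (suc (suc _))} (_ , s≤s (s≤s ()) , _) _ }

        n21 : neg (2 , 1) ∈ lits t
        n21 = force (hasB v21) λ
          { (here refl) ≢ → contradiction refl ≢ ; (there (here refl)) _ → p12 }

        p31 : pos (3 , 1) ∈ lits t
        p31 = forceR (inj₂ row) λ
          { {suc zero} (_ , _ , 1≢1) _ → contradiction refl 1≢1 ; {suc (suc zero)} _ _ → n21
          ; {suc (suc (suc zero))} _ 3≢3 → contradiction refl 3≢3
          ; {suc (suc (suc (suc _)))} (_ , s≤s (s≤s (s≤s ())) , _) _ }

        n13 : neg (1 , 3) ∈ lits t
        n13 = force (hasB v31) λ
          { (here refl) _ → p31 ; (there (here refl)) ≢ → contradiction refl ≢ }

        n23 : neg (2 , 3) ∈ lits t
        n23 = force (hasA v23 v31 v21) λ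
          { (here refl) ≢ → contradiction refl ≢ ; (there (here refl)) _ → p31 ; (there (there (here refl))) _ → n21 }

        p13 : pos (1 , 3) ∈ lits t
        p13 = forceR (inj₂ (dg 2≤3 3≤n₂)) λ
          { {suc zero} _ 1≢1 → contradiction refl 1≢1 ; {suc (suc zero)} _ _ → n23
          ; {suc (suc (suc zero))} (_ , _ , 3≢3) _ → contradiction refl 3≢3
          ; {suc (suc (suc (suc _)))} (_ , s≤s (s≤s (s≤s ())) , _) _ }

-- The expected clauses as row clauses, and their plan.

not≟ : ∀ z i → Dec (i ≢ z)
not≟ z i = ¬? (i ≟ z)

idx-suc : ∀ m → idx (suc m) ≡ idx m ∷ʳ suc m
idx-suc m = trans (cong (map suc) (sym (ListP.upTo-∷ʳ m))) (ListP.map-++ suc (upTo m) (m ∷ []))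

others-suc : ∀ m z → length (filter (not≟ z) (idx (suc m))) ≡
  length (filter (not≟ z) (idx m)) + length (filter (not≟ z) (suc m ∷ []))
others-suc m z = trans (cong (length ∘ filter (not≟ z)) (idx-suc m))
  (trans (cong length (ListP.filter-++ (not≟ z) (idx m) _)) (ListP.length-++ (filter (not≟ z) (idx m))))

others-length : ∀ m {z} → 1 ≤ z → z ≤ suc m → length (filter (not≟ z) (idx (suc m))) ≡ m
others-length m {z} 1≤z z≤sm with z ≟ suc m
... | yes refl = trans (others-suc m z) (trans (cong₂ _+_ all-kept (cong length (ListP.filter-reject (not≟ z) {xs = []} λ z≢z → z≢z refl)))
  (ℕP.+-identityʳ m))
  where
  all-kept : length (filter (not≟ z) (idx m)) ≡ m
  all-kept = trans (cong length (ListP.filter-all (not≟ z) (All.tabulate λ i∈ → ℕP.<⇒≢ (s≤s (proj₂ (∈-idx⁻ i∈))))))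
    (trans (ListP.length-map suc (upTo m)) (ListP.length-upTo m))
others-length zero 1≤z z≤1 | no z≢1 = contradiction (≤-antisym z≤1 1≤z) z≢1
others-length (suc m) {z} 1≤z z≤sm | no z≢sm = trans (others-suc (suc m) z)
  (trans (cong₂ _+_ (others-length m 1≤z (≤-pred (≤∧≢⇒< z≤sm z≢sm)))
    (cong length (ListP.filter-accept (not≟ z) {xs = []} (z≢sm ∘ sym)))) (ℕP.+-comm m 1))

column-prefix : ∀ d m z → ∃ λ ys → column (d + m) z ≡ column m z ++ ys
column-prefix zero m z = [] , sym (ListP.++-identityʳ _)
column-prefix (suc d) m z with ys , eq ← column-prefix d m z =
  ys ++ map (λ i → (i , z)) (filter (not≟ z) (suc (d + m) ∷ [])) , (begin
    map (λ i → (i , z)) (filter (not≟ z) (idx (suc (d + m))))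
      ≡⟨ cong (λ is → map (λ i → (i , z)) (filter (not≟ z) is)) (idx-suc (d + m)) ⟩
    map (λ i → (i , z)) (filter (not≟ z) (idx (d + m) ∷ʳ suc (d + m)))
      ≡⟨ cong (map _) (ListP.filter-++ (not≟ z) (idx (d + m)) _) ⟩
    map (λ i → (i , z)) (filter (not≟ z) (idx (d + m)) ++ filter (not≟ z) (suc (d + m) ∷ []))
      ≡⟨ ListP.map-++ _ (filter (not≟ z) (idx (d + m))) _ ⟩
    column (d + m) z ++ _
      ≡⟨ cong (_++ _) eq ⟩
    (column m z ++ ys) ++ _
      ≡⟨ ListP.++-assoc (column m z) ys _ ⟩
    column m z ++ ys ++ _ ∎)
  where open ≡-Reasoning

take-length-++ : ∀ {X : Set} (xs : List X) {ys} → take (length xs) (xs ++ ys) ≡ xs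
take-length-++ [] = refl
take-length-++ (x ∷ xs) = cong (x ∷_) (take-length-++ xs)

-- Column `z` omits row z ≤ k+1, so its first `k` variables reach down to row k+1. This is why the
-- row bound exceeds the index of `C` by one.
C≡D : ∀ {n z k} → 1 ≤ z → z ≤ suc k → suc k ≤ n → C n z k ≡ D (suc k) z
C≡D {n} {z} {k} 1≤z z≤sk sk≤n with ys , eq ← column-prefix (n ∸ suc k) (suc k) z = begin
  take k (map pos (column n z))
    ≡⟨ cong (λ m → take k (map pos (column m z))) (sym (ℕP.m∸n+n≡m sk≤n)) ⟩
  take k (map pos (column (n ∸ suc k + suc k) z))
    ≡⟨ cong (λ xs → take k (map pos xs)) eq ⟩
  take k (map pos (column (suc k) z ++ ys))
    ≡⟨ cong (take k) (ListP.map-++ pos (column (suc k) z) ys) ⟩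
  take k (D (suc k) z ++ map pos ys)
    ≡⟨ cong (λ m → take m (D (suc k) z ++ map pos ys)) (sym len) ⟩
  take (length (D (suc k) z)) (D (suc k) z ++ map pos ys)
    ≡⟨ take-length-++ (D (suc k) z) ⟩
  D (suc k) z ∎
  where
  open ≡-Reasoning
  len : length (D (suc k) z) ≡ k
  len = trans (ListP.length-map pos (column (suc k) z)) (trans (ListP.length-map _ (filter (not≟ z) (idx (suc k))))
    (others-length k 1≤z z≤sk))

C-rows : ∀ {n z k} → 1 ≤ z → z ≤ suc k → suc k ≤ n → Rows (C n z k) z (suc k)
C-rows {n} {z} {k} 1≤z z≤sk sk≤n = subst (λ c → Rows c z (suc k)) (sym (C≡D 1≤z z≤sk sk≤n)) (D-rows (suc k) z)

descending-refl : ∀ b → descending b b ≡ b ∷ []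
descending-refl b rewrite ℕP.n∸n≡0 b = refl

descending-suc : ∀ {a b} → b ≤ a → descending (suc a) b ≡ suc a ∷ descending a b
descending-suc {a} {b} b≤a rewrite ℕP.+-∸-assoc 1 b≤a = cong (suc a ∷_)
  (trans (ListP.map-applyUpTo suc (suc a ∸_) (suc (a ∸ b))) (sym (ListP.map-upTo (a ∸_) (suc (a ∸ b)))))

sameClauses : ∀ {cs ds xs} → Learned cs xs → Learned ds xs → Pointwise SameClause cs ds
sameClauses [] [] = []
sameClauses {c ∷ _} {d ∷ _} (R ∷ Rs) (Q ∷ Qs) = mk⇔ (move R Q) (move Q R) ∷ sameClauses Rs Qs
  where
  move : ∀ {c d z s l} → Rows c z s → Rows d z s → l ∈ c → l ∈ d
  move R Q l∈ with _ , refl , r ← rows⇒ R l∈ = ⇒rows Q r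

module Expected (p : ℕ) where

  open Schedule (3 + p) (s≤s (s≤s (s≤s z≤n)))

  n₃ : ℕ
  n₃ = 3 + p

  n₃≤n : n₃ ≤ n
  n₃≤n = ≤-trans (n≤1+n n₃) (≤-trans (n≤1+n n₂) (n≤1+n n₁))

  tailList : List Clause
  tailList = map (C n 1) (descending (n ∸ 4) 2)

  block : ℕ → List Clause
  block j = map (C n j) (descending (n ∸ 2) (j ∸ 1))

  tail-plan : ∀ m → 3 + m ≤ n → ∃ λ xs → Plan (tail (3 + m)) xs × Learned (map (C n 1) (descending (2 + m) 2)) ((1 , 3 + m) ∷ xs)
  tail-plan zero le = [] , p-end , C-rows ≤-refl (s≤s z≤n) le ∷ []
  tail-plan (suc m) le with xs , pl , L ← tail-plan m (≤-trans (n≤1+n _) le) =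
    (1 , 3 + m) ∷ xs , p-tail (s≤s (s≤s (s≤s z≤n))) pl ,
    subst (λ ds → Learned (map (C n 1) ds) ((1 , 4 + m) ∷ (1 , 3 + m) ∷ xs)) (sym (descending-suc {2 + m} {2} (s≤s (s≤s z≤n))))
      (C-rows ≤-refl (s≤s z≤n) le ∷ L)

  tail₁-plan : ∃ λ xs → Plan tail₁ xs × Learned tailList xs
  tail₁-plan with xs , pl , L ← tail-plan p n₃≤n = (1 , n₃) ∷ xs , p-tail₁ pl , L

  block-plan : ∀ i {cs ys} → Plan (dir (suc i) (suc (suc i))) ((suc i , suc i) ∷ ys) → Learned cs ys → suc i ≤ n →
    ∀ m → suc (suc m + i) ≤ n₁ →
    ∃ λ xs → Plan (dir (suc i) (suc (suc m + i))) xs × Learned (map (C n (suc i)) (descending (m + i) i) ++ cs) xs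
  block-plan i {cs} {ys} pl L i<n zero le = _ , pl ,
    subst (λ ds → Learned (map (C n (suc i)) ds ++ cs) ((suc i , suc i) ∷ ys)) (sym (descending-refl i)) (C-rows (s≤s z≤n) ≤-refl i<n ∷ L)
  block-plan i {cs} pl L i<n (suc m) le with xs , pl′ , L′ ← block-plan i pl L i<n m (≤-trans (n≤1+n _) le) =
    _ , p-dir (s≤s (s≤s (ℕP.m≤n+m i m))) pl′ ,
    subst (λ ds → Learned (map (C n (suc i)) ds ++ cs) ((suc i , suc (suc m + i)) ∷ xs)) (sym (descending-suc {m + i} {i} (ℕP.m≤n+m i m)))
      (C-rows (s≤s z≤n) (s≤s (≤-trans (ℕP.m≤n+m i m) (n≤1+n _))) (≤-trans (n≤1+n _) (≤-trans le (n≤1+n n₁))) ∷ L′)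

  via-plan : ∀ i {b cs ys} → Plan (dir (suc i) (suc (suc i))) ((suc i , suc i) ∷ ys) → Learned cs ys → i ≤ n₃ →
    ∃ λ xs → Plan (via b (suc i)) xs × Learned (block (suc i) ++ cs) xs
  via-plan i {cs = cs} pl L i≤n₃
    with xs , pl′ , L′ ← block-plan i pl L (≤-trans (s≤s i≤n₃) (≤-trans (n≤1+n n₂) (n≤1+n n₁))) (n₃ ∸ i)
           (subst (λ z → suc (suc z) ≤ n₁) (sym (ℕP.m∸n+n≡m i≤n₃)) ≤-refl)
    rewrite ℕP.m∸n+n≡m i≤n₃ =
    (suc i , n₁) ∷ xs , p-via pl′ ,
    subst (λ ds → Learned (map (C n (suc i)) ds ++ cs) ((suc i , n₁) ∷ xs)) (sym (descending-suc {n₃} {i} i≤n₃))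
      (C-rows (s≤s z≤n) (s≤s (≤-trans i≤n₃ (n≤1+n n₃))) (n≤1+n n₁) ∷ L′)

  -- The column `b` stays open because it is fixed by what comes before the block: column 1 after
  -- the head, the column of the preceding block otherwise.
  cascade-plan : ∀ i {b} → suc i ≤ n₃ →
    ∃ λ xs → Plan (via b (2 + i)) xs × Learned (concatMap block (descending (2 + i) 2) ++ tailList) xs
  cascade-plan zero 1≤n₃ with ys , pl , L ← tail₁-plan with xs , pl′ , L′ ← via-plan 1 (p-dir-tail pl) L 1≤n₃ =
    xs , pl′ , subst (λ cs → Learned cs xs) (cong (_++ tailList) (sym (ListP.++-identityʳ (block 2)))) L′
  cascade-plan (suc i) le with ys , pl , L ← cascade-plan i {3 + i} (≤-trans (n≤1+n _) le)
    with xs , pl′ , L′ ← via-plan (2 + i) (p-dir-via (s≤s (s≤s z≤n)) pl) L le =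
    xs , pl′ , subst (λ cs → Learned cs xs)
      (trans (sym (ListP.++-assoc (block (3 + i)) _ tailList))
        (cong (λ ds → concatMap block ds ++ tailList) (sym (descending-suc {2 + i} {2} (s≤s (s≤s z≤n)))))) L′

  head-plan : ∀ {xs cs} → Plan (via 1 n₂) xs → Learned cs xs →
    Plan head₁ ((1 , n₁) ∷ (1 , n₂) ∷ xs) × Learned (C n 1 n₂ ∷ C n 1 n₃ ∷ cs) ((1 , n₁) ∷ (1 , n₂) ∷ xs)
  head-plan pl L = p-head₁ (p-head₂ pl) ,
    C-rows ≤-refl (s≤s z≤n) (n≤1+n n₁) ∷ C-rows ≤-refl (s≤s z≤n) (≤-trans (n≤1+n n₂) (n≤1+n n₁)) ∷ L

  full-plan : ∃ λ xs → Plan head₁ xs × Learned (expectedLearned n) xs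
  full-plan = let (xs , pl , L) = cascade-plan (2 + p) ≤-refl in (1 , n₁) ∷ (1 , n₂) ∷ xs , head-plan pl L

theorem4 : (n : ℕ) (δ : ℚ) → 6 ≤ n → 0ℚ <ℚ δ → δ ≤ℚ ½ →
    Acc (λ c′ c → Step n δ c c′) initial
    × (∀ c → Star (Step n δ) initial c → Stuck n δ c →
    ∃ λ ls → c ≡ unsat ls × Pointwise SameClause ls (expectedLearned n))
theorem4 _ δ (s≤s (s≤s (s≤s (s≤s (s≤s (s≤s {n = p} _)))))) 0<δ δ≤½ =
  let (xs , pl , L) = Expected.full-plan p in
  wins pl {[]} {[]} (λ ()) (fHead₁ refl zero-dominates) [] zero-inv (λ L′ → sameClauses L′ L)
  where
  open Schedule (3 + p) (s≤s (s≤s (s≤s z≤n)))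
  open Play δ 0<δ δ≤½ (λ ls → Pointwise SameClause ls (expectedLearned n))
  open Scores δ 0<δ δ≤½ using (zero-inv)
  -- Initially all scores are 0 and the tie-break selects column 1; the strict half is vacuous, as
  -- no column lies to its left.
  zero-dominates : Dominates (λ _ → 0ℚ) 1 n₁
  zero-dominates _ _ 1≤z = (λ z<1 → contradiction (≤-trans z<1 1≤z) (<-irrefl refl)) , (λ _ → ℚP.≤-refl)
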